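{- Let $\mathcal A$ be an arrangement of $n$ hyperplanes of rank $r$ in a finite-dimensional complex vector space $V$. Then $$\mathrm{Hilb}(C_{\mathcal A,-2};q)=q^{n-r}\,T_{\mathcal A}\!\left(0,\frac1q\right).$$
   Context: $\mathbb C[V^*]$ denotes the algebra of polynomial functions on $V$. A (central) arrangement $\mathcal A=\{H_1,\dots,H_n\}$ in $V$ is a finite collection (repetitions allowed) of hyperplanes $H_i=\{l_i=0\}$ with $l_i\in V^*$; the degenerate case $l_i=0$ (a loop) is allowed. Its matroid is the linear matroid of $l_1,\dots,l_n$ with rank function $r(\cdot)$; the rank of $\mathcal A$ is $r=\dim\mathrm{span}(l_1,\dots,l_n)$. For nonzero $h\in V$, $\rho_{\mathcal A}(h)$ is the number of hyperplanes of $\mathcal A$ not containing $h$, i.e. the number of $i$ with $l_i(h)\neq 0$. $C_{\mathcal A,-2}$ is the space of $f\in\mathbb C[V^*]$ such that for every nonzero $h\in V$ the restriction of $f$ to every affine line of direction $h$ has degree at most $\rho_{\mathcal A}(h)-2$ (only the zero polynomial has negative degree), i.e. the $(\rho_{\mathcal A}(h)-1)$-th power of the directional derivative along $h$ annihilates $f$; it is graded by degree, and $\mathrm{Hilb}(C;q)=\sum_i \dim C_i\,q^i$. The Tutte polynomial is $T_{\mathcal A}(x,y)=\sum_{S\subseteq[n]}(x-1)^{r-r(S)}(y-1)^{|S|-r(S)}$.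
   Formalization: The arrangement is assumed essential (r = dim V), since otherwise the identity fails, e.g. n = 0, V = ℂ gives 0 = 1; and ℂ is replaced by any field of characteristic 0 with decidable apartness, of which ℂ is an instance by excluded middle. -}

module Defs where

open import Level using (Level; _⊔_; Lift) renaming (suc to lsuc)
open import Algebra.Apartness.Bundles using (HeytingCommutativeRing; HeytingField)
open import Algebra.Bundles using (CommutativeRing; RawRing)
import Algebra.Construct.Pointwise as Pointwise
import Algebra.Definitions.RawSemiring as RawSemiringOps
import Algebra.Definitions.RawMonoid as RawMonoidOps
open import Algebra.Module.Bundles using (Module; LeftModule)
import Algebra.Module.Construct.TensorUnit as TensorUnit
open import Algebra.Module.Morphism.Structures using (module ModuleMorphisms)
open import Data.Bool using (if_then_else_)
open import Data.Fin using (Fin; toℕ)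
open import Data.Fin.Subset using (Subset; inside; outside; ⊤; ∣_∣; _∉_)
open import Data.Integer as ℤ using (ℤ; +_; -[1+_])
open import Data.List as List using (List; []; _∷_; _++_; allFin; filter; length; cartesianProductWith)
open import Data.Nat as ℕ using (ℕ; zero; suc; _∸_)
open import Data.Product using (Σ; Σ-syntax; ∃; ∃-syntax; _×_; _,_)
open import Data.Vec as Vec using ([]; _∷_)
open import Relation.Binary.Definitions using (Decidable)
open import Relation.Binary.PropositionalEquality using (_≡_)
open import Relation.Nullary using (¬_; does)
open import Relation.Unary using (Pred; U)

-- Stands in for ℂ, which the library does not provide. Decidability of _#_
-- makes x # y the same as ¬ (x ≈ y), and lets one count nonzero values.
record CharZeroField c ℓ₁ ℓ₂ : Set (lsuc (c ⊔ ℓ₁ ⊔ ℓ₂)) where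
  field
    heytingField : HeytingField c ℓ₁ ℓ₂

  open HeytingField heytingField public

  commutativeRing : CommutativeRing c ℓ₁
  commutativeRing = HeytingCommutativeRing.commutativeRing heytingCommutativeRing

  open CommutativeRing commutativeRing public
    using (ring; rawRing)
  open RawSemiringOps (RawRing.rawSemiring rawRing) public
    using (sum; _^_) renaming (_×_ to _·_)

  field
    _#?_               : Decidable _#_
    characteristicZero : ∀ k → ¬ (suc k · 1# ≈ 0#)

module _ {c ℓ₁ ℓ₂} (K : CharZeroField c ℓ₁ ℓ₂) where

  private
    module K = CharZeroField K

  module _ {m ℓm} (M : LeftModule K.ring m ℓm) where
    open LeftModule M

    linearCombination : ∀ {d} → (Fin d → K.Carrier) → (Fin d → Carrierᴹ) → Carrierᴹ
    linearCombination a b = RawMonoidOps.sum +ᴹ-rawMonoid (λ j → a j *ₗ b j)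

    -- Meant for P a linear subspace of M: the family b is then a basis of P.
    record HasDimension {p} (P : Pred Carrierᴹ p) (d : ℕ) : Set (c ⊔ ℓ₁ ⊔ m ⊔ ℓm ⊔ p) where
      field
        b           : Fin d → Carrierᴹ
        inside-P    : ∀ j → P (b j)
        independent : ∀ a → linearCombination a b ≈ᴹ 0ᴹ → ∀ j → a j K.≈ K.0#
        spanning    : ∀ {x} → P x → ∃[ a ] x ≈ᴹ linearCombination a b

  -- Degree at most d, for a polynomial function of one variable;
  -- only the zero function has negative degree.
  DegreeAtMost : ℤ → (K.Carrier → K.Carrier) → Set (c ⊔ ℓ₁)
  DegreeAtMost (+ d)    p =
    Σ[ a ∈ (Fin (suc d) → K.Carrier) ] ∀ t → p t K.≈ K.sum (λ j → a j K.* t K.^ toℕ j)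
  DegreeAtMost -[1+ _ ] p = Lift c (∀ t → p t K.≈ K.0#)

  module _ {m ℓm} (V : Module K.commutativeRing m ℓm) where

    private
      module V = Module V

    FiniteDimensional : Set (c ⊔ ℓ₁ ⊔ m ⊔ ℓm)
    FiniteDimensional = ∃[ d ] HasDimension V.leftModule U d

    Function : Set (c ⊔ m)
    Function = V.Carrierᴹ → K.Carrier

    functionRing : CommutativeRing (c ⊔ m) (ℓ₁ ⊔ m)
    functionRing = Pointwise.commutativeRing V.Carrierᴹ K.commutativeRing

    private
      module F = CommutativeRing functionRing
      module S = LeftModule (TensorUnit.leftModule {R = K.ring})

    -- All functions V → K with pointwise operations. V*, and the homogeneous
    -- polynomial functions of each degree, are subspaces of it.
    functions : LeftModule K.ring (c ⊔ m) (ℓ₁ ⊔ m)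
    functions = record
      { Carrierᴹ = Function
      ; _≈ᴹ_     = F._≈_
      ; _+ᴹ_     = F._+_
      ; _*ₗ_     = λ a f v → a K.* f v
      ; 0ᴹ       = F.0#
      ; -ᴹ_      = F.-_
      ; isLeftModule = record
        { isLeftSemimodule = record
          { +ᴹ-isCommutativeMonoid = F.+-isCommutativeMonoid
          ; isPreleftSemimodule = record
            { *ₗ-cong      = λ a≈b f≈g v → S.*ₗ-cong a≈b (f≈g v)
            ; *ₗ-zeroˡ     = λ f v → S.*ₗ-zeroˡ (f v)
            ; *ₗ-distribʳ  = λ f a b v → S.*ₗ-distribʳ (f v) a b
            ; *ₗ-identityˡ = λ f v → S.*ₗ-identityˡ (f v)
            ; *ₗ-assoc     = λ a b f v → S.*ₗ-assoc a b (f v)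
            ; *ₗ-zeroʳ     = λ a v → S.*ₗ-zeroʳ a
            ; *ₗ-distribˡ  = λ a f g v → S.*ₗ-distribˡ a (f v) (g v)
            }
          }
        ; -ᴹ‿cong    = λ f≈g v → S.-ᴹ‿cong (f≈g v)
        ; -ᴹ‿inverse = F.-‿inverse
        }
      }

    record LinearForm : Set (c ⊔ ℓ₁ ⊔ m ⊔ ℓm) where
      field
        ⟦_⟧ : Function
        isModuleHomomorphism :
          ModuleMorphisms.IsModuleHomomorphism V.rawModule
            (Module.rawModule (TensorUnit.⟨module⟩ {R = K.commutativeRing})) ⟦_⟧

    open LinearForm

    -- The span of the d-fold products of linear forms: the homogeneous
    -- polynomial functions of degree d, including 0.
    data IsHomogeneous : ℕ → Pred Function (c ⊔ ℓ₁ ⊔ m ⊔ ℓm) where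
      constant : ∀ a → IsHomogeneous 0 (λ _ → a)
      multiply : ∀ {d f} (φ : LinearForm) → IsHomogeneous d f →
                 IsHomogeneous (suc d) (⟦ φ ⟧ F.* f)
      add      : ∀ {d f g} → IsHomogeneous d f → IsHomogeneous d g →
                 IsHomogeneous d (f F.+ g)
      respects : ∀ {d f g} → f F.≈ g → IsHomogeneous d f → IsHomogeneous d g

    IsPolynomial : Pred Function (c ⊔ ℓ₁ ⊔ m ⊔ ℓm)
    IsPolynomial f =
      ∃[ e ] Σ[ g ∈ (Fin e → Function) ]
        (∀ j → IsHomogeneous (toℕ j) (g j)) × f F.≈ RawMonoidOps.sum F.+-rawMonoid g

    -- The i-th hyperplane is the zero set of the i-th form.
    Arrangement : ℕ → Set (c ⊔ ℓ₁ ⊔ m ⊔ ℓm)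
    Arrangement n = Fin n → LinearForm

    module _ {n} (A : Arrangement n) where

      Span : Subset n → Pred Function (c ⊔ ℓ₁ ⊔ m)
      Span S f = Σ[ a ∈ (Fin n → K.Carrier) ]
        (∀ {i} → i ∉ S → a i K.≈ K.0#) ×
        f F.≈ linearCombination functions a (λ i → ⟦ A i ⟧)

      record RankFunction : Set (c ⊔ ℓ₁ ⊔ m) where
        field
          rank   : Subset n → ℕ
          isRank : ∀ S → HasDimension functions (Span S) (rank S)

      -- Equivalently, rank ⊤ = dim V. Otherwise ρ h = 0 for some h ≠ 0, and then
      -- C k contains only 0 for every k < 0, whatever the Tutte polynomial is.
      Essential : Set (ℓ₁ ⊔ m ⊔ ℓm)
      Essential = ∀ v → (∀ i → ⟦ A i ⟧ v K.≈ K.0#) → v V.≈ᴹ V.0ᴹ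

      ρ : V.Carrierᴹ → ℕ
      ρ h = length (filter (λ i → ⟦ A i ⟧ h K.#? K.0#) (allFin n))

      C : ℤ → Pred Function (c ⊔ ℓ₁ ⊔ m ⊔ ℓm)
      C k f = IsPolynomial f ×
        (∀ h → ¬ (h V.≈ᴹ V.0ᴹ) → ∀ v →
          DegreeAtMost (+ ρ h ℤ.+ k) (λ t → f (v V.+ᴹ t V.*ₗ h)))

      Cᵢ : ℤ → ℕ → Pred Function (c ⊔ ℓ₁ ⊔ m ⊔ ℓm)
      Cᵢ k i f = C k f × IsHomogeneous i f

      -- The power series Σᵢ (hilb i) qⁱ is the Hilbert series of C k.
      IsHilbertSeries : ℤ → (ℕ → ℕ) → Set (c ⊔ ℓ₁ ⊔ m ⊔ ℓm)
      IsHilbertSeries k hilb = ∀ i → HasDimension functions (Cᵢ k i) (hilb i)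

subsets : ∀ n → List (Subset n)
subsets zero    = [] ∷ []
subsets (suc n) = List.map (inside ∷_) (subsets n) ++ List.map (outside ∷_) (subsets n)

-- The value at x, y in R of the Tutte polynomial of the matroid on Fin n with
-- rank function rank. No ∸ truncates, as rank S ≤ rank ⊤ and rank S ≤ ∣ S ∣.
tutte : ∀ {a ℓ} (R : RawRing a ℓ) {n} (rank : Subset n → ℕ) →
        let open RawRing R in Carrier → Carrier → Carrier
tutte R {n} rank x y =
  List.foldr _+_ 0# (List.map term (subsets n))
  where
  open RawRing R
  open RawSemiringOps rawSemiring using (_^_)
  term : Subset n → Carrier
  term S = (x + - 1#) ^ (rank ⊤ ∸ rank S) * (y + - 1#) ^ (∣ S ∣ ∸ rank S)

-- Laurent polynomials over ℤ in q, as formal sums of monomials: (a , e) stands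
-- for a qᵉ, and exponents may repeat. They are compared by their coefficients.
Laurent : Set
Laurent = List (ℤ × ℤ)

coefficient : Laurent → ℤ → ℤ
coefficient []            e = + 0
coefficient ((a , e′) ∷ p) e =
  (if does (e′ ℤ.≟ e) then a else + 0) ℤ.+ coefficient p e

laurent : RawRing _ _
laurent = record
  { Carrier = Laurent
  ; _≈_     = λ p p′ → ∀ e → coefficient p e ≡ coefficient p′ e
  ; _+_     = _++_
  ; _*_     = cartesianProductWith (λ (a , e) (a′ , e′) → a ℤ.* a′ , e ℤ.+ e′)
  ; -_      = List.map (λ (a , e) → ℤ.- a , e)
  ; 0#      = []
  ; 1#      = (+ 1 , + 0) ∷ []
  }

q^ : ℤ → Laurent
q^ e = (+ 1 , e) ∷ []

seriesCoefficient : (ℕ → ℕ) → ℤ → ℤ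
seriesCoefficient s (+ i)    = + s i
seriesCoefficient s -[1+ _ ] = + 0

{-# OPTIONS --safe #-}
module Submission where

-- Write l for the first form. If l is a loop, it can be dropped; if l is a coloop, then C₋₂ = 0.
-- Otherwise deletion and contraction of l give an exact sequence
--   0 → C₋₂(A ∖ l)(-1) → C₋₂(A) → C₋₂(A / l) → 0
-- with maps multiplication by l and restriction to l = 0, matching the recursion of qⁿ⁻ʳ T(0, 1/q).
-- Only the surjectivity is hard. Let P(A) be the span of the products of forms whose complementary
-- forms still span; P(A) = C₋₁(A) by the same deletion-contraction argument, in which surjectivity is
-- clear as products of forms lift. So an element of C₋₂(A / l) has a lift f in P(A), and f is in C₋₂(A)
-- once it is in P(A ∖ b) for all b ≠ l, unless A has a coloop, but then C₋₂(A / l) = 0. Treat one b after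
-- the other. The obstruction along a direction h with b(h) ≠ 0 is the coefficient s of t to the power
-- ρ(h) - 1 in f(v + t h). The function s · ∏ y, the product over the forms y ≠ b with y(h) ≠ 0, lies
-- again in P(A) and has, up to a factor, the same obstruction along h, a vanishing one along the other
-- directions off b = 0, and restriction 0 to l = 0. It lies in each P(A ∖ b′) that contains f, provided
-- b′(h) = 0; if b′(h) ≠ 0, then the obstruction vanishes anyway. Up to scaling and the common kernel of
-- the forms only finitely many directions matter.
--
-- The space V is fixed throughout: the contraction A / l consists of the forms y - y(u) l on V, for
-- some u with l(u) = 1, and C₋₂ is defined for arrangements that need not be essential by requiring
-- invariance along the directions with ρ(h) = 0.
open import Defs
open import Level using (Level; _⊔_; Lift)
open import Algebra.Bundles using (RawRing; CommutativeRing)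
import Algebra.Apartness.Properties.HeytingCommutativeRing as HCRProperties
import Algebra.Definitions.RawMonoid as RawMonoidOps
import Algebra.Definitions.RawSemiring as RawSemiringOps
open import Algebra.Module.Bundles using (Module; LeftModule)
import Algebra.Module.Construct.TensorUnit as TensorUnit
open import Algebra.Module.Morphism.Structures using (module ModuleMorphisms)
import Algebra.Properties.CommutativeMonoid.Sum as CommutativeMonoidSum
import Algebra.Properties.Ring as RingProperties
import Algebra.Properties.Semiring.Mult as SemiringMult
import Algebra.Properties.Semiring.Sum as SemiringSum
import Algebra.Solver.Ring as RingSolver
import Algebra.Solver.Ring.AlmostCommutativeRing as ACR
import Algebra.Solver.Ring.NaturalCoefficients.Default as NatSolver
open import Data.Bool using (if_then_else_)
open import Data.Fin using (Fin; zero; suc; toℕ; punchIn; _↑ˡ_; _↑ʳ_)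
import Data.Fin.Properties as FinP
open import Data.Fin.Subset using (Subset; inside; outside; ⊤; ⊥; ⁅_⁆; ∁; _∈_; _∉_; _⊆_; _∪_; _─_; ∣_∣) renaming (_-_ to _∖_)
open import Data.Fin.Subset.Properties using (_∈?_; ∈⊤; x∈⁅x⁆; x∈⁅y⁆⇒x≡y; ∣⁅x⁆∣≡1; ∣⊥∣≡0; drop-∷-⊆; ⊆-antisym; x∈p∧x≢y⇒x∈p-y; x∈p∧x∉q⇒x∈p─q; p─q⊆p; x∈p∪q⁺; x∈p∪q⁻; x∉p⇒x∈∁p; x∈∁p⇒x∉p)
open import Data.Integer as ℤ using (ℤ)
import Data.Integer.Properties as ℤP
open import Data.Integer.Solver using (module +-*-Solver)
open import Data.List as List using (List; []; _∷_; _++_; allFin; filter; length; tabulate)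
open import Data.List.Membership.Propositional using () renaming (_∈_ to _∈ₗ_)
open import Data.List.Membership.Propositional.Properties using (∈-++⁺ˡ; ∈-++⁺ʳ; ∈-map⁺; ∈-allFin)
open import Data.List.Relation.Unary.All as All using (All; []; _∷_)
open import Data.List.Relation.Unary.Any using (here; there)
open import Data.Maybe using (Maybe; just; nothing)
open import Data.Nat as ℕ using (ℕ; zero; suc; _∸_)
import Data.Nat.Properties as ℕP
open import Data.Product using (Σ; Σ-syntax; ∃; _×_; _,_; proj₁; proj₂)
open import Data.Sum using (_⊎_; inj₁; inj₂; [_,_]′)
open import Data.Unit.Polymorphic using (tt) renaming (⊤ to Unit)
open import Data.Vec using ([]; _∷_; here; there)
open import Data.Vec.Functional using (removeAt; insertAt) renaming (_∷_ to _∷ᶠ_)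
import Data.Vec.Functional.Properties as VectorP
open import Function using (_∘_)
open import Relation.Binary.PropositionalEquality as ≡ using (_≡_; _≢_)
import Relation.Binary.Reasoning.Setoid as SetoidReasoning
open import Relation.Nullary using (¬_; Dec; yes; no; does; contradiction)
open import Relation.Nullary.Decidable using (¬?; _×-dec_)
open import Relation.Unary using (Pred)

-- Why membership in P of the deletions measures progress: off b = 0, deleting b lowers ρ by one, so
-- the bound of C₋₁ for the deletion is the bound of C₋₂ for A. One membership controls all
-- directions off b = 0 at once, and it survives later corrections because the symbols can be
-- computed inside P of the deletion. The forms b ≠ l suffice, since a direction at which only l is
-- nonzero would make l a coloop. Coloops are excluded because ρ = 1 leaves the deletion with ρ = 0,
-- where C₋₁ still allows constants but C₋₂ demands 0. Keeping V fixed makes all spaces in the exact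
-- sequence subspaces of one space of functions. The price is that u lies in the common kernel of
-- the contraction; invariance along the common kernel then replaces passing to a quotient of V.
-- Every case distinction must be decidable. Scalars have decidable apartness; for forms and spans
-- this is extended by a basis of V, and for directions by one candidate for each set of forms.

-- A ring solver with integer coefficients

module IntegerSolver {c ℓ : Level} (R : CommutativeRing c ℓ) where
  open CommutativeRing R
  open RingProperties ring using (-‿+-comm; -‿distribˡ-*; -‿distribʳ-*; -‿involutive; -0#≈0#)
  open SemiringMult semiring using (×-homo-+; ×1-homo-*; ×-congˡ) renaming (_×_ to _·_)
  open SetoidReasoning setoid
  private
    module N = NatSolver commutativeSemiring
    open N using (_:=_; _:+_; _:*_)

  -- The pair (m , n) stands for the integer m - n.
  differences : RawRing _ _
  differences = record
    { Carrier = ℕ × ℕ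
    ; _≈_     = _≡_
    ; _+_     = λ (a , b) (c , d) → a ℕ.+ c , b ℕ.+ d
    ; _*_     = λ (a , b) (c , d) → a ℕ.* c ℕ.+ b ℕ.* d , a ℕ.* d ℕ.+ b ℕ.* c
    ; -_      = λ (a , b) → b , a
    ; 0#      = 0 , 0
    ; 1#      = 1 , 0
    }

  private
    ι : ℕ → Carrier
    ι n = n · 1#

    ι-+ : ∀ m n → ι (m ℕ.+ n) ≈ ι m + ι n
    ι-+ = ×-homo-+ 1#

    ⟦_⟧ : ℕ × ℕ → Carrier
    ⟦ a , b ⟧ = ι a - ι b

    +-homo : ∀ x y → ⟦ RawRing._+_ differences x y ⟧ ≈ ⟦ x ⟧ + ⟦ y ⟧
    +-homo (a , b) (c , d) = begin
      ι (a ℕ.+ c) - ι (b ℕ.+ d)         ≈⟨ +-cong (ι-+ a c) (-‿cong (ι-+ b d)) ⟩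
      (ι a + ι c) - (ι b + ι d)         ≈⟨ +-congˡ (-‿+-comm _ _) ⟨
      (ι a + ι c) + (- ι b + - ι d)     ≈⟨ N.solve 4 (λ p q r s → (p :+ q) :+ (r :+ s) := (p :+ r) :+ (q :+ s)) refl _ _ _ _ ⟩
      (ι a - ι b) + (ι c - ι d)         ∎

    ι-+* : ∀ a b c d → ι (a ℕ.* c ℕ.+ b ℕ.* d) ≈ ι a * ι c + ι b * ι d
    ι-+* a b c d = trans (ι-+ (a ℕ.* c) (b ℕ.* d)) (+-cong (×1-homo-* a c) (×1-homo-* b d))

    *-homo : ∀ x y → ⟦ RawRing._*_ differences x y ⟧ ≈ ⟦ x ⟧ * ⟦ y ⟧
    *-homo (a , b) (c , d) = begin
      ι (a ℕ.* c ℕ.+ b ℕ.* d) - ι (a ℕ.* d ℕ.+ b ℕ.* c)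
        ≈⟨ +-cong (ι-+* a b c d) (-‿cong (ι-+* a b d c)) ⟩
      (ι a * ι c + ι b * ι d) - (ι a * ι d + ι b * ι c)
        ≈⟨ +-cong (+-congˡ (-‿involutive _)) (-‿+-comm _ _) ⟨
      (ι a * ι c + - - (ι b * ι d)) + (- (ι a * ι d) + - (ι b * ι c))
        ≈⟨ +-cong (+-congˡ (trans (-‿cong (-‿distribʳ-* _ _)) (-‿distribˡ-* _ _))) (+-cong (-‿distribʳ-* _ _) (-‿distribˡ-* _ _)) ⟩
      (ι a * ι c + - ι b * - ι d) + (ι a * - ι d + - ι b * ι c)
        ≈⟨ N.solve 4 (λ p q r s → (p :* r :+ q :* s) :+ (p :* s :+ q :* r) := (p :+ q) :* (r :+ s)) refl _ _ _ _ ⟩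
      (ι a - ι b) * (ι c - ι d) ∎

    -‿homo : ∀ x → ⟦ RawRing.-_ differences x ⟧ ≈ - ⟦ x ⟧
    -‿homo (a , b) = begin
      ι b + - ι a     ≈⟨ +-comm _ _ ⟩
      - ι a + ι b     ≈⟨ +-congˡ (-‿involutive _) ⟨
      - ι a + - - ι b ≈⟨ -‿+-comm _ _ ⟩
      - (ι a - ι b)   ∎

    -- Agrees with ⟦_⟧, but sends the constants 0 and 1 to 0# and 1# on the nose.
    ⟦_⟧′ : ℕ × ℕ → Carrier
    ⟦ 0 , 0 ⟧′ = 0#
    ⟦ 1 , 0 ⟧′ = 1#
    ⟦ x ⟧′     = ⟦ x ⟧

    agree : ∀ x → ⟦ x ⟧′ ≈ ⟦ x ⟧
    agree (0 , 0)           = sym (-‿inverseʳ 0#)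
    agree (1 , 0)           = sym (trans (+-cong (+-identityʳ 1#) -0#≈0#) (+-identityʳ 1#))
    agree (0 , suc _)       = refl
    agree (1 , suc _)       = refl
    agree (suc (suc _) , _) = refl

    morphism : differences ACR.-Raw-AlmostCommutative⟶ ACR.fromCommutativeRing R
    morphism = record
      { ⟦_⟧    = ⟦_⟧′
      ; +-homo = λ x y → trans (agree (RawRing._+_ differences x y)) (trans (+-homo x y) (sym (+-cong (agree x) (agree y))))
      ; *-homo = λ x y → trans (agree (RawRing._*_ differences x y)) (trans (*-homo x y) (sym (*-cong (agree x) (agree y))))
      ; -‿homo = λ x → trans (agree (RawRing.-_ differences x)) (trans (-‿homo x) (sym (-‿cong (agree x))))
      ; 0-homo = refl
      ; 1-homo = refl
      }

    cross : ∀ a b c d → a ℕ.+ d ≡ c ℕ.+ b → ι a - ι b ≈ ι c - ι d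
    cross a b c d eq = begin
      ι a - ι b                     ≈⟨ +-identityʳ _ ⟨
      (ι a - ι b) + 0#              ≈⟨ +-congˡ (-‿inverseʳ (ι d)) ⟨
      (ι a - ι b) + (ι d - ι d)     ≈⟨ N.solve 4 (λ p q r s → (p :+ q) :+ (r :+ s) := (p :+ r) :+ (q :+ s)) refl _ _ _ _ ⟩
      (ι a + ι d) + (- ι b - ι d)   ≈⟨ +-congʳ (trans (sym (ι-+ a d)) (trans (×-congˡ eq) (ι-+ c b))) ⟩
      (ι c + ι b) + (- ι b - ι d)   ≈⟨ N.solve 4 (λ p q r s → (p :+ q) :+ (r :+ s) := (p :+ s) :+ (q :+ r)) refl _ _ _ _ ⟩
      (ι c - ι d) + (ι b - ι b)     ≈⟨ +-congˡ (-‿inverseʳ (ι b)) ⟩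
      (ι c - ι d) + 0#              ≈⟨ +-identityʳ _ ⟩
      ι c - ι d                     ∎

    -- Pairs are not normalised, so integers are compared by cross-addition. Negative coefficients
    -- are what lets the solver cancel terms of opposite sign.
    _≟_ : ∀ x y → Maybe (⟦ x ⟧′ ≈ ⟦ y ⟧′)
    (a , b) ≟ (c , d) with a ℕ.+ d ℕ.≟ c ℕ.+ b
    ... | yes eq = just (trans (agree (a , b)) (trans (cross a b c d eq) (sym (agree (c , d)))))
    ... | no  _  = nothing

  open RingSolver differences (ACR.fromCommutativeRing R) morphism _≟_ public
    using (solve; _:=_; _:+_; _:*_; _:-_; :-_; con; Polynomial)

  :0 :1 : ∀ {n} → Polynomial n
  :0 = con (0 , 0)
  :1 = con (1 , 0)

-- Field arithmetic

module Field {c ℓ₁ ℓ₂ : Level} (K : CharZeroField c ℓ₁ ℓ₂) where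
  private module K = CharZeroField K
  open K public using (_#_; _#?_; characteristicZero; _·_; #⇒invertible; tight)
  open CommutativeRing K.commutativeRing public hiding (_≉_; zero) renaming (Carrier to 𝕂)
  open HCRProperties K.heytingCommutativeRing public using (1#0; x#0y#0→xy#0; #-congʳ; x-0≈x)
  open SemiringSum semiring public
  open IntegerSolver K.commutativeRing public


  zero-or-apart : ∀ x → x # 0# ⊎ x ≈ 0#
  zero-or-apart x with x #? 0#
  ... | yes x#0 = inj₁ x#0
  ... | no ¬x#0 = inj₂ (proj₁ (tight x 0#) ¬x#0)

  #⇒≉ : ∀ {x} → x # 0# → ¬ (x ≈ 0#)
  #⇒≉ x#0 x≈0 = proj₂ (tight _ _) x≈0 x#0

  ≉⇒# : ∀ {x} → ¬ (x ≈ 0#) → x # 0#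
  ≉⇒# {x} x≉0 with zero-or-apart x
  ... | inj₁ x#0 = x#0
  ... | inj₂ x≈0 = contradiction x≈0 x≉0

  #-resp : ∀ {x y} → x ≈ y → x # 0# → y # 0#
  #-resp x≈y = #-congʳ x≈y

  inverse : ∀ {x} → x # 0# → Σ[ y ∈ 𝕂 ] y * x ≈ 1#
  inverse {x} x#0 with #⇒invertible x#0
  ... | y , eq , _ = y , trans (*-congˡ (sym (x-0≈x x))) eq

  infix 8 _⁻¹
  _⁻¹ : ∀ {x} → x # 0# → 𝕂
  p ⁻¹ = proj₁ (inverse p)

  ⁻¹-inverseˡ : ∀ {x} (p : x # 0#) → p ⁻¹ * x ≈ 1#
  ⁻¹-inverseˡ p = proj₂ (inverse p)

  x≈[yx⁻¹]x : ∀ {x} (p : x # 0#) y → y ≈ (y * p ⁻¹) * x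
  x≈[yx⁻¹]x {x} p y = begin
    y                ≈⟨ *-identityʳ y ⟨
    y * 1#           ≈⟨ *-congˡ (⁻¹-inverseˡ p) ⟨
    y * (p ⁻¹ * x)   ≈⟨ *-assoc _ _ _ ⟨
    (y * p ⁻¹) * x   ∎
    where open SetoidReasoning setoid

  cancel-zero : ∀ {x y} → x # 0# → x * y ≈ 0# → y ≈ 0#
  cancel-zero {x} {y} x#0 eq = begin
    y                  ≈⟨ *-identityˡ y ⟨
    1# * y             ≈⟨ *-congʳ (⁻¹-inverseˡ x#0) ⟨
    (x#0 ⁻¹ * x) * y   ≈⟨ *-assoc _ _ _ ⟩
    x#0 ⁻¹ * (x * y)   ≈⟨ *-congˡ eq ⟩
    x#0 ⁻¹ * 0#        ≈⟨ zeroʳ _ ⟩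
    0#                 ∎
    where open SetoidReasoning setoid

  x-y≈0⇒x≈y : ∀ {x y} → x - y ≈ 0# → x ≈ y
  x-y≈0⇒x≈y {x} {y} eq = begin
    x              ≈⟨ solve 2 (λ x y → x := (x :- y) :+ y) refl x y ⟩
    (x - y) + y    ≈⟨ +-congʳ eq ⟩
    0# + y         ≈⟨ +-identityˡ y ⟩
    y              ∎
    where open SetoidReasoning setoid

  suc·#0 : ∀ m → suc m · 1# # 0#
  suc·#0 m = ≉⇒# (characteristicZero m)

-- Polynomial functions of one variable

module Univariate {c ℓ₁ ℓ₂ : Level} (K : CharZeroField c ℓ₁ ℓ₂) where
  open Field K
  open SetoidReasoning setoid

  -- Below k p: the function p is a polynomial of degree < k.
  Below : ℕ → (𝕂 → 𝕂) → Set (c ⊔ ℓ₁)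
  Below zero    p = Level.Lift c (∀ t → p t ≈ 0#)
  Below (suc k) p = Σ[ a ∈ 𝕂 ] Σ[ q ∈ (𝕂 → 𝕂) ] Below k q × (∀ t → p t ≈ a + t * q t)

  -- Top m p s: the function p is a polynomial of degree ≤ m in which tᵐ has the coefficient s.
  Top : ℕ → (𝕂 → 𝕂) → 𝕂 → Set (c ⊔ ℓ₁)
  Top zero    p s = Level.Lift c (∀ t → p t ≈ s)
  Top (suc m) p s = Σ[ a ∈ 𝕂 ] Σ[ q ∈ (𝕂 → 𝕂) ] Top m q s × (∀ t → p t ≈ a + t * q t)

  below-resp : ∀ k {p q} → (∀ t → p t ≈ q t) → Below k p → Below k q
  below-resp zero    eq (Level.lift z)   = Level.lift λ t → trans (sym (eq t)) (z t)
  below-resp (suc k) eq (a , r , br , e) = a , r , br , λ t → trans (sym (eq t)) (e t)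

  below-0 : ∀ k {p} → (∀ t → p t ≈ 0#) → Below k p
  below-0 zero    z = Level.lift z
  below-0 (suc k) z = 0# , (λ _ → 0#) , below-0 k (λ _ → refl) ,
    λ t → trans (z t) (solve 1 (λ t → :0 := :0 :+ t :* :0) refl t)

  below-+ : ∀ k {p q} → Below k p → Below k q → Below k (λ t → p t + q t)
  below-+ zero    (Level.lift z) (Level.lift z′) = Level.lift λ t → trans (+-cong (z t) (z′ t)) (+-identityˡ 0#)
  below-+ (suc k) (a , r , br , e) (a′ , r′ , br′ , e′) =
    a + a′ , (λ t → r t + r′ t) , below-+ k br br′ ,
    λ t → trans (+-cong (e t) (e′ t))
      (solve 5 (λ a a′ t r r′ → (a :+ t :* r) :+ (a′ :+ t :* r′) := (a :+ a′) :+ t :* (r :+ r′)) refl a a′ t (r t) (r′ t))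

  below-* : ∀ k x {p} → Below k p → Below k (λ t → x * p t)
  below-* zero    x (Level.lift z)   = Level.lift λ t → trans (*-congˡ (z t)) (zeroʳ x)
  below-* (suc k) x (a , r , br , e) = x * a , (λ t → x * r t) , below-* k x br ,
    λ t → trans (*-congˡ (e t)) (solve 4 (λ x a t r → x :* (a :+ t :* r) := x :* a :+ t :* (x :* r)) refl x a t (r t))

  below-‿- : ∀ k {p q} → Below k p → Below k q → Below k (λ t → p t - q t)
  below-‿- k {p} {q} bp bq = below-resp k
    (λ t → solve 2 (λ x y → x :+ (:- :1) :* y := x :- y) refl (p t) (q t)) (below-+ k bp (below-* k (- 1#) bq))

  below-suc : ∀ k {p} → Below k p → Below (suc k) p
  below-suc zero    (Level.lift z)   = below-0 1 z
  below-suc (suc k) (a , r , br , e) = a , r , below-suc k br , e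

  below-≤ : ∀ {k k′ p} → k ℕ.≤ k′ → Below k p → Below k′ p
  below-≤ {k} {k′} {p} k≤k′ b = go (ℕP.≤⇒≤′ k≤k′)
    where
    go : ∀ {k′} → k ℕ.≤′ k′ → Below k′ p
    go (ℕ.≤′-reflexive ≡.refl) = b
    go (ℕ.≤′-step le)          = below-suc _ (go le)

  below-const : ∀ x → Below 1 (λ _ → x)
  below-const x = x , (λ _ → 0#) , Level.lift (λ _ → refl) , λ t → solve 2 (λ x t → x := x :+ t :* :0) refl x t

  below-1 : ∀ {p} → Below 1 p → ∀ t → p t ≈ p 0#
  below-1 {p} (a , q , Level.lift z , e) t = trans (lemma t) (sym (lemma 0#))
    where
    lemma : ∀ t → p t ≈ a
    lemma t = trans (e t) (trans (+-congˡ (trans (*-congˡ (z t)) (zeroʳ t))) (+-identityʳ a))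

  below-t : ∀ k {p} → Below k p → Below (suc k) (λ t → t * p t)
  below-t k {p} b = 0# , p , b , λ t → sym (+-identityˡ _)

  below-linear : ∀ k x y {p} → Below k p → Below (suc k) (λ t → (x + t * y) * p t)
  below-linear k x y {p} b = below-resp (suc k)
    (λ t → solve 4 (λ x y t p → x :* p :+ y :* (t :* p) := (x :+ t :* y) :* p) refl x y t (p t))
    (below-+ (suc k) (below-suc k (below-* k x b)) (below-* (suc k) y (below-t k b)))

  below-rescale : ∀ k x {p} → Below k p → Below k (λ t → p (t * x))
  below-rescale zero    x (Level.lift z)   = Level.lift λ t → z (t * x)
  below-rescale (suc k) x (a , q , b , e) = a , (λ t → x * q (t * x)) , below-* k x (below-rescale k x b) ,
    λ t → trans (e (t * x)) (+-congˡ (*-assoc t x _))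

  top⇒below : ∀ m {p s} → Top m p s → Below (suc m) p
  top⇒below zero {s = s} (Level.lift z) = below-resp 1 (λ t → sym (z t)) (below-const s)
  top⇒below (suc m) (a , q , b , e)     = a , q , top⇒below m b , e

  below⇒top : ∀ m {p} → Below (suc m) p → Σ[ s ∈ 𝕂 ] Top m p s
  below⇒top zero {p} b = p 0# , Level.lift (below-1 b)
  below⇒top (suc m) (a , q , b , e) = proj₁ (below⇒top m b) , a , q , proj₂ (below⇒top m b) , e

  below⇒top-0 : ∀ m {p} → Below m p → Top m p 0#
  below⇒top-0 zero    b               = b
  below⇒top-0 (suc m) (a , q , b , e) = a , q , below⇒top-0 m b , e

  top-0⇒below : ∀ m {p s} → s ≈ 0# → Top m p s → Below m p
  top-0⇒below zero    s≈0 (Level.lift z)  = Level.lift λ t → trans (z t) s≈0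
  top-0⇒below (suc m) s≈0 (a , q , b , e) = a , q , top-0⇒below m s≈0 b , e

  top-resp : ∀ m {p q s r} → (∀ t → p t ≈ q t) → s ≈ r → Top m p s → Top m q r
  top-resp zero    eq s≈r (Level.lift z)  = Level.lift λ t → trans (sym (eq t)) (trans (z t) s≈r)
  top-resp (suc m) eq s≈r (a , q , b , e) = a , q , top-resp m (λ _ → refl) s≈r b , λ t → trans (sym (eq t)) (e t)

  top-+ : ∀ m {p q s r} → Top m p s → Top m q r → Top m (λ t → p t + q t) (s + r)
  top-+ zero    (Level.lift z) (Level.lift z′) = Level.lift λ t → +-cong (z t) (z′ t)
  top-+ (suc m) (a , r , br , e) (a′ , r′ , br′ , e′) =
    a + a′ , (λ t → r t + r′ t) , top-+ m br br′ ,
    λ t → trans (+-cong (e t) (e′ t))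
      (solve 5 (λ a a′ t r r′ → (a :+ t :* r) :+ (a′ :+ t :* r′) := (a :+ a′) :+ t :* (r :+ r′)) refl a a′ t (r t) (r′ t))

  top-* : ∀ m x {p s} → Top m p s → Top m (λ t → x * p t) (x * s)
  top-* zero    x (Level.lift z)   = Level.lift λ t → *-congˡ (z t)
  top-* (suc m) x (a , r , br , e) = x * a , (λ t → x * r t) , top-* m x br ,
    λ t → trans (*-congˡ (e t)) (solve 4 (λ x a t r → x :* (a :+ t :* r) := x :* a :+ t :* (x :* r)) refl x a t (r t))

  top-suc : ∀ m {p s} → Top m p s → Top (suc m) p 0#
  top-suc m b = below⇒top-0 (suc m) (top⇒below m b)

  top-t : ∀ m {p s} → Top m p s → Top (suc m) (λ t → t * p t) s
  top-t m {p} b = 0# , p , b , λ t → sym (+-identityˡ _)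

  top-linear : ∀ m x y {p s} → Top m p s → Top (suc m) (λ t → (x + t * y) * p t) (y * s)
  top-linear m x y {p} {s} b = top-resp (suc m)
    (λ t → solve 4 (λ x y t p → x :* p :+ y :* (t :* p) := (x :+ t :* y) :* p) refl x y t (p t))
    (+-identityˡ _)
    (top-+ (suc m) (top-suc m (top-* m x b)) (top-* (suc m) y (top-t m b)))

  -- The forward difference takes the place of the derivative, as it makes sense for functions given
  -- without coefficients.
  Δ : (𝕂 → 𝕂) → 𝕂 → 𝕂
  Δ p t = p (t + 1#) - p t

  private
    -- The product rule for `t * q t`; the extra `q t` arises because the difference of t is 1.
    Δ-horner : ∀ {p q : 𝕂 → 𝕂} {a} → (∀ t → p t ≈ a + t * q t) → ∀ t → t * Δ q t + (Δ q t + q t) ≈ Δ p t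
    Δ-horner {p} {q} {a} e t = begin
      t * (q (t + 1#) - q t) + ((q (t + 1#) - q t) + q t)
        ≈⟨ solve 4 (λ a t x y → t :* (x :- y) :+ ((x :- y) :+ y) := (a :+ (t :+ :1) :* x) :- (a :+ t :* y))
             refl a t (q (t + 1#)) (q t) ⟩
      (a + (t + 1#) * q (t + 1#)) - (a + t * q t) ≈⟨ +-cong (e (t + 1#)) (-‿cong (e t)) ⟨
      Δ p t ∎

  top-Δ : ∀ m {p s} → Top (suc m) p s → Top m (Δ p) (suc m · s)
  top-Δ zero {p} {s} (a , q , Level.lift z , e) = Level.lift λ t → begin
    Δ p t                         ≈⟨ Δ-horner e t ⟨
    t * Δ q t + (Δ q t + q t)     ≈⟨ +-cong (*-congˡ (+-cong (z _) (-‿cong (z t)))) (+-cong (+-cong (z _) (-‿cong (z t))) (z t)) ⟩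
    t * (s - s) + ((s - s) + s)   ≈⟨ solve 2 (λ t s → t :* (s :- s) :+ ((s :- s) :+ s) := s :+ :0) refl t s ⟩
    s + 0#                        ∎
  top-Δ (suc m) {p} {s} (a , q , b , e) = top-resp (suc m) (Δ-horner e)
    (solve 2 (λ x s → x :+ (:0 :+ s) := s :+ x) refl _ s)
    (top-+ (suc m) (top-t m (top-Δ m b)) (top-+ (suc m) (top-suc m (top-Δ m b)) b))

  below-Δ : ∀ k {p} → Below (suc k) p → Below k (Δ p)
  below-Δ zero    b = Level.lift λ t → trans (+-cong (below-1 b (t + 1#)) (-‿cong (below-1 b t))) (-‿inverseʳ _)
  below-Δ (suc k) b = top⇒below k (top-Δ k (proj₂ (below⇒top (suc k) b)))

  private
    ·≈* : ∀ m x → m · x ≈ (m · 1#) * x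
    ·≈* zero    x = sym (zeroˡ x)
    ·≈* (suc m) x = trans (+-cong (sym (*-identityˡ x)) (·≈* m x)) (sym (distribʳ x 1# (m · 1#)))

  -- Each difference multiplies the leading coefficient by the degree, which can be cancelled in
  -- characteristic zero. So leading coefficients are unique, with no count of roots.
  top-of-0 : ∀ m {p s} → (∀ t → p t ≈ 0#) → Top m p s → s ≈ 0#
  top-of-0 zero    z (Level.lift z′) = trans (sym (z′ 0#)) (z 0#)
  top-of-0 (suc m) {p} {s} z b = cancel-zero (suc·#0 m)
    (trans (sym (·≈* (suc m) s)) (top-of-0 m (λ t → trans (+-cong (z _) (-‿cong (z t))) (-‿inverseʳ 0#)) (top-Δ m b)))

  top-unique : ∀ m {p s r} → Top m p s → Top m p r → s ≈ r
  top-unique m {p} {s} {r} b b′ = x-y≈0⇒x≈y (trans (solve 2 (λ s r → s :- r := s :+ (:- :1) :* r) refl s r)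
    (top-of-0 m (λ t → solve 1 (λ x → x :+ (:- :1) :* x := :0) refl (p t)) (top-+ m b (top-* m (- 1#) b′))))

  -- The crude bound `N` starts a descent: if p has degree at most k + j, then y times its
  -- coefficient there is the coefficient of degree k + j + 1 of the product, hence zero.
  below-divide : ∀ k N {x y p} → y # 0# → Below (suc k) (λ t → (x + t * y) * p t) → Below N p → Below k p
  below-divide k N {x} {y} {p} y#0 b bp = descend N (below-≤ (ℕP.m≤n+m N k) bp)
    where
    descend : ∀ j → Below (k ℕ.+ j) p → Below k p
    descend zero    b′ = ≡.subst (λ i → Below i p) (ℕP.+-identityʳ k) b′
    descend (suc j) b′ with below⇒top (k ℕ.+ j) (≡.subst (λ i → Below i p) (ℕP.+-suc k j) b′)
    ... | s , tp = descend j (top-0⇒below (k ℕ.+ j) s≈0 tp)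
      where
      s≈0 : s ≈ 0#
      s≈0 = cancel-zero y#0 (top-unique (suc (k ℕ.+ j)) (top-linear (k ℕ.+ j) x y tp)
        (below⇒top-0 (suc (k ℕ.+ j)) (below-≤ (ℕ.s≤s (ℕP.m≤m+n k j)) b)))

  -- The values p(1), p(2), … of a polynomial p determine p(0), by finite differences.
  below-extrapolate : ∀ j k (P : 𝕂 → 𝕂 → 𝕂) → (∀ t {x y} → x ≈ y → P t x ≈ P t y) →
    (∀ t → Below j (P t)) → (∀ n → Below k (λ t → P t (suc n · 1#))) → Below k (λ t → P t 0#)
  below-extrapolate zero    k P P-cong b positive = below-0 k (λ t → Level.lower (b t) 0#)
  below-extrapolate (suc j) k P P-cong b positive = below-resp k
    (λ t → trans (+-cong (P-cong t (+-identityʳ 1#)) (-‿cong (+-congʳ (P-cong t (+-identityˡ 1#)))))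
      (solve 2 (λ x y → x :- (x :- y) := y) refl (P t 1#) (P t 0#)))
    (below-‿- k (positive 0) (below-extrapolate j k (λ t → Δ (P t))
      (λ t x≈y → +-cong (P-cong t (+-congʳ x≈y)) (-‿cong (P-cong t x≈y)))
      (λ t → below-Δ j (b t))
      (λ n → below-resp k (λ t → +-congʳ (P-cong t (+-comm _ _))) (below-‿- k (positive (suc n)) (positive n)))))

-- Linear forms and homogeneous polynomial functions

module Polynomials {c ℓ₁ ℓ₂ m ℓm : Level} (K : CharZeroField c ℓ₁ ℓ₂)
                   (V : Module (CharZeroField.commutativeRing K) m ℓm) where
  open Field K
  open Univariate K
  open Module V public
    using (_≈ᴹ_; _+ᴹ_; _*ₗ_; 0ᴹ; -ᴹ_; ≈ᴹ-sym; ≈ᴹ-trans; ≈ᴹ-setoid; +ᴹ-cong; +ᴹ-congˡ; +ᴹ-congʳ; +ᴹ-comm; +ᴹ-assoc;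
           +ᴹ-identityˡ; +ᴹ-identityʳ; *ₗ-congˡ; *ₗ-congʳ; *ₗ-distribˡ; *ₗ-distribʳ; *ₗ-assoc; *ₗ-identityˡ; *ₗ-zeroˡ; *ₗ-zeroʳ;
           *ₗ-*ᵣ-coincident)
    renaming (Carrierᴹ to 𝕍)
  open SetoidReasoning setoid

  Form : Set (c ⊔ ℓ₁ ⊔ m ⊔ ℓm)
  Form = LinearForm K V

  open LinearForm public using (⟦_⟧)

  Fun : Set (c ⊔ m)
  Fun = Function K V

  private
    module M = ModuleMorphisms (Module.rawModule V) (Module.rawModule (TensorUnit.⟨module⟩ {R = CharZeroField.commutativeRing K}))
    module Hom (φ : Form) = M.IsModuleHomomorphism (LinearForm.isModuleHomomorphism φ)

  form-cong : ∀ (φ : Form) {v w} → v ≈ᴹ w → ⟦ φ ⟧ v ≈ ⟦ φ ⟧ w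
  form-cong φ = Hom.⟦⟧-cong φ

  form-+ : ∀ (φ : Form) v w → ⟦ φ ⟧ (v +ᴹ w) ≈ ⟦ φ ⟧ v + ⟦ φ ⟧ w
  form-+ φ = Hom.+ᴹ-homo φ

  form-* : ∀ (φ : Form) x v → ⟦ φ ⟧ (x *ₗ v) ≈ x * ⟦ φ ⟧ v
  form-* φ = Hom.*ₗ-homo φ

  form-0 : ∀ (φ : Form) → ⟦ φ ⟧ 0ᴹ ≈ 0#
  form-0 φ = Hom.0ᴹ-homo φ

  form-line : ∀ (φ : Form) v t h → ⟦ φ ⟧ (v +ᴹ t *ₗ h) ≈ ⟦ φ ⟧ v + t * ⟦ φ ⟧ h
  form-line φ v t h = trans (form-+ φ v _) (+-congˡ (form-* φ t h))

  module _ (f : Fun) (f-cong : ∀ {v w} → v ≈ᴹ w → f v ≈ f w)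
           (f-+ : ∀ v w → f (v +ᴹ w) ≈ f v + f w) (f-* : ∀ x v → f (x *ₗ v) ≈ x * f v) where

    private
      f-0 : f 0ᴹ ≈ 0#
      f-0 = trans (f-cong (≈ᴹ-sym (*ₗ-zeroˡ 0ᴹ))) (trans (f-* 0# 0ᴹ) (zeroˡ _))

      f-neg : ∀ v → f (-ᴹ v) ≈ - f v
      f-neg v = begin
        f (-ᴹ v)                 ≈⟨ solve 2 (λ x y → x := (y :+ x) :- y) refl (f (-ᴹ v)) (f v) ⟩
        (f v + f (-ᴹ v)) - f v   ≈⟨ +-congʳ (f-+ v (-ᴹ v)) ⟨
        f (v +ᴹ -ᴹ v) - f v      ≈⟨ +-congʳ (trans (f-cong (Module.-ᴹ‿inverseʳ V v)) f-0) ⟩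
        0# - f v                 ≈⟨ +-identityˡ _ ⟩
        - f v                    ∎

      f-*ᵣ : ∀ x v → f (Module._*ᵣ_ V v x) ≈ f v * x
      f-*ᵣ x v = trans (f-cong (≈ᴹ-sym (*ₗ-*ᵣ-coincident x v))) (trans (f-* x v) (*-comm x _))

    form : Form
    form = record
      { ⟦_⟧ = f
      ; isModuleHomomorphism = record
        { isBimoduleHomomorphism = record
          { +ᴹ-isGroupHomomorphism = record
            { isMonoidHomomorphism = record
              { isMagmaHomomorphism = record
                { isRelHomomorphism = record { cong = f-cong }
                ; homo              = f-+
                }
              ; ε-homo = f-0
              }
            ; ⁻¹-homo = f-neg
            }
          ; *ₗ-homo = f-*
          ; *ᵣ-homo = f-*ᵣ
          }
        }
      }

  zeroForm : Form
  zeroForm = form (λ _ → 0#) (λ _ → refl) (λ _ _ → sym (+-identityˡ 0#)) (λ x _ → sym (zeroʳ x))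

  Homogeneous : ℕ → Fun → Set (c ⊔ ℓ₁ ⊔ m ⊔ ℓm)
  Homogeneous = IsHomogeneous K V

  hom-cong : ∀ {i f} → Homogeneous i f → ∀ {v w} → v ≈ᴹ w → f v ≈ f w
  hom-cong (constant a)    v≈w = refl
  hom-cong (multiply φ hf) v≈w = *-cong (form-cong φ v≈w) (hom-cong hf v≈w)
  hom-cong (add hf hg)     v≈w = +-cong (hom-cong hf v≈w) (hom-cong hg v≈w)
  hom-cong (respects e hf) v≈w = trans (sym (e _)) (trans (hom-cong hf v≈w) (e _))

  hom-0 : ∀ i → Homogeneous i (λ _ → 0#)
  hom-0 zero    = constant 0#
  hom-0 (suc i) = respects (λ _ → zeroˡ _) (multiply zeroForm (hom-0 i))

  hom-* : ∀ {i f} x → Homogeneous i f → Homogeneous i (λ v → x * f v)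
  hom-* x (constant a)            = constant (x * a)
  hom-* x (multiply {f = f} φ hf) = respects
    (λ v → solve 3 (λ x y z → y :* (x :* z) := x :* (y :* z)) refl x (⟦ φ ⟧ v) (f v)) (multiply φ (hom-* x hf))
  hom-* x (add hf hg)             = respects (λ v → sym (distribˡ x _ _)) (add (hom-* x hf) (hom-* x hg))
  hom-* x (respects e hf)         = respects (λ v → *-congˡ (e v)) (hom-* x hf)

  hom-‿- : ∀ {i f g} → Homogeneous i f → Homogeneous i g → Homogeneous i (λ v → f v - g v)
  hom-‿- {f = f} {g} hf hg = respects (λ v → solve 2 (λ x y → x :+ (:- :1) :* y := x :- y) refl (f v) (g v))
    (add hf (hom-* (- 1#) hg))

  hom-at-0 : ∀ {i f} → Homogeneous (suc i) f → f 0ᴹ ≈ 0#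
  hom-at-0 (multiply φ hf) = trans (*-congʳ (form-0 φ)) (zeroˡ _)
  hom-at-0 (add hf hg)     = trans (+-cong (hom-at-0 hf) (hom-at-0 hg)) (+-identityˡ 0#)
  hom-at-0 (respects e hf) = trans (sym (e 0ᴹ)) (hom-at-0 hf)

  line : Fun → 𝕍 → 𝕍 → 𝕂 → 𝕂
  line f h v t = f (v +ᴹ t *ₗ h)

  v+0h≈v : ∀ v h → v +ᴹ 0# *ₗ h ≈ᴹ v
  v+0h≈v v h = ≈ᴹ-trans (+ᴹ-congˡ (*ₗ-zeroˡ h)) (+ᴹ-identityʳ v)

  below-line-* : ∀ k φ f h v → Below k (line f h v) → Below (suc k) (line (λ w → ⟦ φ ⟧ w * f w) h v)
  below-line-* k φ f h v b = below-resp (suc k) (λ t → *-congʳ (sym (form-line φ v t h)))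
    (below-linear k (⟦ φ ⟧ v) (⟦ φ ⟧ h) b)

  hom-below : ∀ {i f} → Homogeneous i f → ∀ h v → Below (suc i) (line f h v)
  hom-below (constant a)            h v = below-const a
  hom-below {suc i} (multiply {f = f} φ hf) h v = below-line-* (suc i) φ f h v (hom-below hf h v)
  hom-below {i} (add hf hg)         h v = below-+ (suc i) (hom-below hf h v) (hom-below hg h v)
  hom-below {i} (respects e hf)     h v = below-resp (suc i) (λ t → e _) (hom-below hf h v)

  module _ (l : Form) (u : 𝕍) where

    -- When l u = 1, the projection onto the kernel of l along u.
    π : 𝕍 → 𝕍
    π v = v +ᴹ (- ⟦ l ⟧ v) *ₗ u

    π-cong : ∀ {v w} → v ≈ᴹ w → π v ≈ᴹ π w
    π-cong e = +ᴹ-cong e (*ₗ-congʳ (-‿cong (form-cong l e)))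

    form-π : ∀ (φ : Form) v → ⟦ φ ⟧ (π v) ≈ ⟦ φ ⟧ v + (- ⟦ l ⟧ v) * ⟦ φ ⟧ u
    form-π φ v = form-line φ v (- ⟦ l ⟧ v) u

    formOnKernel : Form → Form
    formOnKernel φ = form (λ v → ⟦ φ ⟧ (π v)) (λ e → form-cong φ (π-cong e))
      (λ v w → begin
        ⟦ φ ⟧ (π (v +ᴹ w))                                  ≈⟨ form-π φ (v +ᴹ w) ⟩
        ⟦ φ ⟧ (v +ᴹ w) + (- ⟦ l ⟧ (v +ᴹ w)) * ⟦ φ ⟧ u         ≈⟨ +-cong (form-+ φ v w) (*-congʳ (-‿cong (form-+ l v w))) ⟩
        _                                                   ≈⟨ solve 5 (λ a b x y z → (a :+ b) :+ (:- (x :+ y)) :* z := (a :+ (:- x) :* z) :+ (b :+ (:- y) :* z)) refl (⟦ φ ⟧ v) (⟦ φ ⟧ w) (⟦ l ⟧ v) (⟦ l ⟧ w) (⟦ φ ⟧ u) ⟩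
        _                                                   ≈⟨ +-cong (form-π φ v) (form-π φ w) ⟨
        ⟦ φ ⟧ (π v) + ⟦ φ ⟧ (π w)                           ∎)
      (λ x v → begin
        ⟦ φ ⟧ (π (x *ₗ v))                                  ≈⟨ form-π φ (x *ₗ v) ⟩
        ⟦ φ ⟧ (x *ₗ v) + (- ⟦ l ⟧ (x *ₗ v)) * ⟦ φ ⟧ u         ≈⟨ +-cong (form-* φ x v) (*-congʳ (-‿cong (form-* l x v))) ⟩
        _                                                   ≈⟨ solve 4 (λ x a b z → x :* a :+ (:- (x :* b)) :* z := x :* (a :+ (:- b) :* z)) refl x (⟦ φ ⟧ v) (⟦ l ⟧ v) (⟦ φ ⟧ u) ⟩
        _                                                   ≈⟨ *-congˡ (form-π φ v) ⟨
        x * ⟦ φ ⟧ (π v)                                     ∎)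

    hom-π : ∀ {i f} → Homogeneous i f → Homogeneous i (λ v → f (π v))
    hom-π (constant a)    = constant a
    hom-π (multiply φ hf) = multiply (formOnKernel φ) (hom-π hf)
    hom-π (add hf hg)     = add (hom-π hf) (hom-π hg)
    hom-π (respects e hf) = respects (λ v → e _) (hom-π hf)

    π-fixes : ∀ {v} → ⟦ l ⟧ v ≈ 0# → π v ≈ᴹ v
    π-fixes {v} e = ≈ᴹ-trans (+ᴹ-congˡ (*ₗ-congʳ (trans (-‿cong e) (solve 0 (:- :0 := :0) refl)))) (v+0h≈v v u)

    v≈π+lu : ∀ v → v ≈ᴹ π v +ᴹ ⟦ l ⟧ v *ₗ u
    v≈π+lu v = ≈ᴹ-sym (≈ᴹ-trans (+ᴹ-assoc v _ _) (≈ᴹ-trans (+ᴹ-congˡ (≈ᴹ-trans (≈ᴹ-sym (*ₗ-distribʳ u _ _))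
      (*ₗ-congʳ (-‿inverseˡ _)))) (v+0h≈v v u)))

    π-line : ∀ v t h → π (v +ᴹ t *ₗ h) ≈ᴹ π v +ᴹ t *ₗ π h
    π-line v t h = R.begin
      (v +ᴹ t *ₗ h) +ᴹ (- ⟦ l ⟧ (v +ᴹ t *ₗ h)) *ₗ u
        R.≈⟨ +ᴹ-congˡ (*ₗ-congʳ (trans (-‿cong (form-line l v t h))
             (solve 3 (λ a b t → :- (a :+ t :* b) := (:- a) :+ t :* (:- b)) refl (⟦ l ⟧ v) (⟦ l ⟧ h) t))) ⟩
      (v +ᴹ t *ₗ h) +ᴹ (- ⟦ l ⟧ v + t * (- ⟦ l ⟧ h)) *ₗ u
        R.≈⟨ +ᴹ-congˡ (≈ᴹ-trans (*ₗ-distribʳ u _ _) (+ᴹ-congˡ (*ₗ-assoc t _ u))) ⟩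
      (v +ᴹ t *ₗ h) +ᴹ ((- ⟦ l ⟧ v) *ₗ u +ᴹ t *ₗ ((- ⟦ l ⟧ h) *ₗ u))
        R.≈⟨ interchange v (t *ₗ h) _ _ ⟩
      π v +ᴹ (t *ₗ h +ᴹ t *ₗ ((- ⟦ l ⟧ h) *ₗ u))
        R.≈⟨ +ᴹ-congˡ (*ₗ-distribˡ t _ _) ⟨
      π v +ᴹ t *ₗ π h R.∎
      where
      module R = SetoidReasoning ≈ᴹ-setoid
      interchange : ∀ a b x y → (a +ᴹ b) +ᴹ (x +ᴹ y) ≈ᴹ (a +ᴹ x) +ᴹ (b +ᴹ y)
      interchange a b x y = ≈ᴹ-trans (+ᴹ-assoc a b _) (≈ᴹ-trans (+ᴹ-congˡ (≈ᴹ-trans (≈ᴹ-sym (+ᴹ-assoc b x y))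
        (≈ᴹ-trans (+ᴹ-congʳ (+ᴹ-comm b x)) (+ᴹ-assoc x b y)))) (≈ᴹ-sym (+ᴹ-assoc a x _)))

  -- The degree drops by one, and there is nothing of degree -1.
  HomogeneousPred : ℕ → Fun → Set (c ⊔ ℓ₁ ⊔ m ⊔ ℓm)
  HomogeneousPred zero    f = Level.Lift (c ⊔ ℓm) (∀ v → f v ≈ 0#)
  HomogeneousPred (suc i) f = Homogeneous i f

  -- Since φ = φ ∘ π + φ(u) l for every form φ, an induction over products collects the terms that
  -- contain l. With l(u) = 1 this makes a polynomial that vanishes on l = 0 divisible by l.
  divideOut : ∀ (l : Form) u {i f} → Homogeneous i f →
    Σ[ g ∈ Fun ] HomogeneousPred i g × (∀ v → f v ≈ f (π l u v) + ⟦ l ⟧ v * g v)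
  divideOut l u (constant a) = (λ _ → 0#) , Level.lift (λ _ → refl) , λ v → sym (trans (+-congˡ (zeroʳ _)) (+-identityʳ a))
  divideOut l u (multiply {d} {f} φ hf) with divideOut l u hf
  ... | g , hg , e = (λ v → ⟦ φ ⟧ u * f (π l u v) + ⟦ φ ⟧ v * g v) , add (hom-* _ (hom-π l u hf)) (hom d hg) , λ v → begin
    ⟦ φ ⟧ v * f v                            ≈⟨ *-congˡ (e v) ⟩
    ⟦ φ ⟧ v * (f (π l u v) + ⟦ l ⟧ v * g v)
      ≈⟨ solve 5 (λ p q x y z → p :* (x :+ y :* z) := (p :+ (:- y) :* q) :* x :+ y :* (q :* x :+ p :* z)) refl
           (⟦ φ ⟧ v) (⟦ φ ⟧ u) (f (π l u v)) (⟦ l ⟧ v) (g v) ⟩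
    (⟦ φ ⟧ v + (- ⟦ l ⟧ v) * ⟦ φ ⟧ u) * f (π l u v) + ⟦ l ⟧ v * (⟦ φ ⟧ u * f (π l u v) + ⟦ φ ⟧ v * g v)
      ≈⟨ +-congʳ (*-congʳ (form-π l u φ v)) ⟨
    ⟦ φ ⟧ (π l u v) * f (π l u v) + ⟦ l ⟧ v * (⟦ φ ⟧ u * f (π l u v) + ⟦ φ ⟧ v * g v) ∎
    where
    hom : ∀ d {g} → HomogeneousPred d g → Homogeneous d (λ v → ⟦ φ ⟧ v * g v)
    hom zero    (Level.lift z) = respects (λ v → sym (trans (*-congˡ (z v)) (zeroʳ _))) (constant 0#)
    hom (suc d) hg             = multiply φ hg
  divideOut l u {i} (add {f = f} {f′} hf hf′) with divideOut l u hf | divideOut l u hf′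
  ... | g , hg , e | g′ , hg′ , e′ = (λ v → g v + g′ v) , pred-+ i hg hg′ , λ v → trans (+-cong (e v) (e′ v))
    (solve 5 (λ x x′ y z z′ → (x :+ y :* z) :+ (x′ :+ y :* z′) := (x :+ x′) :+ y :* (z :+ z′)) refl
      (f (π l u v)) (f′ (π l u v)) (⟦ l ⟧ v) (g v) (g′ v))
    where
    pred-+ : ∀ i {g g′} → HomogeneousPred i g → HomogeneousPred i g′ → HomogeneousPred i (λ v → g v + g′ v)
    pred-+ zero    (Level.lift z) (Level.lift z′) = Level.lift λ v → trans (+-cong (z v) (z′ v)) (+-identityˡ 0#)
    pred-+ (suc i) hg hg′ = add hg hg′
  divideOut l u (respects e′ hf) with divideOut l u hf
  ... | g , hg , e = g , hg , λ v → trans (sym (e′ v)) (trans (e v) (+-congʳ (e′ _)))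

  -- The points off the hyperplane l = 0 are dense.
  below-dense : ∀ {i g} → Homogeneous i g → (l : Form) {u : 𝕍} → ⟦ l ⟧ u ≈ 1# → ∀ k {h} →
    (∀ v → ⟦ l ⟧ v # 0# → Below k (line g h v)) → ∀ v → Below k (line g h v)
  below-dense {i} {g} hg l {u} lu≈1 k {h} off v with zero-or-apart (⟦ l ⟧ v)
  ... | inj₁ lv#0 = off v lv#0
  ... | inj₂ lv≈0 = below-resp k (λ t → hom-cong hg (v+0h≈v _ u))
    -- The line is moved along u to base points v + n u, where l has the value n ≥ 1; extrapolation
    -- in this second parameter returns to n = 0.
    (below-extrapolate (suc i) k (λ t → line g u (v +ᴹ t *ₗ h)) (λ t e → hom-cong hg (+ᴹ-congˡ (*ₗ-congʳ e)))
      (λ t → hom-below hg u _)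
      (λ n → below-resp k (λ t → hom-cong hg (swap (suc n · 1#) t)) (off _ (#-resp (sym (l-at n)) (suc·#0 n)))))
    where
    l-at : ∀ n → ⟦ l ⟧ (v +ᴹ (suc n · 1#) *ₗ u) ≈ suc n · 1#
    l-at n = trans (form-line l v _ u) (trans (+-cong lv≈0 (trans (*-congˡ lu≈1) (*-identityʳ _))) (+-identityˡ _))
    swap : ∀ s t → (v +ᴹ s *ₗ u) +ᴹ t *ₗ h ≈ᴹ (v +ᴹ t *ₗ h) +ᴹ s *ₗ u
    swap s t = ≈ᴹ-trans (+ᴹ-assoc v _ _) (≈ᴹ-trans (+ᴹ-congˡ (+ᴹ-comm _ _)) (≈ᴹ-sym (+ᴹ-assoc v _ _)))

-- Cardinalities of subsets

module Subsets where

  x∈p─q⇒x∉q : ∀ {n} {p q : Subset n} {x} → x ∈ p ─ q → x ∉ q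
  x∈p─q⇒x∉q {p = _ ∷ _}     {inside ∷ _}  () here
  x∈p─q⇒x∉q {p = _ ∷ _}     {_ ∷ _}       (there x∈) (there x∈q) = x∈p─q⇒x∉q x∈ x∈q

  x∈p-y⇒x≢y : ∀ {n} {p : Subset n} {x y} → x ∈ p ∖ y → x ≢ y
  x∈p-y⇒x≢y {y = y} x∈ ≡.refl = x∈p─q⇒x∉q x∈ (x∈⁅x⁆ y)

  x∈p⇒⁅x⁆⊆p : ∀ {n} {p : Subset n} {x} → x ∈ p → ⁅ x ⁆ ⊆ p
  x∈p⇒⁅x⁆⊆p {p = p} {x} x∈p y∈ = ≡.subst (_∈ p) (≡.sym (x∈⁅y⁆⇒x≡y x y∈)) x∈p

  ∣p─q∣+∣q∣≡∣p∣ : ∀ {n} (p q : Subset n) → q ⊆ p → ∣ p ─ q ∣ ℕ.+ ∣ q ∣ ≡ ∣ p ∣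
  ∣p─q∣+∣q∣≡∣p∣ []            []            _   = ≡.refl
  ∣p─q∣+∣q∣≡∣p∣ (inside ∷ p)  (inside ∷ q)  q⊆p = ≡.trans (ℕP.+-suc _ _) (≡.cong suc (∣p─q∣+∣q∣≡∣p∣ p q (drop-∷-⊆ q⊆p)))
  ∣p─q∣+∣q∣≡∣p∣ (inside ∷ p)  (outside ∷ q) q⊆p = ≡.cong suc (∣p─q∣+∣q∣≡∣p∣ p q (drop-∷-⊆ q⊆p))
  ∣p─q∣+∣q∣≡∣p∣ (outside ∷ p) (inside ∷ q)  q⊆p with () ← q⊆p here
  ∣p─q∣+∣q∣≡∣p∣ (outside ∷ p) (outside ∷ q) q⊆p = ∣p─q∣+∣q∣≡∣p∣ p q (drop-∷-⊆ q⊆p)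

  x∈p⇒suc∣p-x∣≡∣p∣ : ∀ {n} {p : Subset n} {x} → x ∈ p → suc ∣ p ∖ x ∣ ≡ ∣ p ∣
  x∈p⇒suc∣p-x∣≡∣p∣ {p = p} {x} x∈p = ≡.trans (≡.sym (ℕP.+-comm ∣ p ∖ x ∣ 1))
    (≡.trans (≡.cong (∣ p ∖ x ∣ ℕ.+_) (≡.sym (∣⁅x⁆∣≡1 x))) (∣p─q∣+∣q∣≡∣p∣ p ⁅ x ⁆ (x∈p⇒⁅x⁆⊆p x∈p)))

  Disjoint : ∀ {n} → Subset n → Subset n → Set
  Disjoint p q = ∀ {x} → x ∈ p → x ∉ q

  disjoint-tail : ∀ {n} {s t} {p q : Subset n} → Disjoint (s ∷ p) (t ∷ q) → Disjoint p q
  disjoint-tail d x∈p x∈q = d (there x∈p) (there x∈q)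

  ∣p∪q∣≡∣p∣+∣q∣ : ∀ {n} (p q : Subset n) → Disjoint p q → ∣ p ∪ q ∣ ≡ ∣ p ∣ ℕ.+ ∣ q ∣
  ∣p∪q∣≡∣p∣+∣q∣ []            []            d = ≡.refl
  ∣p∪q∣≡∣p∣+∣q∣ (inside ∷ p)  (inside ∷ q)  d = contradiction here (d here)
  ∣p∪q∣≡∣p∣+∣q∣ (inside ∷ p)  (outside ∷ q) d = ≡.cong suc (∣p∪q∣≡∣p∣+∣q∣ p q (disjoint-tail d))
  ∣p∪q∣≡∣p∣+∣q∣ (outside ∷ p) (inside ∷ q)  d = ≡.trans (≡.cong suc (∣p∪q∣≡∣p∣+∣q∣ p q (disjoint-tail d))) (≡.sym (ℕP.+-suc _ _))
  ∣p∪q∣≡∣p∣+∣q∣ (outside ∷ p) (outside ∷ q) d = ∣p∪q∣≡∣p∣+∣q∣ p q (disjoint-tail d)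

-- Bounds for degrees of restrictions to lines, as functions of ρ; the degrees
-- are required to be strictly smaller than the bound.
central internal : ℕ → ℕ
central zero     = 1
central (suc k)  = suc k
internal zero    = 1
internal (suc k) = k

-- Products of forms and the space P(A)

module Arrangements {c ℓ₁ ℓ₂ m ℓm : Level} (K : CharZeroField c ℓ₁ ℓ₂)
                    (V : Module (CharZeroField.commutativeRing K) m ℓm) where
  open Field K
  open Univariate K
  open Polynomials K V
  open Subsets

  Arr : ℕ → Set (c ⊔ ℓ₁ ⊔ m ⊔ ℓm)
  Arr = Arrangement K V

  -- The support of h, of size ρ(h). It is kept as a subset because it also selects the factors of
  -- products.
  nz : ∀ {n} → Arr n → 𝕍 → Subset n
  nz {zero}  A h = []
  nz {suc n} A h = does (⟦ A zero ⟧ h #? 0#) ∷ nz (A ∘ suc) h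

  ∈nz⇒# : ∀ {n} (A : Arr n) {h i} → i ∈ nz A h → ⟦ A i ⟧ h # 0#
  ∈nz⇒# A {h} {zero} i∈ with ⟦ A zero ⟧ h #? 0#
  ... | yes p = p
  ∈nz⇒# A {h} {suc i} (there i∈) = ∈nz⇒# (A ∘ suc) i∈

  #⇒∈nz : ∀ {n} (A : Arr n) {h i} → ⟦ A i ⟧ h # 0# → i ∈ nz A h
  #⇒∈nz A {h} {zero} p with ⟦ A zero ⟧ h #? 0#
  ... | yes _ = here
  ... | no ¬p = contradiction p ¬p
  #⇒∈nz A {h} {suc i} p = there (#⇒∈nz (A ∘ suc) p)

  ∉nz⇒≈0 : ∀ {n} (A : Arr n) {h i} → i ∉ nz A h → ⟦ A i ⟧ h ≈ 0#
  ∉nz⇒≈0 A {h} {i} i∉ with zero-or-apart (⟦ A i ⟧ h)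
  ... | inj₁ p = contradiction (#⇒∈nz A p) i∉
  ... | inj₂ z = z

  ≈0⇒∉nz : ∀ {n} (A : Arr n) {h i} → ⟦ A i ⟧ h ≈ 0# → i ∉ nz A h
  ≈0⇒∉nz A z i∈ = #⇒≉ (∈nz⇒# A i∈) z

  mono : ∀ {n} → Arr n → Subset n → Fun
  mono A []            v = 1#
  mono A (inside ∷ S)  v = ⟦ A zero ⟧ v * mono (A ∘ suc) S v
  mono A (outside ∷ S) v = mono (A ∘ suc) S v

  mono-cong : ∀ {n} (A B : Arr n) S {v w} → (∀ {i} → i ∈ S → ⟦ A i ⟧ v ≈ ⟦ B i ⟧ w) → mono A S v ≈ mono B S w
  mono-cong A B []            e = refl
  mono-cong A B (inside ∷ S)  e = *-cong (e here) (mono-cong (A ∘ suc) (B ∘ suc) S (e ∘ there))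
  mono-cong A B (outside ∷ S) e = mono-cong (A ∘ suc) (B ∘ suc) S (e ∘ there)

  mono-hom : ∀ {n} (A : Arr n) S → Homogeneous ∣ S ∣ (mono A S)
  mono-hom A []            = constant 1#
  mono-hom A (inside ∷ S)  = multiply (A zero) (mono-hom (A ∘ suc) S)
  mono-hom A (outside ∷ S) = mono-hom (A ∘ suc) S

  mono-# : ∀ {n} (A : Arr n) S {v} → (∀ {i} → i ∈ S → ⟦ A i ⟧ v # 0#) → mono A S v # 0#
  mono-# A []            p = 1#0
  mono-# A (inside ∷ S)  p = x#0y#0→xy#0 (p here) (mono-# (A ∘ suc) S (p ∘ there))
  mono-# A (outside ∷ S) p = mono-# (A ∘ suc) S (p ∘ there)

  mono-zero : ∀ {n} (A : Arr n) S {v i} → i ∈ S → ⟦ A i ⟧ v ≈ 0# → mono A S v ≈ 0#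
  mono-zero A (_ ∷ S)       here       z = trans (*-congʳ z) (zeroˡ _)
  mono-zero A (inside ∷ S)  (there i∈) z = trans (*-congˡ (mono-zero (A ∘ suc) S i∈ z)) (zeroʳ _)
  mono-zero A (outside ∷ S) (there i∈) z = mono-zero (A ∘ suc) S i∈ z

  mono-∪ : ∀ {n} (A : Arr n) S T v → Disjoint S T → mono A (S ∪ T) v ≈ mono A S v * mono A T v
  mono-∪ A []            []            v d = sym (*-identityˡ 1#)
  mono-∪ A (inside ∷ S)  (inside ∷ T)  v d = contradiction here (d here)
  mono-∪ A (inside ∷ S)  (outside ∷ T) v d = trans (*-congˡ (mono-∪ (A ∘ suc) S T v (disjoint-tail d))) (sym (*-assoc _ _ _))
  mono-∪ A (outside ∷ S) (inside ∷ T)  v d = trans (*-congˡ (mono-∪ (A ∘ suc) S T v (disjoint-tail d)))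
    (solve 3 (λ x y z → x :* (y :* z) := y :* (x :* z)) refl (⟦ A zero ⟧ v) (mono (A ∘ suc) S v) (mono (A ∘ suc) T v))
  mono-∪ A (outside ∷ S) (outside ∷ T) v d = mono-∪ (A ∘ suc) S T v (disjoint-tail d)

  -- The coefficient of t to the power ∣ E ∣ in mono A S (v + t h), when the forms outside E vanish at h.
  coef : ∀ {n} → Arr n → Subset n → Subset n → 𝕍 → 𝕍 → 𝕂
  coef A []            []            h v = 1#
  coef A (inside ∷ E)  (inside ∷ S)  h v = ⟦ A zero ⟧ h * coef (A ∘ suc) E S h v
  coef A (inside ∷ E)  (outside ∷ S) h v = 0#
  coef A (outside ∷ E) (inside ∷ S)  h v = ⟦ A zero ⟧ v * coef (A ∘ suc) E S h v
  coef A (outside ∷ E) (outside ∷ S) h v = coef (A ∘ suc) E S h v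

  -- Factors that vanish at h are constant along h, so at most ∣ E ∣ factors vary. An index of E
  -- missing from S wastes a degree and makes the coefficient 0; thus one statement yields both
  -- leading coefficients and strict degree bounds.
  mono-top : ∀ {n} (A : Arr n) E S h v → (∀ {i} → i ∈ S → i ∉ E → ⟦ A i ⟧ h ≈ 0#) →
    Top ∣ E ∣ (line (mono A S) h v) (coef A E S h v)
  mono-top A []            []            h v z = Level.lift λ _ → refl
  mono-top A (inside ∷ E)  (inside ∷ S)  h v z = top-resp (suc ∣ E ∣) (λ t → *-congʳ (sym (form-line (A zero) v t h))) refl
    (top-linear ∣ E ∣ _ _ (mono-top (A ∘ suc) E S h v λ i∈ i∉ → z (there i∈) λ { (there i∈′) → i∉ i∈′ }))
  mono-top A (inside ∷ E)  (outside ∷ S) h v z =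
    top-suc ∣ E ∣ (mono-top (A ∘ suc) E S h v λ i∈ i∉ → z (there i∈) λ { (there i∈′) → i∉ i∈′ })
  mono-top A (outside ∷ E) (inside ∷ S)  h v z = top-resp ∣ E ∣
    (λ t → *-congʳ (sym (trans (form-line (A zero) v t h)
      (trans (+-congˡ (trans (*-congˡ (z here λ ())) (zeroʳ t))) (+-identityʳ _))))) refl
    (top-* ∣ E ∣ _ (mono-top (A ∘ suc) E S h v λ i∈ i∉ → z (there i∈) λ { (there i∈′) → i∉ i∈′ }))
  mono-top A (outside ∷ E) (outside ∷ S) h v z =
    mono-top (A ∘ suc) E S h v λ i∈ i∉ → z (there i∈) λ { (there i∈′) → i∉ i∈′ }

  coef-zero : ∀ {n} (A : Arr n) E S {h v i} → i ∈ E → i ∉ S → coef A E S h v ≈ 0#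
  coef-zero A (inside ∷ E)  (inside ∷ S)  here       i∉ = contradiction here i∉
  coef-zero A (inside ∷ E)  (outside ∷ S) i∈         i∉ = refl
  coef-zero A (inside ∷ E)  (inside ∷ S)  (there i∈) i∉ = trans (*-congˡ (coef-zero (A ∘ suc) E S i∈ (i∉ ∘ there))) (zeroʳ _)
  coef-zero A (outside ∷ E) (inside ∷ S)  (there i∈) i∉ = trans (*-congˡ (coef-zero (A ∘ suc) E S i∈ (i∉ ∘ there))) (zeroʳ _)
  coef-zero A (outside ∷ E) (outside ∷ S) (there i∈) i∉ = coef-zero (A ∘ suc) E S i∈ (i∉ ∘ there)

  coef-⊆ : ∀ {n} (A : Arr n) E S h v → E ⊆ S → coef A E S h v ≈ mono A E h * mono A (S ─ E) v
  coef-⊆ A []            []            h v E⊆S = sym (*-identityˡ 1#)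
  coef-⊆ A (inside ∷ E)  (inside ∷ S)  h v E⊆S = trans (*-congˡ (coef-⊆ (A ∘ suc) E S h v (drop-∷-⊆ E⊆S))) (sym (*-assoc _ _ _))
  coef-⊆ A (inside ∷ E)  (outside ∷ S) h v E⊆S with () ← E⊆S here
  coef-⊆ A (outside ∷ E) (inside ∷ S)  h v E⊆S = trans (*-congˡ (coef-⊆ (A ∘ suc) E S h v (drop-∷-⊆ E⊆S)))
    (solve 3 (λ x y z → x :* (y :* z) := y :* (x :* z)) refl (⟦ A zero ⟧ v) (mono (A ∘ suc) E h) (mono (A ∘ suc) (S ─ E) v))
  coef-⊆ A (outside ∷ E) (outside ∷ S) h v E⊆S = coef-⊆ (A ∘ suc) E S h v (drop-∷-⊆ E⊆S)

  -- The forms outside S have the same common kernel, hence the same span, as all forms.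
  CoSpans : ∀ {n} → Arr n → Subset n → Set (ℓ₁ ⊔ m)
  CoSpans A S = ∀ h → (∀ i → i ∉ S → ⟦ A i ⟧ h ≈ 0#) → ∀ i → ⟦ A i ⟧ h ≈ 0#

  -- The degree `d` part of the central space of zonotopal algebra. As it is generated inductively,
  -- a property of all its elements is proved by recursion on a derivation, with the products as the
  -- only real case.
  data P {n} (A : Arr n) (d : ℕ) : Fun → Set (c ⊔ ℓ₁ ⊔ m ⊔ ℓm) where
    p-mono : ∀ S → CoSpans A S → ∣ S ∣ ≡ d → P A d (mono A S)
    p-0    : P A d (λ _ → 0#)
    p-*    : ∀ x {f} → P A d f → P A d (λ v → x * f v)
    p-+    : ∀ {f g} → P A d f → P A d g → P A d (λ v → f v + g v)
    p-resp : ∀ {f g} → (∀ v → f v ≈ g v) → P A d f → P A d g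

  p-‿- : ∀ {n} {A : Arr n} {d f g} → P A d f → P A d g → P A d (λ v → f v - g v)
  p-‿- {f = f} {g} pf pg = p-resp (λ v → solve 2 (λ x y → x :+ (:- :1) :* y := x :- y) refl (f v) (g v)) (p-+ pf (p-* (- 1#) pg))

  P⇒hom : ∀ {n} {A : Arr n} {d f} → P A d f → Homogeneous d f
  P⇒hom {A = A} (p-mono S _ eq) = ≡.subst (λ d → Homogeneous d (mono A S)) eq (mono-hom A S)
  P⇒hom {d = d} p-0     = hom-0 d
  P⇒hom (p-* x p)       = hom-* x (P⇒hom p)
  P⇒hom (p-+ p q)       = add (P⇒hom p) (P⇒hom q)
  P⇒hom (p-resp e p)    = respects e (P⇒hom p)

  any-nonzero? : ∀ {n ℓ} (A : Arr n) h {Q : Fin n → Set ℓ} → (∀ i → Dec (Q i)) →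
    (Σ[ i ∈ Fin n ] Q i × ⟦ A i ⟧ h # 0#) ⊎ (∀ i → Q i → ⟦ A i ⟧ h ≈ 0#)
  any-nonzero? A h Q? with FinP.any? (λ i → Q? i ×-dec (⟦ A i ⟧ h #? 0#))
  ... | yes (i , q , p) = inj₁ (i , q , p)
  ... | no none         = inj₂ λ i q → ∉nz⇒≈0 A λ i∈ → none (i , q , ∈nz⇒# A i∈)

  central≥1 : ∀ k → 1 ℕ.≤ central k
  central≥1 zero    = ℕ.s≤s ℕ.z≤n
  central≥1 (suc k) = ℕ.s≤s ℕ.z≤n

  ≤central : ∀ k → k ℕ.≤ central k
  ≤central zero    = ℕ.z≤n
  ≤central (suc k) = ℕP.≤-refl

  -- If a form outside S is nonzero at h, then at most ρ(h) - 1 factors vary along h. Otherwise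
  -- co-spanning makes all forms vanish at h, and the product is constant along h.
  P⇒central : ∀ {n} {A : Arr n} {d f} → P A d f → ∀ h v → Below (central ∣ nz A h ∣) (line f h v)
  P⇒central {n} {A = A} (p-mono S co _) h v with any-nonzero? A h (λ i → ¬? (i ∈? S))
  ... | inj₁ (i , i∉S , p) = below-≤ (≤central ∣ nz A h ∣)
        (≡.subst (λ k → Below k (line (mono A S) h v)) (x∈p⇒suc∣p-x∣≡∣p∣ (#⇒∈nz A p)) (top⇒below ∣ nz A h ∖ i ∣ (mono-top A (nz A h ∖ i) S h v
          λ {j} j∈S j∉ → ∉nz⇒≈0 A λ j∈ → j∉ (x∈p∧x≢y⇒x∈p-y {x = j} {y = i} j∈ λ { ≡.refl → i∉S j∈S }))))
  ... | inj₂ z = below-≤ (≡.subst (λ k → suc k ℕ.≤ central ∣ nz A h ∣) (≡.sym (∣⊥∣≡0 n)) (central≥1 ∣ nz A h ∣))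
        (top⇒below ∣ ⊥ {n} ∣ (mono-top A ⊥ S h v λ {i} _ _ → co h z i))
  P⇒central {A = A} p-0          h v = below-0 (central ∣ nz A h ∣) (λ _ → refl)
  P⇒central {A = A} (p-* x p)    h v = below-* (central ∣ nz A h ∣) x (P⇒central p h v)
  P⇒central {A = A} (p-+ p q)    h v = below-+ (central ∣ nz A h ∣) (P⇒central p h v) (P⇒central q h v)
  P⇒central {A = A} (p-resp e p) h v = below-resp (central ∣ nz A h ∣) (λ t → e _) (P⇒central p h v)

-- Leading coefficients along a direction

module Symbols {c ℓ₁ ℓ₂ m ℓm : Level} (K : CharZeroField c ℓ₁ ℓ₂)
               (V : Module (CharZeroField.commutativeRing K) m ℓm) where
  open Field K
  open Univariate K
  open Polynomials K V
  open Subsets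
  open Arrangements K V

  x-cy≈0⇒x≈cy : ∀ {x y z} → x + (- z) * y ≈ 0# → x ≈ z * y
  x-cy≈0⇒x≈cy {x} {y} {z} e = x-y≈0⇒x≈y (trans (solve 3 (λ x y z → x :- z :* y := x :+ (:- z) :* y) refl x y z) e)

  x≈cy⇒x-cy≈0 : ∀ {x y z} → x ≈ z * y → x + (- z) * y ≈ 0#
  x≈cy⇒x-cy≈0 {x} {y} {z} e = trans (+-congʳ e) (solve 2 (λ y z → z :* y :+ (:- z) :* y := :0) refl y z)

  -- The scalar is chosen so that y₀ also vanishes at h′ - x h; co-spanning then puts this vector
  -- into the common kernel. So the forms outside S other than y₀ share at most a line modulo the
  -- common kernel.
  proportional : ∀ {n} {A : Arr n} {S} → CoSpans A S → ∀ {y₀ h h′} → ⟦ A y₀ ⟧ h # 0# →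
    (∀ i → i ∉ S → i ≢ y₀ → ⟦ A i ⟧ h ≈ 0#) → (∀ i → i ∉ S → i ≢ y₀ → ⟦ A i ⟧ h′ ≈ 0#) →
    Σ[ x ∈ 𝕂 ] (∀ i → ⟦ A i ⟧ h′ ≈ x * ⟦ A i ⟧ h)
  proportional {A = A} {S} co {y₀} {h} {h′} p z z′ = x , λ i → x-cy≈0⇒x≈cy
    (trans (sym (form-line (A i) h′ (- x) h)) (co (h′ +ᴹ (- x) *ₗ h) vanish i))
    where
    x = ⟦ A y₀ ⟧ h′ * p ⁻¹
    vanish : ∀ i → i ∉ S → ⟦ A i ⟧ (h′ +ᴹ (- x) *ₗ h) ≈ 0#
    vanish i i∉S = trans (form-line (A i) h′ (- x) h) (x≈cy⇒x-cy≈0 eq)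
      where
      eq : ⟦ A i ⟧ h′ ≈ x * ⟦ A i ⟧ h
      eq with i FinP.≟ y₀
      ... | yes ≡.refl = x≈[yx⁻¹]x p _
      ... | no  i≢y₀   = trans (z′ i i∉S i≢y₀) (sym (trans (*-congˡ (z i i∉S i≢y₀)) (zeroʳ x)))

  -- For f in P A, the coefficient s of t to the power ρ(h) - 1 in f (v + t h),
  -- and its extension s · ∏ A i, the product over i ≠ b with A i h ≠ 0.
  record Symbol {n} (A : Arr n) (d : ℕ) (h : 𝕍) (b : Fin n) (f : Fun) : Set (c ⊔ ℓ₁ ⊔ ℓ₂ ⊔ m ⊔ ℓm) where
    field
      s         : Fun
      top       : ∀ v → Top ∣ nz A h ∖ b ∣ (line f h v) (s v)
      invariant : ∀ v t → s (v +ᴹ t *ₗ h) ≈ s v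
      in-P      : P A d (λ v → s v * mono A (nz A h ∖ b) v)
      -- The form y, zero at h but not at h₁, certifies that h₁ is not a multiple of h modulo the
      -- common kernel.
      degree    : ∀ h₁ → ⟦ A b ⟧ h₁ # 0# → (Σ[ y ∈ Fin n ] ⟦ A y ⟧ h ≈ 0# × ⟦ A y ⟧ h₁ # 0#) →
                  ∀ v → Below ∣ nz A h₁ ∖ b ∣ (line (λ v → s v * mono A (nz A h ∖ b) v) h₁ v)
      -- A nonzero symbol is possible only if the forms vanishing at h share just the line of h
      -- modulo the common kernel. A further shared direction e, normalised by b(e) = 0, therefore
      -- kills it.
      vanish    : ∀ e → (∀ y → ⟦ A y ⟧ h ≈ 0# → ⟦ A y ⟧ e ≈ 0#) → ⟦ A b ⟧ e ≈ 0# →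
                  (Σ[ x ∈ Fin n ] ⟦ A x ⟧ e # 0#) → ∀ v → s v ≈ 0#

  module _ {n} {A : Arr n} {d : ℕ} {h : 𝕍} {b : Fin n} where
    private
      J = nz A h ∖ b
      q : Fun
      q = mono A J

    symbol-0 : ∀ {f} → (∀ v → Below ∣ J ∣ (line f h v)) → Symbol A d h b f
    symbol-0 bf = record
      { s         = λ _ → 0#
      ; top       = λ v → below⇒top-0 ∣ J ∣ (bf v)
      ; invariant = λ _ _ → refl
      ; in-P      = p-resp (λ v → sym (zeroˡ (q v))) p-0
      ; degree    = λ h₁ _ _ v → below-0 ∣ nz A h₁ ∖ b ∣ (λ t → zeroˡ _)
      ; vanish    = λ _ _ _ _ _ → refl
      }

    symbol-* : ∀ x {f} → Symbol A d h b f → Symbol A d h b (λ v → x * f v)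
    symbol-* x σ = record
      { s         = λ v → x * s v
      ; top       = λ v → top-* ∣ J ∣ x (top v)
      ; invariant = λ v t → *-congˡ (invariant v t)
      ; in-P      = p-resp (λ v → sym (*-assoc x (s v) (q v))) (p-* x in-P)
      ; degree    = λ h₁ p y v → below-resp ∣ nz A h₁ ∖ b ∣ (λ t → sym (*-assoc x _ _)) (below-* ∣ nz A h₁ ∖ b ∣ x (degree h₁ p y v))
      ; vanish    = λ e z zb y v → trans (*-congˡ (vanish e z zb y v)) (zeroʳ x)
      }
      where open Symbol σ

    symbol-+ : ∀ {f g} → Symbol A d h b f → Symbol A d h b g → Symbol A d h b (λ v → f v + g v)
    symbol-+ σ τ = record
      { s         = λ v → σ.s v + τ.s v
      ; top       = λ v → top-+ ∣ J ∣ (σ.top v) (τ.top v)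
      ; invariant = λ v t → +-cong (σ.invariant v t) (τ.invariant v t)
      ; in-P      = p-resp (λ v → sym (distribʳ (q v) (σ.s v) (τ.s v))) (p-+ σ.in-P τ.in-P)
      ; degree    = λ h₁ p y v → below-resp ∣ nz A h₁ ∖ b ∣ (λ t → sym (distribʳ _ _ _))
                      (below-+ ∣ nz A h₁ ∖ b ∣ (σ.degree h₁ p y v) (τ.degree h₁ p y v))
      ; vanish    = λ e z zb y v → trans (+-cong (σ.vanish e z zb y v) (τ.vanish e z zb y v)) (+-identityˡ 0#)
      }
      where
      module σ = Symbol σ
      module τ = Symbol τ

    symbol-resp : ∀ {f g} → (∀ v → f v ≈ g v) → Symbol A d h b f → Symbol A d h b g
    symbol-resp e σ = record
      { Symbol σ using (s; invariant; in-P; degree; vanish)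
      ; top = λ v → top-resp ∣ J ∣ (λ t → e _) refl (Symbol.top σ v)
      }

    module _ (b# : ⟦ A b ⟧ h # 0#) (S : Subset n) (co : CoSpans A S) (eq : ∣ S ∣ ≡ d) where
      private
        b∈nz = #⇒∈nz A b#

        ∉∖ : ∀ {T : Subset n} {y i} → i ≢ y → i ∉ T ∖ y → i ∉ T
        ∉∖ i≢y i∉ i∈ = i∉ (x∈p∧x≢y⇒x∈p-y i∈ i≢y)

        ∣J∣≡ : ∀ {y} → ⟦ A y ⟧ h # 0# → ∣ nz A h ∖ y ∣ ≡ ∣ J ∣
        ∣J∣≡ p = ℕP.suc-injective (≡.trans (x∈p⇒suc∣p-x∣≡∣p∣ (#⇒∈nz A p)) (≡.sym (x∈p⇒suc∣p-x∣≡∣p∣ b∈nz)))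

        outsideE : ∀ {y} → y ∉ S → ∀ {i} → i ∈ S → i ∉ nz A h ∖ y → ⟦ A i ⟧ h ≈ 0#
        outsideE {y} y∉S {i} i∈S i∉ = ∉nz⇒≈0 A (∉∖ (λ { ≡.refl → y∉S i∈S }) i∉)

      -- S misses two of the forms which are nonzero at h.
      symbol-mono-0 : ∀ {y₀ y₁} → y₀ ∉ S → ⟦ A y₀ ⟧ h # 0# → y₁ ∉ S → y₁ ≢ y₀ → ⟦ A y₁ ⟧ h # 0# → Symbol A d h b (mono A S)
      symbol-mono-0 {y₀} {y₁} y₀∉S p₀ y₁∉S y₁≢y₀ p₁ = symbol-0 λ v →
        ≡.subst (λ k → Below k (line (mono A S) h v)) (∣J∣≡ p₀)
          (top-0⇒below ∣ nz A h ∖ y₀ ∣ (coef-zero A (nz A h ∖ y₀) S (x∈p∧x≢y⇒x∈p-y (#⇒∈nz A p₁) y₁≢y₀) y₁∉S)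
            (mono-top A (nz A h ∖ y₀) S h v (outsideE y₀∉S)))

      -- S misses only the form y₀ of those which are nonzero at h: the extension
      -- of the symbol is then the product in which b is exchanged for y₀.
      module _ {y₀} (y₀∉S : y₀ ∉ S) (p₀ : ⟦ A y₀ ⟧ h # 0#) (z : ∀ i → i ∉ S → i ≢ y₀ → ⟦ A i ⟧ h ≈ 0#) where
        private
          E = nz A h ∖ y₀
          S′ = (S ─ E) ∪ J

          E⊆S : E ⊆ S
          E⊆S {i} i∈E with i ∈? S
          ... | yes i∈S = i∈S
          ... | no  i∉S = contradiction (z i i∉S (x∈p-y⇒x≢y i∈E)) (#⇒≉ (∈nz⇒# A (p─q⊆p (nz A h) ⁅ y₀ ⁆ i∈E)))

          S─E-zero : ∀ {i} → i ∈ S ─ E → ⟦ A i ⟧ h ≈ 0#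
          S─E-zero i∈ = outsideE y₀∉S (p─q⊆p S E i∈) (x∈p─q⇒x∉q i∈)

          disjoint : Disjoint (S ─ E) J
          disjoint i∈ i∈J = ≈0⇒∉nz A (S─E-zero i∈) (p─q⊆p (nz A h) ⁅ b ⁆ i∈J)

          ∣S′∣≡d : ∣ S′ ∣ ≡ d
          ∣S′∣≡d = ≡.trans (∣p∪q∣≡∣p∣+∣q∣ (S ─ E) J disjoint) (≡.trans (≡.cong (∣ S ─ E ∣ ℕ.+_) (≡.sym (∣J∣≡ p₀)))
            (≡.trans (∣p─q∣+∣q∣≡∣p∣ S E E⊆S) eq))

          b∉S′ : b ∉ S′
          b∉S′ b∈ with x∈p∪q⁻ (S ─ E) J b∈
          ... | inj₁ b∈─ = #⇒≉ b# (S─E-zero b∈─)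
          ... | inj₂ b∈J = x∈p-y⇒x≢y b∈J ≡.refl

          ∉S′ : ∀ {i} → i ∉ S → i ≢ y₀ → i ∉ S′
          ∉S′ {i} i∉S i≢y₀ i∈ with x∈p∪q⁻ (S ─ E) J i∈
          ... | inj₁ i∈─ = i∉S (p─q⊆p S E i∈─)
          ... | inj₂ i∈J = ≈0⇒∉nz A (z i i∉S i≢y₀) (p─q⊆p (nz A h) ⁅ b ⁆ i∈J)

          ≢b : ∀ {i} → i ∉ S → i ≢ y₀ → i ≢ b
          ≢b i∉S i≢y₀ ≡.refl = #⇒≉ b# (z b i∉S i≢y₀)

          zero-if-b : ∀ {h′ x} → (∀ i → ⟦ A i ⟧ h′ ≈ x * ⟦ A i ⟧ h) → ⟦ A b ⟧ h′ ≈ 0# → ∀ i → ⟦ A i ⟧ h′ ≈ 0#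
          zero-if-b {x = x} prop bz i = trans (prop i) (trans (*-congʳ
            (cancel-zero b# (trans (*-comm _ x) (trans (sym (prop b)) bz)))) (zeroˡ _))

          -- A common zero of the forms outside S′ is a common zero of those outside S other than
          -- y₀, hence a multiple of h modulo the common kernel. As b is also outside S′ and nonzero
          -- at h, the multiple is zero.
          co′ : CoSpans A S′
          co′ h′ z′ = zero-if-b (proj₂ (proportional {A = A} {S} co {y₀} {h} {h′} p₀ z λ i i∉S i≢y₀ → z′ i (∉S′ i∉S i≢y₀))) (z′ b b∉S′)

          s : Fun
          s v = mono A E h * mono A (S ─ E) v

          extension : ∀ v → mono A E h * mono A S′ v ≈ s v * q v
          extension v = trans (*-congˡ (mono-∪ A (S ─ E) J v disjoint)) (sym (*-assoc _ _ _))

          -- If some i ≠ b outside S′ is nonzero at h₁, then the product misses both b and i, which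
          -- pushes its degree below ρ(h₁) - 1. Otherwise h₁ would be a multiple of h modulo the
          -- common kernel, which y rules out.
          degree-S′ : ∀ h₁ → ⟦ A b ⟧ h₁ # 0# → (Σ[ y ∈ Fin n ] ⟦ A y ⟧ h ≈ 0# × ⟦ A y ⟧ h₁ # 0#) →
            ∀ v → Below ∣ nz A h₁ ∖ b ∣ (line (mono A S′) h₁ v)
          degree-S′ h₁ b#₁ (y , yz , y#) v with any-nonzero? A h₁ (λ i → ¬? (i ∈? S′) ×-dec ¬? (i FinP.≟ b))
          ... | inj₁ (i , (i∉S′ , i≢b) , i#) = top-0⇒below ∣ nz A h₁ ∖ b ∣
            (coef-zero A (nz A h₁ ∖ b) S′ (x∈p∧x≢y⇒x∈p-y (#⇒∈nz A i#) i≢b) i∉S′)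
            (mono-top A (nz A h₁ ∖ b) S′ h₁ v λ {j} j∈ j∉ → ∉nz⇒≈0 A (∉∖ (λ { ≡.refl → b∉S′ j∈ }) j∉))
          ... | inj₂ z₁ = contradiction
            (trans (proj₂ prop y) (trans (*-congˡ yz) (zeroʳ _))) (#⇒≉ y#)
            where prop = proportional {A = A} {S} co {y₀} {h} {h₁} p₀ z λ i i∉S i≢y₀ → z₁ i (∉S′ i∉S i≢y₀ , ≢b i∉S i≢y₀)

        symbol-mono-1 : Symbol A d h b (mono A S)
        symbol-mono-1 = record
          { s         = s
          ; top       = λ v → ≡.subst (λ k → Top k (line (mono A S) h v) (s v)) (∣J∣≡ p₀)
                          (top-resp ∣ E ∣ (λ _ → refl) (coef-⊆ A E S h v E⊆S) (mono-top A E S h v (outsideE y₀∉S)))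
          ; invariant = λ v t → *-congˡ (mono-cong A A (S ─ E) λ {i} i∈ →
                          trans (form-line (A i) v t h) (trans (+-congˡ (trans (*-congˡ (S─E-zero i∈)) (zeroʳ t))) (+-identityʳ _)))
          ; in-P      = p-resp extension (p-* (mono A E h) (p-mono S′ co′ ∣S′∣≡d))
          ; degree    = λ h₁ b#₁ y v → below-resp ∣ nz A h₁ ∖ b ∣ (λ t → extension _)
                          (below-* ∣ nz A h₁ ∖ b ∣ (mono A E h) (degree-S′ h₁ b#₁ y v))
          ; vanish    = λ e ze zb (x , x#) v → contradiction
                          (zero-if-b (proj₂ (proportional {A = A} {S} co {y₀} {h} {e} p₀ z λ i i∉S i≢y₀ → ze i (z i i∉S i≢y₀))) zb x) (#⇒≉ x#)
          }

      symbol-mono : Symbol A d h b (mono A S)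
      symbol-mono with any-nonzero? A h (λ i → ¬? (i ∈? S))
      ... | inj₂ z = contradiction (co h z b) (#⇒≉ b#)
      ... | inj₁ (y₀ , y₀∉S , p₀) with any-nonzero? A h (λ i → ¬? (i ∈? S) ×-dec ¬? (i FinP.≟ y₀))
      ...   | inj₁ (y₁ , (y₁∉S , y₁≢y₀) , p₁) = symbol-mono-0 y₀∉S p₀ y₁∉S y₁≢y₀ p₁
      ...   | inj₂ z = symbol-mono-1 y₀∉S p₀ λ i i∉S i≢y₀ → z i (i∉S , i≢y₀)

    -- The recursion runs over the derivation, but by `top-unique` the values of `s` depend on f
    -- alone. This allows symbols taken in different arrangements to be compared.
    symbol : ⟦ A b ⟧ h # 0# → ∀ {f} → P A d f → Symbol A d h b f
    symbol b# (p-mono S co eq) = symbol-mono b# S co eq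
    symbol b# p-0              = symbol-0 λ v → below-0 ∣ J ∣ (λ _ → refl)
    symbol b# (p-* x p)        = symbol-* x (symbol b# p)
    symbol b# (p-+ p q)        = symbol-+ (symbol b# p) (symbol b# q)
    symbol b# (p-resp e p)     = symbol-resp e (symbol b# p)

-- Deletion, contraction, and P(A) = C₋₁(A)

module Deletion {c ℓ₁ ℓ₂ m ℓm : Level} (K : CharZeroField c ℓ₁ ℓ₂)
                (V : Module (CharZeroField.commutativeRing K) m ℓm) (fin : FiniteDimensional K V) where
  open Field K
  open Univariate K
  open Polynomials K V
  open Arrangements K V
  open SetoidReasoning setoid

  nz-cong : ∀ {n} (A B : Arr n) {v w} → (∀ i → ⟦ A i ⟧ v # 0# → ⟦ B i ⟧ w # 0#) →
    (∀ i → ⟦ B i ⟧ w # 0# → ⟦ A i ⟧ v # 0#) → nz A v ≡ nz B w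
  nz-cong {zero}  A B to from = ≡.refl
  nz-cong {suc n} A B {v} {w} to from with ⟦ A zero ⟧ v #? 0# | ⟦ B zero ⟧ w #? 0# | nz-cong (A ∘ suc) (B ∘ suc) (to ∘ suc) (from ∘ suc)
  ... | yes _ | yes _ | eq = ≡.cong (inside ∷_) eq
  ... | no _  | no _  | eq = ≡.cong (outside ∷_) eq
  ... | yes p | no ¬q | _  = contradiction (to zero p) ¬q
  ... | no ¬p | yes q | _  = contradiction (from zero q) ¬p

  nz-cong-≈ : ∀ {n} (A B : Arr n) {v w} → (∀ i → ⟦ A i ⟧ v ≈ ⟦ B i ⟧ w) → nz A v ≡ nz B w
  nz-cong-≈ A B e = nz-cong A B (λ i → #-resp (e i)) (λ i → #-resp (sym (e i)))

  ∣nz∣-apart : ∀ {n} (A : Arr (suc n)) {h} → ⟦ A zero ⟧ h # 0# → ∣ nz A h ∣ ≡ suc ∣ nz (A ∘ suc) h ∣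
  ∣nz∣-apart A {h} p with ⟦ A zero ⟧ h #? 0#
  ... | yes _ = ≡.refl
  ... | no ¬p = contradiction p ¬p

  ∣nz∣-zero : ∀ {n} (A : Arr (suc n)) {h} → ⟦ A zero ⟧ h ≈ 0# → ∣ nz A h ∣ ≡ ∣ nz (A ∘ suc) h ∣
  ∣nz∣-zero A {h} z with ⟦ A zero ⟧ h #? 0#
  ... | yes p = contradiction z (#⇒≉ p)
  ... | no _  = ≡.refl

  ∣nz∣-empty : ∀ {n} (A : Arr n) {h} → (∀ i → ⟦ A i ⟧ h ≈ 0#) → ∣ nz A h ∣ ≡ 0
  ∣nz∣-empty {zero}  A z = ≡.refl
  ∣nz∣-empty {suc n} A z = ≡.trans (∣nz∣-zero A (z zero)) (∣nz∣-empty (A ∘ suc) (z ∘ suc))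

  combination : ∀ {n} → (Fin n → 𝕂) → Arr n → Fun
  combination a A v = sum (λ i → a i * ⟦ A i ⟧ v)

  combination-zero : ∀ {n} (a : Fin n → 𝕂) (A : Arr n) {h} → (∀ i → ⟦ A i ⟧ h ≈ 0#) → combination a A h ≈ 0#
  combination-zero {n} a A z = trans (sum-cong-≋ {n} (λ i → trans (*-congˡ (z i)) (zeroʳ (a i)))) (sum-replicate-zero n)

  vanish-on-combinations : ∀ (φ : Form) {d} (a : Fin d → 𝕂) (b : Fin d → 𝕍) → (∀ j → ⟦ φ ⟧ (b j) ≈ 0#) →
    ⟦ φ ⟧ (linearCombination K (Module.leftModule V) a b) ≈ 0#
  vanish-on-combinations φ {zero}  a b z = form-0 φ
  vanish-on-combinations φ {suc d} a b z = trans (form-+ φ _ _) (trans (+-cong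
    (trans (form-* φ (a zero) (b zero)) (trans (*-congˡ (z zero)) (zeroʳ _)))
    (vanish-on-combinations φ (a ∘ suc) (b ∘ suc) (z ∘ suc))) (+-identityˡ 0#))

  -- A form that vanishes on a basis is zero, which leaves finitely many decidable tests. Here the
  -- finite dimension of V enters.
  zero-or-one : ∀ (φ : Form) → (∀ v → ⟦ φ ⟧ v ≈ 0#) ⊎ (Σ[ u ∈ 𝕍 ] ⟦ φ ⟧ u ≈ 1#)
  zero-or-one φ = decide (FinP.any? (λ j → ⟦ φ ⟧ (b j) #? 0#))
    where
    open HasDimension (proj₂ fin)
    decide : Dec (∃ λ j → ⟦ φ ⟧ (b j) # 0#) → _
    decide (yes (j , p)) = inj₂ (p ⁻¹ *ₗ b j , trans (form-* φ (p ⁻¹) (b j)) (⁻¹-inverseˡ p))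
    decide (no none) = inj₁ λ v → trans (form-cong φ (proj₂ (spanning {v} _)))
      (vanish-on-combinations φ (proj₁ (spanning {v} _)) b
        (λ j → [ (λ p → contradiction (j , p) none) , (λ z → z) ]′ (zero-or-apart (⟦ φ ⟧ (b j)))))

  Spanned Separated : ∀ {n} → Arr n → Form → Set (c ⊔ ℓ₁ ⊔ m)
  Spanned   A φ = Σ[ a ∈ _ ] (∀ v → ⟦ φ ⟧ v ≈ combination a A v)
  Separated A φ = Lift c (Σ[ h ∈ 𝕍 ] (∀ i → ⟦ A i ⟧ h ≈ 0#) × ⟦ φ ⟧ h ≈ 1#)

  spanned-suc : ∀ {n} (A : Arr (suc n)) (φ : Form) x a →
    (∀ v → ⟦ φ ⟧ v ≈ x * ⟦ A zero ⟧ v + combination a (A ∘ suc) v) → Spanned A φ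
  spanned-suc A φ x a e = (x ∷ᶠ a) , e

  private
    separated-step : ∀ {n} (A : Arr (suc n)) (φ : Form) {h₀} → (∀ i → ⟦ A (suc i) ⟧ h₀ ≈ 0#) → ⟦ A zero ⟧ h₀ ≈ 1# →
      Spanned (A ∘ suc) (formOnKernel (A zero) h₀ φ) ⊎ Separated (A ∘ suc) (formOnKernel (A zero) h₀ φ) →
      Spanned A φ ⊎ Separated A φ
    separated-step A φ {h₀} z₀ e₀ (inj₁ (a , e)) = inj₁ (spanned-suc A φ (⟦ φ ⟧ h₀) a λ v → trans
      (solve 3 (λ x y z → x := z :* y :+ (x :+ (:- y) :* z)) refl (⟦ φ ⟧ v) (⟦ A zero ⟧ v) (⟦ φ ⟧ h₀))
      (+-congˡ (trans (sym (form-π (A zero) h₀ φ v)) (e v))))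
    -- Moving the separating direction along h₀, where the later forms vanish, makes the first form
    -- vanish as well.
    separated-step A φ {h₀} z₀ e₀ (inj₂ (Level.lift (h , z , e))) = inj₂ (Level.lift (π (A zero) h₀ h , vanish , e))
      where
      vanish : ∀ i → ⟦ A i ⟧ (π (A zero) h₀ h) ≈ 0#
      vanish zero    = trans (form-π (A zero) h₀ (A zero) h) (trans (+-congˡ (*-congˡ e₀))
        (solve 1 (λ x → x :+ (:- x) :* :1 := :0) refl (⟦ A zero ⟧ h)))
      vanish (suc i) = trans (form-π (A zero) h₀ (A (suc i)) h)
        (trans (+-cong (z i) (trans (*-congˡ (z₀ i)) (zeroʳ _))) (+-identityˡ 0#))

    spanned-step : ∀ {n} (A : Arr (suc n)) (φ : Form) → Spanned (A ∘ suc) (A zero) →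
      Spanned (A ∘ suc) φ ⊎ Separated (A ∘ suc) φ → Spanned A φ ⊎ Separated A φ
    spanned-step A φ (a₀ , e₀) (inj₁ (a , e)) = inj₁ (spanned-suc A φ 0# a λ v → trans (e v)
      (sym (trans (+-congʳ (zeroˡ (⟦ A zero ⟧ v))) (+-identityˡ (combination a (A ∘ suc) v)))))
    spanned-step A φ (a₀ , e₀) (inj₂ (Level.lift (h , z , e))) = inj₂ (Level.lift (h , vanish , e))
      where
      vanish : ∀ i → ⟦ A i ⟧ h ≈ 0#
      vanish zero    = trans (e₀ h) (combination-zero a₀ (A ∘ suc) z)
      vanish (suc i) = z i

  -- Elimination: if h₀ separates the first form l from the later ones, then φ is replaced by φ -
  -- φ(h₀) l, which vanishes at h₀. Otherwise l is a combination of the later forms and adds nothing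
  -- to their span.
  spanned-or-separated : ∀ {n} (A : Arr n) (φ : Form) → Spanned A φ ⊎ Separated A φ
  spanned-or-separated {zero} A φ =
    [ (λ z → inj₁ ((λ ()) , z)) , (λ (u , e) → inj₂ (Level.lift (u , (λ ()) , e))) ]′ (zero-or-one φ)
  spanned-or-separated {suc n} A φ =
    [ (λ s → spanned-step A φ s (spanned-or-separated (A ∘ suc) φ))
    , (λ (Level.lift (h₀ , z₀ , e₀)) → separated-step A φ z₀ e₀ (spanned-or-separated (A ∘ suc) (formOnKernel (A zero) h₀ φ)))
    ]′ (spanned-or-separated (A ∘ suc) (A zero))

  data Kind {n} (A : Arr (suc n)) : Set (c ⊔ ℓ₁ ⊔ m) where
    loop    : (∀ v → ⟦ A zero ⟧ v ≈ 0#) → Kind A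
    coloop  : ∀ h → ⟦ A zero ⟧ h ≈ 1# → (∀ i → ⟦ A (suc i) ⟧ h ≈ 0#) → Kind A
    generic : ∀ u → ⟦ A zero ⟧ u ≈ 1# → ∀ a → (∀ v → ⟦ A zero ⟧ v ≈ combination a (A ∘ suc) v) → Kind A

  kind : ∀ {n} (A : Arr (suc n)) → Kind A
  kind A with spanned-or-separated (A ∘ suc) (A zero)
  ... | inj₂ (Level.lift (h , z , e)) = coloop h e z
  ... | inj₁ (a , e) with zero-or-one (A zero)
  ...   | inj₁ z        = loop z
  ...   | inj₂ (u , e′) = generic u e′ a e

  contract : ∀ {n} → Arr (suc n) → 𝕍 → Arr n
  contract A u i = formOnKernel (A zero) u (A (suc i))

  module _ (l : Form) {u : 𝕍} (lu≈1 : ⟦ l ⟧ u ≈ 1#) where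

    l-π : ∀ v → ⟦ l ⟧ (π l u v) ≈ 0#
    l-π v = trans (form-π l u l v) (trans (+-congˡ (*-congˡ lu≈1))
      (solve 1 (λ x → x :+ (:- x) :* :1 := :0) refl (⟦ l ⟧ v)))

  -- At π h the form l vanishes and the other forms take the values of their contractions at h, so
  -- the two values of ρ agree. The bound `β` is a parameter because both C₋₁ and C₋₂ are restricted
  -- this way.
  below-restrict : ∀ {f} → (∀ {v w} → v ≈ᴹ w → f v ≈ f w) → ∀ {n} (A : Arr (suc n)) {u} → ⟦ A zero ⟧ u ≈ 1# → (β : ℕ → ℕ) →
    (∀ h v → Below (β ∣ nz A h ∣) (line f h v)) →
    ∀ h v → Below (β ∣ nz (contract A u) h ∣) (line (f ∘ π (A zero) u) h v)
  below-restrict {f} f-cong A {u} lu≈1 β b h v =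
    ≡.subst (λ k → Below (β k) (line (f ∘ π (A zero) u) h v))
      (≡.trans (∣nz∣-zero A (l-π (A zero) lu≈1 h)) (≡.cong ∣_∣ (nz-cong-≈ (A ∘ suc) (contract A u) (λ _ → refl))))
      (below-resp (β ∣ nz A (π (A zero) u h) ∣) (λ t → f-cong (≈ᴹ-sym (π-line (A zero) u v t h)))
        (b (π (A zero) u h) (π (A zero) u v)))

  module _ (l : Form) {u : 𝕍} (lu≈1 : ⟦ l ⟧ u ≈ 1#) {i : ℕ} {f g : Fun} (hg : Homogeneous i g) (e : ∀ v → f v ≈ ⟦ l ⟧ v * g v) where

    below-quotient-apart : ∀ {h} → ⟦ l ⟧ h # 0# → ∀ k v → Below (suc k) (line f h v) → Below k (line g h v)
    below-quotient-apart {h} p k v b = below-divide k (suc i) p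
      (below-resp (suc k) (λ t → trans (e _) (*-congʳ (form-line l v t h))) b) (hom-below hg h v)

    -- Here l is constant along h, and dividing by this constant works wherever it is nonzero.
    -- Density of these base points covers the rest.
    below-quotient-zero : ∀ {h} → ⟦ l ⟧ h ≈ 0# → ∀ k → (∀ v → Below k (line f h v)) → ∀ v → Below k (line g h v)
    below-quotient-zero {h} z k b = below-dense hg l lu≈1 k λ v p → below-resp k
      (λ t → trans (*-congˡ (trans (e _) (*-congʳ (trans (form-line l v t h) (trans (+-congˡ (trans (*-congˡ z) (zeroʳ t))) (+-identityʳ _))))))
        (trans (sym (*-assoc _ _ _)) (trans (*-congʳ (⁻¹-inverseˡ p)) (*-identityˡ _))))
      (below-* k (p ⁻¹) (b v))

  Central : ∀ {n} → Arr n → Fun → Set (c ⊔ ℓ₁ ⊔ m)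
  Central A f = ∀ h v → Below (central ∣ nz A h ∣) (line f h v)

  central-quotient : ∀ {n} (A : Arr (suc n)) {u i f g} → ⟦ A zero ⟧ u ≈ 1# → Homogeneous i g → (∀ v → f v ≈ ⟦ A zero ⟧ v * g v) →
    Central A f → Central (A ∘ suc) g
  central-quotient A {f = f} lu≈1 hg e cf h v with zero-or-apart (⟦ A zero ⟧ h)
  ... | inj₁ p = below-≤ (≤central _) (below-quotient-apart (A zero) lu≈1 hg e p _ v
        (≡.subst (λ k → Below (central k) (line f h v)) (∣nz∣-apart A p) (cf h v)))
  ... | inj₂ z = below-quotient-zero (A zero) lu≈1 hg e z _
        (λ v → ≡.subst (λ k → Below (central k) (line f h v)) (∣nz∣-zero A z) (cf h v)) v

  central-‿- : ∀ {n} {A : Arr n} {f g} → Central A f → Central A g → Central A (λ v → f v - g v)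
  central-‿- {A = A} cf cg h v = below-‿- (central ∣ nz A h ∣) (cf h v) (cg h v)

  -- With ρ(h) = 1 the bound of C₋₁ leaves only constants along h, so f is determined by its
  -- restriction to the hyperplane.
  below-coloop : ∀ {n} (A : Arr (suc n)) {h i f} → Homogeneous i f → ⟦ A zero ⟧ h ≈ 1# → (∀ i → ⟦ A (suc i) ⟧ h ≈ 0#) →
    Central A f → ∀ v → f v ≈ f (π (A zero) h v)
  below-coloop A {h} {f = f} hf e z cf v = begin
    f v                                     ≈⟨ hom-cong hf (v≈π+lu (A zero) h v) ⟩
    line f h (π (A zero) h v) (⟦ A zero ⟧ v)  ≈⟨ below-1 (≡.subst (λ k → Below (central k) (line f h (π (A zero) h v)))
      (≡.trans (∣nz∣-apart A (#-resp (sym e) 1#0)) (≡.cong suc (∣nz∣-empty (A ∘ suc) z))) (cf h _)) _ ⟩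
    line f h (π (A zero) h v) 0#            ≈⟨ hom-cong hf (v+0h≈v _ h) ⟩
    f (π (A zero) h v)                      ∎

  P-outside : ∀ {n} (A : Arr (suc n)) {d f} → P (A ∘ suc) d f → P A d f
  P-outside A (p-mono S co eq) = p-mono (outside ∷ S)
    (λ { h z zero → z zero λ () ; h z (suc i) → co h (λ i i∉S → z (suc i) λ { (there i∈S) → i∉S i∈S }) i }) eq
  P-outside A p-0              = p-0
  P-outside A (p-* x p)        = p-* x (P-outside A p)
  P-outside A (p-+ p q)        = p-+ (P-outside A p) (P-outside A q)
  P-outside A (p-resp e p)     = p-resp e (P-outside A p)

  P-inside : ∀ {n} (A : Arr (suc n)) a → (∀ v → ⟦ A zero ⟧ v ≈ combination a (A ∘ suc) v) →
    ∀ {d f} → P (A ∘ suc) d f → P A (suc d) (λ v → ⟦ A zero ⟧ v * f v)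
  P-inside A a e (p-mono S co eq) = p-mono (inside ∷ S)
    (λ h z → let z′ = co h (λ i i∉S → z (suc i) λ { (there i∈S) → i∉S i∈S }) in
      λ { zero → trans (e h) (combination-zero a (A ∘ suc) z′) ; (suc i) → z′ i }) (≡.cong suc eq)
  P-inside A a e p-0              = p-resp (λ v → sym (zeroʳ _)) p-0
  P-inside A a e (p-* x {f} p)    = p-resp (λ v → solve 3 (λ x y z → x :* (y :* z) := y :* (x :* z)) refl x (⟦ A zero ⟧ v) (f v))
                                      (p-* x (P-inside A a e p))
  P-inside A a e (p-+ p q)        = p-resp (λ v → sym (distribˡ _ _ _)) (p-+ (P-inside A a e p) (P-inside A a e q))
  P-inside A a e (p-resp e′ p)    = p-resp (λ v → *-congˡ (e′ v)) (P-inside A a e p)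

  -- The lift takes the same product of the original forms. Its complement contains l, so a common
  -- zero lies in the kernel of l, where contracted and original forms agree.
  P-lift : ∀ {n} (A : Arr (suc n)) {u d f} → P (contract A u) d f →
    Σ[ g ∈ Fun ] P A d g × (∀ v → g (π (A zero) u v) ≈ f v)
  P-lift A {u} (p-mono S co eq) = mono A (outside ∷ S) , p-mono (outside ∷ S) co′ eq ,
    λ v → mono-cong (A ∘ suc) (contract A u) S λ _ → refl
    where
    co′ : CoSpans A (outside ∷ S)
    co′ h z zero    = z zero λ ()
    co′ h z (suc i) = trans (sym (on-kernel i))
      (co h (λ i i∉S → trans (on-kernel i) (z (suc i) λ { (there i∈S) → i∉S i∈S })) i)
      where
      on-kernel : ∀ i → ⟦ contract A u i ⟧ h ≈ ⟦ A (suc i) ⟧ h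
      on-kernel i = form-cong (A (suc i)) (π-fixes (A zero) u (z zero λ ()))
  P-lift A p-0         = (λ _ → 0#) , p-0 , λ v → refl
  P-lift A (p-* x p) with P-lift A p
  ... | g , pg , e     = _ , p-* x pg , λ v → *-congˡ (e v)
  P-lift A (p-+ p q) with P-lift A p | P-lift A q
  ... | g , pg , e | g′ , pg′ , e′ = _ , p-+ pg pg′ , λ v → +-cong (e v) (e′ v)
  P-lift A (p-resp e′ p) with P-lift A p
  ... | g , pg , e     = g , pg , λ v → trans (e v) (e′ v)

  constant-f : ∀ {d f} → Homogeneous d f → (A : Arr 0) → Central A f → ∀ v → f v ≈ f 0ᴹ
  constant-f {f = f} hf A cf v = begin
    f v                  ≈⟨ hom-cong hf (≈ᴹ-trans (+ᴹ-identityˡ _) (*ₗ-identityˡ v)) ⟨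
    f (0ᴹ +ᴹ 1# *ₗ v)    ≈⟨ below-1 (cf v 0ᴹ) 1# ⟩
    f (0ᴹ +ᴹ 0# *ₗ v)    ≈⟨ hom-cong hf (v+0h≈v 0ᴹ v) ⟩
    f 0ᴹ                 ∎

  P-empty : ∀ (A : Arr 0) d {f} → Homogeneous d f → Central A f → P A d f
  P-empty A zero    {f} hf cf = p-resp (λ v → trans (*-identityʳ _) (sym (constant-f hf A cf v))) (p-* (f 0ᴹ) (p-mono [] (λ _ _ ()) ≡.refl))
  P-empty A (suc d) {f} hf cf = p-resp (λ v → sym (trans (constant-f hf A cf v) (hom-at-0 hf))) p-0

  module _ {n} (A : Arr (suc n)) {d : ℕ} {f : Fun} (hf : Homogeneous d f) (cf : Central A f) where

    central-loop : (∀ v → ⟦ A zero ⟧ v ≈ 0#) → Central (A ∘ suc) f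
    central-loop z h v = ≡.subst (λ k → Below (central k) (line f h v)) (∣nz∣-zero A (z h)) (cf h v)

    module _ {u : 𝕍} (e : ⟦ A zero ⟧ u ≈ 1#) {g : Fun} (pg : P A d g) (eg : ∀ v → g (π (A zero) u v) ≈ f (π (A zero) u v)) where

      private
        hdiff : Homogeneous d (λ v → f v - g v)
        hdiff = hom-‿- hf (P⇒hom pg)

        diff-π : ∀ v → f (π (A zero) u v) - g (π (A zero) u v) ≈ 0#
        diff-π v = trans (+-congˡ (-‿cong (eg v))) (-‿inverseʳ _)

        central-diff : Central A (λ v → f v - g v)
        central-diff = central-‿- {A = A} {f} {g} cf (P⇒central pg)

      P-coloop : (∀ i → ⟦ A (suc i) ⟧ u ≈ 0#) → P A d f
      P-coloop z = p-resp (λ v → sym (x-y≈0⇒x≈y (trans (below-coloop A {f = λ v → f v - g v} hdiff e z central-diff v) (diff-π v)))) pg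

      -- The difference f - g vanishes on the hyperplane, hence is l times an element of C₋₁ of the
      -- deletion. The argument `rec` is the induction hypothesis for the deletion.
      P-generic : ∀ a → (∀ v → ⟦ A zero ⟧ v ≈ combination a (A ∘ suc) v) →
        (∀ {j k} → Homogeneous j k → Central (A ∘ suc) k → P (A ∘ suc) j k) → P A d f
      P-generic a ea rec = finish (divideOut (A zero) u hdiff)
        where
        finish : Σ[ k ∈ Fun ] HomogeneousPred d k × (∀ v → f v - g v ≈ (f (π (A zero) u v) - g (π (A zero) u v)) + ⟦ A zero ⟧ v * k v) → P A d f
        finish (k , hk , ek) = p-resp (λ v → trans (+-congˡ (sym (e′ v))) (solve 2 (λ x y → y :+ (x :- y) := x) refl (f v) (g v)))
          (p-+ pg (product d hk))
          where
          e′ : ∀ v → f v - g v ≈ ⟦ A zero ⟧ v * k v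
          e′ v = trans (ek v) (trans (+-congʳ (diff-π v)) (+-identityˡ _))
          product : ∀ j → HomogeneousPred j k → P A j (λ v → ⟦ A zero ⟧ v * k v)
          product zero    (Level.lift z) = p-resp (λ v → sym (trans (*-congˡ (z v)) (zeroʳ _))) p-0
          product (suc j) hk = P-inside A a ea (rec {k = k} hk (central-quotient A {f = λ v → f v - g v} {k} e hk e′ central-diff))

  central⇒P : ∀ {n} (A : Arr n) {d f} → Homogeneous d f → Central A f → P A d f
  central⇒P {zero}  A {d} hf cf = P-empty A d hf cf
  central⇒P {suc n} A {d} {f} hf cf = by-kind (kind A)
    where
    lifted : ∀ {u} → ⟦ A zero ⟧ u ≈ 1# → Σ[ g ∈ Fun ] P A d g × (∀ v → g (π (A zero) u v) ≈ f (π (A zero) u v))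
    lifted {u} e = P-lift A (central⇒P (contract A u) {f = f ∘ π (A zero) u} (hom-π (A zero) u hf) (below-restrict {f} (hom-cong hf) A e central cf))
    by-kind : Kind A → P A d f
    by-kind (loop z)           = P-outside A (central⇒P (A ∘ suc) {f = f} hf (central-loop A hf cf z))
    by-kind (coloop u e z)     = P-coloop A hf cf e (proj₁ (proj₂ (lifted e))) (proj₂ (proj₂ (lifted e))) z
    by-kind (generic u e a ea) = P-generic A hf cf e (proj₁ (proj₂ (lifted e))) (proj₂ (proj₂ (lifted e))) a ea
      (λ {j} {k} → central⇒P (A ∘ suc) {j} {k})

-- Lifting C₋₂ from the contraction

∈-subsets : ∀ {n} (S : Subset n) → S ∈ₗ subsets n
∈-subsets []            = here ≡.refl
∈-subsets (inside ∷ S)  = ∈-++⁺ˡ (∈-map⁺ (inside ∷_) (∈-subsets S))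
∈-subsets (outside ∷ S) = ∈-++⁺ʳ (List.map (inside ∷_) (subsets _)) (∈-map⁺ (outside ∷_) (∈-subsets S))

module Lifting {c ℓ₁ ℓ₂ m ℓm : Level} (K : CharZeroField c ℓ₁ ℓ₂)
               (V : Module (CharZeroField.commutativeRing K) m ℓm) (fin : FiniteDimensional K V) where
  open Field K
  open Univariate K
  open Polynomials K V
  open Subsets
  open Arrangements K V
  open Symbols K V
  open Deletion K V fin
  open SetoidReasoning setoid

  -- Deleting the forms outside S without renumbering.
  keep : ∀ {n} → Arr n → {Q : Fin n → Set} → (∀ i → Dec (Q i)) → Arr n
  keep A Q? i with Q? i
  ... | yes _ = A i
  ... | no  _ = zeroForm

  keep-yes : ∀ {n} (A : Arr n) {Q : Fin n → Set} (Q? : ∀ i → Dec (Q i)) {i} → Q i → ∀ v → ⟦ keep A Q? i ⟧ v ≈ ⟦ A i ⟧ v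
  keep-yes A Q? {i} q v with Q? i
  ... | yes _ = refl
  ... | no ¬q = contradiction q ¬q

  keep-no : ∀ {n} (A : Arr n) {Q : Fin n → Set} (Q? : ∀ i → Dec (Q i)) {i} → ¬ Q i → ∀ v → ⟦ keep A Q? i ⟧ v ≈ 0#
  keep-no A Q? {i} ¬q v with Q? i
  ... | yes q = contradiction q ¬q
  ... | no _  = refl

  keep-zero : ∀ {n} (A : Arr n) {Q : Fin n → Set} (Q? : ∀ i → Dec (Q i)) {v} →
    (∀ i → Q i → ⟦ A i ⟧ v ≈ 0#) → ∀ i → ⟦ keep A Q? i ⟧ v ≈ 0#
  keep-zero A Q? {v} z i with Q? i
  ... | yes q = z i q
  ... | no _  = refl

  other? : ∀ {n} (b i : Fin n) → Dec (i ≢ b)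
  other? b i = ¬? (i FinP.≟ b)

  erase : ∀ {n} → Arr n → Fin n → Arr n
  erase A b = keep A (other? b)

  nz-erase : ∀ {n} (A : Arr n) b h → nz (erase A b) h ≡ nz A h ∖ b
  nz-erase A b h = ⊆-antisym ⊆ᵣ ⊇ᵣ
    where
    ⊆ᵣ : nz (erase A b) h ⊆ nz A h ∖ b
    ⊆ᵣ {i} i∈ = x∈p∧x≢y⇒x∈p-y (#⇒∈nz A (#-resp (keep-yes A (other? b) i≢b h) (∈nz⇒# (erase A b) i∈))) i≢b
      where
      i≢b : i ≢ b
      i≢b eq = #⇒≉ (∈nz⇒# (erase A b) i∈) (keep-no A (other? b) (λ i≢b → i≢b eq) h)
    ⊇ᵣ : nz A h ∖ b ⊆ nz (erase A b) h
    ⊇ᵣ {i} i∈ = #⇒∈nz (erase A b) (#-resp (sym (keep-yes A (other? b) (x∈p-y⇒x≢y i∈) h)) (∈nz⇒# A (p─q⊆p (nz A h) ⁅ b ⁆ i∈)))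

  nz-erase-zero : ∀ {n} (A : Arr n) b {h} → ⟦ A b ⟧ h ≈ 0# → nz (erase A b) h ≡ nz A h
  nz-erase-zero A b {h} z = nz-cong-≈ (erase A b) A λ i → eq i (i FinP.≟ b)
    where
    eq : ∀ i → Dec (i ≡ b) → ⟦ erase A b i ⟧ h ≈ ⟦ A i ⟧ h
    eq i (yes ≡.refl) = trans (keep-no A (other? b) (λ i≢i → i≢i ≡.refl) h) (sym z)
    eq i (no i≢b)     = keep-yes A (other? b) i≢b h

  ∣nz∖∣ : ∀ {n} (A : Arr n) {b h} → ⟦ A b ⟧ h # 0# → suc ∣ nz A h ∖ b ∣ ≡ ∣ nz A h ∣
  ∣nz∖∣ A b# = x∈p⇒suc∣p-x∣≡∣p∣ (#⇒∈nz A b#)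

  spanned-zero : ∀ {n} (A : Arr n) (φ : Form) {h} → Spanned A φ → (∀ i → ⟦ A i ⟧ h ≈ 0#) → ⟦ φ ⟧ h ≈ 0#
  spanned-zero A φ (a , e) z = trans (e _) (combination-zero a A z)

  separated? : ∀ {n} (A : Arr n) (φ : Form) → Dec (Separated A φ)
  separated? A φ = [ (λ s → no λ { (Level.lift (h , z , e)) → #⇒≉ 1#0 (trans (sym e) (spanned-zero A φ s z)) }) , yes ]′
    (spanned-or-separated A φ)

  -- A form that alone is nonzero at h is not a combination of the others. Coloops are stated
  -- through directions because ρ = 1 is where the degree bounds behave exceptionally.
  HasColoop : ∀ {n} → Arr n → Set (c ⊔ ℓ₁ ⊔ m)
  HasColoop A = Lift (c ⊔ ℓ₁ ⊔ m) (Σ[ h ∈ 𝕍 ] ∣ nz A h ∣ ≡ 1)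

  -- The search over directions is replaced by one over forms, each tested for separation from the
  -- others.
  coloop? : ∀ {n} (A : Arr n) → Dec (HasColoop A)
  coloop? A = decide (FinP.any? (λ i → separated? (erase A i) (A i)))
    where
    decide : Dec (∃ λ i → Separated (erase A i) (A i)) → Dec (HasColoop A)
    decide (yes (i , Level.lift (h , z , e))) = yes (Level.lift (h , ≡.trans (≡.sym (∣nz∖∣ A (#-resp (sym e) 1#0)))
      (≡.cong suc (≡.trans (≡.cong ∣_∣ (≡.sym (nz-erase A i h))) (∣nz∣-empty (erase A i) z)))))
    decide (no none) = no λ { (Level.lift (h , eq)) → [ uncurried h eq , none-nonzero h eq ]′ (any-nonzero? A h (λ _ → yes tt)) }
      where
      none-nonzero : ∀ h → ∣ nz A h ∣ ≡ 1 → ¬ (∀ i → Unit {Level.zero} → ⟦ A i ⟧ h ≈ 0#)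
      none-nonzero h eq z with () ← ≡.trans (≡.sym (∣nz∣-empty A (λ i → z i tt))) eq
      uncurried : ∀ h → ∣ nz A h ∣ ≡ 1 → ¬ (Σ[ i ∈ Fin _ ] Unit {Level.zero} × ⟦ A i ⟧ h # 0#)
      uncurried h eq (i , _ , p) = [ spanned , (λ s → none (i , s)) ]′ (spanned-or-separated (erase A i) (A i))
        where
        ∣erase∣≡0 : ∣ nz (erase A i) h ∣ ≡ 0
        ∣erase∣≡0 = ≡.trans (≡.cong ∣_∣ (nz-erase A i h)) (ℕP.suc-injective (≡.trans (∣nz∖∣ A p) eq))
        erased : ∀ j → ⟦ erase A i j ⟧ h ≈ 0#
        erased j = ∉nz⇒≈0 (erase A i) {i = j} λ j∈ → ℕP.1+n≢0 (≡.trans (x∈p⇒suc∣p-x∣≡∣p∣ j∈) ∣erase∣≡0)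
        spanned : ¬ Spanned (erase A i) (A i)
        spanned s = #⇒≉ p (spanned-zero (erase A i) (A i) s erased)

  coef-self : ∀ {n} (A : Arr n) S h v → coef A S S h v ≈ mono A S h
  coef-self A []            h v = refl
  coef-self A (inside ∷ S)  h v = *-congˡ (coef-self (A ∘ suc) S h v)
  coef-self A (outside ∷ S) h v = coef-self (A ∘ suc) S h v

  -- For b(h) ≠ 0 this is the bound of C₋₂ along h, in the shape that matches the exponent in
  -- `Symbol.top`.
  Good : ∀ {n} → Arr n → Fin n → Fun → 𝕍 → Set (c ⊔ ℓ₁ ⊔ m)
  Good A b f h = ∀ v → Below ∣ nz A h ∖ b ∣ (line f h v)

  module _ {n} (A : Arr n) {b : Fin n} {h h₁ : 𝕍} (b# : ⟦ A b ⟧ h # 0#) where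
    private
      -- The only multiple of h whose subtraction makes b vanish. So h₁ is a multiple of h modulo
      -- the common kernel exactly if all forms vanish at `e`.
      x = ⟦ A b ⟧ h₁ * b# ⁻¹
      e = h₁ +ᴹ (- x) *ₗ h

    difference-b : ⟦ A b ⟧ e ≈ 0#
    difference-b = trans (form-line (A b) h₁ (- x) h) (x≈cy⇒x-cy≈0 (x≈[yx⁻¹]x b# _))

    difference-zero : ∀ i → ⟦ A i ⟧ h ≈ 0# → ⟦ A i ⟧ h₁ ≈ 0# → ⟦ A i ⟧ e ≈ 0#
    difference-zero i z z₁ = trans (form-line (A i) h₁ (- x) h) (trans (+-cong z₁ (trans (*-congˡ z) (zeroʳ _))) (+-identityˡ 0#))

    module _ {d : ℕ} {f : Fun} (pf : P A d f) (b#₁ : ⟦ A b ⟧ h₁ # 0#) (z : ∀ i → ⟦ A i ⟧ e ≈ 0#) where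
      private
        x# : x # 0#
        x# = ≉⇒# λ eq → #⇒≉ b#₁ (trans (x≈[yx⁻¹]x b# _) (trans (*-congʳ eq) (zeroˡ _)))

        multiple : ∀ i → ⟦ A i ⟧ h₁ ≈ x * ⟦ A i ⟧ h
        multiple i = x-cy≈0⇒x≈cy (trans (sym (form-line (A i) h₁ (- x) h)) (z i))

        same-nz : nz A h ≡ nz A h₁
        same-nz = nz-cong A A (λ i p → #-resp (sym (multiple i)) (x#0y#0→xy#0 x# p))
          (λ i p → ≉⇒# λ eq → #⇒≉ p (trans (multiple i) (trans (*-congˡ eq) (zeroʳ x))))

        decompose : ∀ v t → v +ᴹ t *ₗ h₁ ≈ᴹ (v +ᴹ (t * x) *ₗ h) +ᴹ t *ₗ e
        decompose v t = ≈ᴹ-sym (≈ᴹ-trans (+ᴹ-assoc v _ _) (+ᴹ-congˡ (≈ᴹ-trans (+ᴹ-congˡ (≈ᴹ-trans (*ₗ-distribˡ t _ _) (+ᴹ-comm _ _)))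
          (≈ᴹ-trans (≈ᴹ-sym (+ᴹ-assoc _ _ _)) (≈ᴹ-trans (+ᴹ-congʳ (≈ᴹ-trans (+ᴹ-congˡ (≈ᴹ-sym (*ₗ-assoc t (- x) h))) (≈ᴹ-trans (≈ᴹ-sym (*ₗ-distribʳ h _ _))
          (≈ᴹ-trans (*ₗ-congʳ (solve 2 (λ t x → t :* x :+ t :* (:- x) := :0) refl t x)) (*ₗ-zeroˡ h))))) (+ᴹ-identityˡ _))))))

        line-multiple : ∀ v t → line f h v (t * x) ≈ line f h₁ v t
        line-multiple v t = begin
          f (v +ᴹ (t * x) *ₗ h)                  ≈⟨ hom-cong (P⇒hom pf) (v+0h≈v _ e) ⟨
          line f e (v +ᴹ (t * x) *ₗ h) 0#        ≈⟨ below-1 (≡.subst (λ k → Below (central k) (line f e (v +ᴹ (t * x) *ₗ h)))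
                                                     (∣nz∣-empty A z) (P⇒central pf e _)) t ⟨
          line f e (v +ᴹ (t * x) *ₗ h) t         ≈⟨ hom-cong (P⇒hom pf) (decompose v t) ⟨
          f (v +ᴹ t *ₗ h₁)                       ∎

      -- The directions h₁ and h agree up to scaling modulo the common kernel.
      transfer : Good A b f h → Good A b f h₁
      transfer good v = below-resp ∣ nz A h₁ ∖ b ∣ (line-multiple v)
        (below-rescale ∣ nz A h₁ ∖ b ∣ x (≡.subst (λ s → Below ∣ s ∖ b ∣ (line f h v)) same-nz (good v)))

  module _ {n} (A : Arr n) {d : ℕ} {f : Fun} (pf : P A d f) {b : Fin n} {h : 𝕍} (b# : ⟦ A b ⟧ h # 0#) where
    private
      J = nz A h ∖ b
      q = mono A J

    open Symbol (symbol {A = A} {d} {h} {b} b# pf)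

    private
      q# : q h # 0#
      q# = mono-# A J λ i∈J → ∈nz⇒# A (p─q⊆p (nz A h) ⁅ b ⁆ i∈J)

    -- Along h the symbol `s` is constant and `q` has the leading coefficient q(h). After division
    -- by q(h), the extension has exactly the leading coefficient to be removed.
    correction : Fun
    correction v = q# ⁻¹ * (s v * q v)

    correction-P : P A d correction
    correction-P = p-* (q# ⁻¹) in-P

    correction-0 : (∀ v → s v ≈ 0#) → ∀ v → correction v ≈ 0#
    correction-0 z v = trans (*-congˡ (trans (*-congʳ (z v)) (zeroˡ _))) (zeroʳ _)

    good-corrected : Good A b (λ v → f v - correction v) h
    good-corrected v = below-resp ∣ J ∣ (λ t → solve 2 (λ x y → x :+ (:- :1) :* y := x :- y) refl (f (v +ᴹ t *ₗ h)) (correction (v +ᴹ t *ₗ h)))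
      (top-0⇒below ∣ J ∣ leading (top-+ ∣ J ∣ (top v) (top-* ∣ J ∣ (- 1#)
        (top-resp ∣ J ∣ (λ t → *-congˡ (*-congʳ (sym (invariant v t)))) refl
          (top-* ∣ J ∣ (q# ⁻¹) (top-* ∣ J ∣ (s v) (mono-top A J J h v λ i∈ i∉ → contradiction i∈ i∉)))))))
      where
      leading : s v + (- 1#) * (q# ⁻¹ * (s v * coef A J J h v)) ≈ 0#
      leading = begin
        s v + (- 1#) * (q# ⁻¹ * (s v * coef A J J h v)) ≈⟨ +-congˡ (*-congˡ (*-congˡ (*-congˡ (coef-self A J h v)))) ⟩
        s v + (- 1#) * (q# ⁻¹ * (s v * q h)) ≈⟨ solve 3 (λ s x q → s :+ (:- :1) :* (x :* (s :* q)) := s :+ (:- s) :* (x :* q)) refl (s v) (q# ⁻¹) (q h) ⟩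
        s v + (- s v) * (q# ⁻¹ * q h) ≈⟨ +-congˡ (*-congˡ (⁻¹-inverseˡ q#)) ⟩
        s v + (- s v) * 1# ≈⟨ solve 1 (λ s → s :+ (:- s) :* :1 := :0) refl (s v) ⟩
        0# ∎

    good-if-vanishing : (∀ v → s v ≈ 0#) → Good A b f h
    good-if-vanishing z v = top-0⇒below ∣ J ∣ (z v) (top v)

    -- If a form vanishing at h is nonzero at h₁, the correction itself is small along h₁. Otherwise
    -- consider h₁ - x h: either some form is nonzero there, and the correction is zero, or h₁ is a
    -- multiple of h modulo the common kernel and inherits the bound just achieved at h.
    good-preserved : ∀ {h₁} → ⟦ A b ⟧ h₁ # 0# → Good A b f h₁ → Good A b (λ v → f v - correction v) h₁
    good-preserved {h₁} b#₁ good = [ off , along ]′ (any-nonzero? A h₁ (λ i → ¬? (i ∈? nz A h)))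
      where
      k = ∣ nz A h₁ ∖ b ∣
      e = h₁ +ᴹ (- (⟦ A b ⟧ h₁ * b# ⁻¹)) *ₗ h
      off : Σ[ i ∈ Fin n ] i ∉ nz A h × ⟦ A i ⟧ h₁ # 0# → Good A b (λ v → f v - correction v) h₁
      off (i , i∉ , i#) v = below-‿- k (good v) (below-* k (q# ⁻¹) (degree h₁ b#₁ (i , ∉nz⇒≈0 A i∉ , i#) v))
      along : (∀ i → i ∉ nz A h → ⟦ A i ⟧ h₁ ≈ 0#) → Good A b (λ v → f v - correction v) h₁
      along z = [ nonspecial , special ]′ (any-nonzero? A e (λ _ → yes tt))
        where
        nonspecial : Σ[ i ∈ Fin n ] Unit {Level.zero} × ⟦ A i ⟧ e # 0# → Good A b (λ v → f v - correction v) h₁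
        nonspecial (i , _ , i#) v = below-resp k (λ t → sym (trans (+-congˡ (-‿cong (correction-0
          (vanish e (λ y yz → difference-zero A b# y yz (z y (≈0⇒∉nz A yz))) (difference-b A b#) (i , i#)) _)))
          (solve 1 (λ x → x :- :0 := x) refl (f (v +ᴹ t *ₗ h₁))))) (good v)
        special : (∀ i → Unit {Level.zero} → ⟦ A i ⟧ e ≈ 0#) → Good A b (λ v → f v - correction v) h₁
        special z₁ = transfer A b# (p-‿- pf correction-P) b#₁ (λ i → z₁ i tt) good-corrected

    -- Since b′ vanishes at h, erasing it changes neither the support of h nor the factors in the
    -- extension. The symbol computed in the deletion is the same function by uniqueness, so its
    -- extension lies in P of the deletion.
    correction-erase : ∀ {b′} → ⟦ A b′ ⟧ h ≈ 0# → P (erase A b′) d f → P (erase A b′) d correction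
    correction-erase {b′} z pf′ = p-* (q# ⁻¹) (p-resp same-extension σ.in-P)
      where
      b≢b′ : b ≢ b′
      b≢b′ ≡.refl = #⇒≉ b# z
      b#′ : ⟦ erase A b′ b ⟧ h # 0#
      b#′ = #-resp (sym (keep-yes A (other? b′) b≢b′ h)) b#
      module σ = Symbol (symbol {A = erase A b′} {d} {h} {b} b#′ pf′)
      same-nz : nz (erase A b′) h ≡ nz A h
      same-nz = nz-erase-zero A b′ z
      same-s : ∀ v → σ.s v ≈ s v
      same-s v = top-unique ∣ J ∣ (≡.subst (λ S → Top ∣ S ∖ b ∣ (line f h v) (σ.s v)) same-nz (σ.top v)) (top v)
      same-extension : ∀ v → σ.s v * mono (erase A b′) (nz (erase A b′) h ∖ b) v ≈ s v * q v
      same-extension v = *-cong (same-s v) (≡.subst (λ S → mono (erase A b′) (S ∖ b) v ≈ q v) (≡.sym same-nz)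
        (mono-cong (erase A b′) A J λ {i} i∈ → keep-yes A (other? b′)
          (λ { ≡.refl → ≈0⇒∉nz A z (p─q⊆p (nz A h) ⁅ b ⁆ i∈) }) v))

  Internal : ∀ {n} → Arr n → ℕ → Fun → Set (c ⊔ ℓ₁ ⊔ m ⊔ ℓm)
  Internal A d f = Homogeneous d f × (∀ h v → Below (internal ∣ nz A h ∣) (line f h v))

  internal≤central : ∀ k → internal k ℕ.≤ central k
  internal≤central zero    = ℕP.≤-refl
  internal≤central (suc k) = ℕP.n≤1+n k

  internal⇒central : ∀ {n} (A : Arr n) {d f} → Internal A d f → Central A f
  internal⇒central A (_ , b) h v = below-≤ (internal≤central ∣ nz A h ∣) (b h v)

  module Correct {n} (A : Arr (suc n)) {u : 𝕍} (e : ⟦ A zero ⟧ u ≈ 1#) {d : ℕ} {f₀ : Fun} (in₀ : Internal (contract A u) d f₀) where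
    private
      l = A zero

    -- A lift of f₀ to P A which has become small enough along all directions off the hyperplanes in bs.
    record State (bs : List (Fin n)) (f : Fun) : Set (c ⊔ ℓ₁ ⊔ m ⊔ ℓm) where
      constructor state
      field
        in-P     : P A d f
        in-erase : All (λ b → P (erase A (suc b)) d f) bs
        lifts    : ∀ v → f (π l u v) ≈ f₀ v

    initial : Σ[ f ∈ Fun ] State [] f
    initial = proj₁ g , state (proj₁ (proj₂ g)) [] (proj₂ (proj₂ g))
      where
      g : Σ[ g ∈ Fun ] P A d g × (∀ v → g (π l u v) ≈ f₀ v)
      g = P-lift A (central⇒P (contract A u) {f = f₀} (proj₁ in₀) (internal⇒central (contract A u) {f = f₀} in₀))

    module _ {bs : List (Fin n)} {f : Fun} (st : State bs f) {b : Fin n} {h : 𝕍} (b# : ⟦ A (suc b) ⟧ h # 0#) where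
      open State st

      private
        J = nz A h ∖ suc b
        k = correction A in-P b#
        open Symbol (symbol {A = A} {d} {h} {suc b} b# in-P) using (s; top)

      -- If l h ≈ 0, then the restriction f₀ of f already has small degree along h.
      symbol-on-kernel : ⟦ l ⟧ h ≈ 0# → ∀ v → s (π l u v) ≈ 0#
      symbol-on-kernel z v = top-unique ∣ J ∣ (top (π l u v)) (below⇒top-0 ∣ J ∣
        (≡.subst (λ k → Below k (line f h (π l u v))) ∣nz∣≡ (below-resp (internal ∣ nz (contract A u) h ∣) eq (proj₂ in₀ h v))))
        where
        ∣nz∣≡ : internal ∣ nz (contract A u) h ∣ ≡ ∣ J ∣
        ∣nz∣≡ = ≡.cong internal (≡.trans (≡.cong ∣_∣ (nz-cong-≈ (contract A u) (A ∘ suc) λ i → form-cong (A (suc i)) (π-fixes l u z)))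
          (≡.trans (≡.sym (∣nz∣-zero A z)) (≡.sym (∣nz∖∣ A b#))))
        eq : ∀ t → line f₀ h v t ≈ line f h (π l u v) t
        eq t = trans (sym (lifts _)) (hom-cong (P⇒hom in-P) (≈ᴹ-trans (π-line l u v t h) (+ᴹ-congˡ (*ₗ-congˡ (π-fixes l u z)))))

      -- If l(h) ≠ 0, then l is one of the factors of the extension, because l is not the form b.
      -- Otherwise the symbol already vanishes there.
      correction-on-kernel : ∀ v → k (π l u v) ≈ 0#
      correction-on-kernel v = trans (*-congˡ ([ factor , (λ z → trans (*-congʳ (symbol-on-kernel z v)) (zeroˡ _)) ]′ (zero-or-apart (⟦ l ⟧ h)))) (zeroʳ _)
        where
        factor : ⟦ l ⟧ h # 0# → s (π l u v) * mono A J (π l u v) ≈ 0#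
        factor p = trans (*-congˡ (mono-zero A J (x∈p∧x≢y⇒x∈p-y {p = nz A h} {y = suc b} (#⇒∈nz A p) λ ()) (l-π l e v))) (zeroʳ _)

      corrected : All (λ b′ → ⟦ A (suc b′) ⟧ h ≈ 0#) bs → State bs (λ v → f v - k v)
      corrected zs = state (p-‿- in-P (correction-P A in-P b#)) (erased zs in-erase)
        (λ v → trans (+-congˡ (-‿cong (correction-on-kernel v))) (trans (solve 1 (λ x → x :- :0 := x) refl (f (π l u v))) (lifts v)))
        where
        erased : ∀ {bs} → All (λ b′ → ⟦ A (suc b′) ⟧ h ≈ 0#) bs → All (λ b → P (erase A (suc b)) d f) bs →
          All (λ b → P (erase A (suc b)) d (λ v → f v - k v)) bs
        erased []       []       = []
        erased (z ∷ zs) (p ∷ ps) = p-‿- p (correction-erase A in-P b# z p) ∷ erased zs ps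

    module _ (no-coloop : ∀ h → ∣ nz A h ∣ ≢ 1) where

      -- Deleting `suc b` lowers ρ(h) by one, and without coloops the result is not 0, so the bound
      -- of C₋₁ is exact. Removing any other form that is nonzero at h gives the same number.
      good-erased : ∀ {f b} → P (erase A (suc b)) d f → ∀ b₁ {h} → ⟦ A (suc b) ⟧ h # 0# → ⟦ A b₁ ⟧ h # 0# → Good A b₁ f h
      good-erased {f} {b} pf b₁ {h} b# b₁# v = ≡.subst (λ k → Below k (line f h v)) size (P⇒central pf h v)
        where
        positive : ∀ k → suc k ≢ 1 → central k ≡ k
        positive zero    k≢ = contradiction ≡.refl k≢
        positive (suc k) _  = ≡.refl
        size : central ∣ nz (erase A (suc b)) h ∣ ≡ ∣ nz A h ∖ b₁ ∣
        size = ≡.trans (≡.cong (central ∘ ∣_∣) (nz-erase A (suc b) h))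
          (≡.trans (positive ∣ nz A h ∖ suc b ∣ λ eq → no-coloop h (≡.trans (≡.sym (∣nz∖∣ A b#)) eq))
            (ℕP.suc-injective (≡.trans (∣nz∖∣ A b#) (≡.sym (∣nz∖∣ A b₁#)))))

      module _ (b : Fin n) where

        -- One candidate direction for every set of forms.
        separation : ∀ S → Spanned (keep A (_∈? S)) (A (suc b)) ⊎ Separated (keep A (_∈? S)) (A (suc b))
        separation S = spanned-or-separated (keep A (_∈? S)) (A (suc b))

        GoodAt : Fun → ∀ {S} → Spanned (keep A (_∈? S)) (A (suc b)) ⊎ Separated (keep A (_∈? S)) (A (suc b)) → Set (c ⊔ ℓ₁ ⊔ m)
        GoodAt f (inj₁ _)                        = Unit
        GoodAt f (inj₂ (Level.lift (h , _ , _))) = Good A (suc b) f h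

        -- The last component keeps earlier directions from being spoiled, so that the candidates
        -- can be treated one at a time.
        Improvement : List (Fin n) → Fun → 𝕍 → Set (c ⊔ ℓ₁ ⊔ ℓ₂ ⊔ m ⊔ ℓm)
        Improvement bs f h = Σ[ g ∈ Fun ] State bs g × Good A (suc b) g h ×
          (∀ {h₁} → ⟦ A (suc b) ⟧ h₁ # 0# → Good A (suc b) f h₁ → Good A (suc b) g h₁)

        -- If a form already treated is nonzero at h, then membership in P of its deletion gives the
        -- bound at h. Otherwise all of them vanish at h, which is what keeps the correction in
        -- their spaces P.
        improve : ∀ {bs f} → State bs f → ∀ {h} → ⟦ A (suc b) ⟧ h # 0# → Improvement bs f h
        improve {bs} {f} st {h} b# = by-cases (all-zero? bs (State.in-erase st))
          where
          open State st
          all-zero? : ∀ bs → All (λ b → P (erase A (suc b)) d f) bs →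
            Good A (suc b) f h ⊎ All (λ b′ → ⟦ A (suc b′) ⟧ h ≈ 0#) bs
          all-zero? []        []       = inj₂ []
          all-zero? (b′ ∷ bs) (p ∷ ps) = [ (λ b′# → inj₁ (good-erased p (suc b) b′# b#))
                                         , (λ z → [ inj₁ , (λ zs → inj₂ (z ∷ zs)) ]′ (all-zero? bs ps)) ]′ (zero-or-apart (⟦ A (suc b′) ⟧ h))
          by-cases : Good A (suc b) f h ⊎ All (λ b′ → ⟦ A (suc b′) ⟧ h ≈ 0#) bs → Improvement bs f h
          by-cases (inj₁ good) = f , st , good , λ {h₁} _ good₁ → good₁
          by-cases (inj₂ zs)   = _ , corrected st b# zs , good-corrected A in-P b# , λ {h₁} → good-preserved A in-P b# {h₁}

        separated-# : ∀ {h} → ⟦ A (suc b) ⟧ h ≈ 1# → ⟦ A (suc b) ⟧ h # 0#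
        separated-# e = #-resp (sym e) 1#0

        preserved : ∀ {f g} → (∀ {h₁} → ⟦ A (suc b) ⟧ h₁ # 0# → Good A (suc b) f h₁ → Good A (suc b) g h₁) →
          ∀ {S} (s : Spanned (keep A (_∈? S)) (A (suc b)) ⊎ Separated (keep A (_∈? S)) (A (suc b))) → GoodAt f {S} s → GoodAt g {S} s
        preserved pres (inj₁ _)                        good = tt
        preserved pres (inj₂ (Level.lift (h , _ , e))) good = pres (separated-# e) good

        improve-all : ∀ {bs f} → State bs f → (Ss : List (Subset (suc n))) →
          Σ[ g ∈ Fun ] State bs g × All (λ S → GoodAt g {S} (separation S)) Ss
        improve-all {f = f} st []  = f , st , []
        improve-all {bs} st (S ∷ Ss) = finish (improve-all st Ss)
          where
          finish : Σ[ g ∈ Fun ] State bs g × All (λ S → GoodAt g {S} (separation S)) Ss →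
            Σ[ g ∈ Fun ] State bs g × All (λ S → GoodAt g {S} (separation S)) (S ∷ Ss)
          -- `GoodAt` computes on the outcome of `separation S`, so the case analysis keeps the
          -- equation for a transport.
          finish (g , st′ , goods) = at (separation S) ≡.refl
            where
            at : ∀ s → separation S ≡ s → Σ[ g ∈ Fun ] State bs g × All (λ S → GoodAt g {S} (separation S)) (S ∷ Ss)
            at (inj₁ s) eq = g , st′ , ≡.subst (GoodAt g {S}) (≡.sym eq) tt ∷ goods
            at (inj₂ (Level.lift (h , z , e′))) eq = next (improve st′ (separated-# e′))
              where
              next : Improvement bs g h → Σ[ g ∈ Fun ] State bs g × All (λ S → GoodAt g {S} (separation S)) (S ∷ Ss)
              next (g′ , st″ , good , pres) = g′ , st″ ,
                ≡.subst (GoodAt g′ {S}) (≡.sym eq) good ∷ All.map (λ {S} → preserved pres {S} (separation S)) goods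

        -- The candidates suffice: h agrees up to scaling modulo the common kernel with the
        -- candidate for the forms vanishing at h, or else the symbol at h vanishes.
        all-good : ∀ {f} → P A d f → (∀ S → GoodAt f {S} (separation S)) → ∀ {h} → ⟦ A (suc b) ⟧ h # 0# → Good A (suc b) f h
        all-good {f} pf goods {h} b# = at (separation S) (goods S)
          where
          S = ∁ (nz A h)
          at : ∀ s → GoodAt f {S} s → Good A (suc b) f h
          at (inj₁ s) _ = contradiction (spanned-zero (keep A (_∈? S)) (A (suc b)) s
            (keep-zero A (_∈? S) λ i i∈ → ∉nz⇒≈0 A (x∈∁p⇒x∉p i∈))) (#⇒≉ b#)
          at (inj₂ (Level.lift (h₀ , z , e′))) good = [ nonspecial , special ]′ (any-nonzero? A _ (λ _ → yes tt))
            where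
            b#₀ = separated-# e′
            z₀ : ∀ i → ⟦ A i ⟧ h ≈ 0# → ⟦ A i ⟧ h₀ ≈ 0#
            z₀ i iz = trans (sym (keep-yes A (_∈? S) (x∉p⇒x∈∁p (≈0⇒∉nz A iz)) h₀)) (z i)
            w = h +ᴹ (- (⟦ A (suc b) ⟧ h * b#₀ ⁻¹)) *ₗ h₀
            nonspecial : Σ[ i ∈ Fin (suc n) ] Unit {Level.zero} × ⟦ A i ⟧ w # 0# → Good A (suc b) f h
            nonspecial (i , _ , i#) = good-if-vanishing A pf b# (Symbol.vanish (symbol {A = A} b# pf) w
              (λ y yz → difference-zero A b#₀ y (z₀ y yz) yz) (difference-b A b#₀) (i , i#))
            special : (∀ i → Unit {Level.zero} → ⟦ A i ⟧ w ≈ 0#) → Good A (suc b) f h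
            special z₁ = transfer A b#₀ pf b# (λ i → z₁ i tt) good

        step : ∀ {bs f} → State bs f → Σ[ g ∈ Fun ] State (b ∷ bs) g
        step {bs} st = finish (improve-all st (subsets (suc n)))
          where
          finish : Σ[ g ∈ Fun ] State bs g × All (λ S → GoodAt g {S} (separation S)) (subsets (suc n)) → Σ[ g ∈ Fun ] State (b ∷ bs) g
          finish (g , state pg ps ls , goods) = g , state pg (central⇒P (erase A (suc b)) (P⇒hom pg) central-g ∷ ps) ls
            where
            -- Off b = 0 the corrections supply the bound. On b = 0 deleting b leaves ρ unchanged,
            -- and membership in P A is enough.
            central-g : Central (erase A (suc b)) g
            central-g h v = [ apart , kernel ]′ (zero-or-apart (⟦ A (suc b) ⟧ h))
              where
              apart : ⟦ A (suc b) ⟧ h # 0# → Below (central ∣ nz (erase A (suc b)) h ∣) (line g h v)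
              apart b# = below-≤ (≡.subst (λ S → ∣ nz A h ∖ suc b ∣ ℕ.≤ central ∣ S ∣) (≡.sym (nz-erase A (suc b) h)) (≤central _))
                (all-good pg (λ S → All.lookup goods (∈-subsets S)) b# v)
              kernel : ⟦ A (suc b) ⟧ h ≈ 0# → Below (central ∣ nz (erase A (suc b)) h ∣) (line g h v)
              kernel z = ≡.subst (λ S → Below (central ∣ S ∣) (line g h v)) (≡.sym (nz-erase-zero A (suc b) z)) (P⇒central pg h v)

      steps : ∀ bs → Σ[ f ∈ Fun ] State bs f
      steps []       = initial
      steps (b ∷ bs) = step b (proj₂ (steps bs))

      internal-lift : Σ[ f ∈ Fun ] Internal A d f × (∀ v → f (π l u v) ≈ f₀ v)
      internal-lift = f , (P⇒hom in-P , small) , lifts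
        where
        f = proj₁ (steps (allFin n))
        open State (proj₂ (steps (allFin n)))
        small : ∀ h v → Below (internal ∣ nz A h ∣) (line f h v)
        small h v = [ apart , kernel ]′ (any-nonzero? (A ∘ suc) h (λ _ → yes tt))
          where
          apart : Σ[ b ∈ Fin n ] Unit {Level.zero} × ⟦ A (suc b) ⟧ h # 0# → Below (internal ∣ nz A h ∣) (line f h v)
          apart (b , _ , b#) = ≡.subst (λ k → Below (internal k) (line f h v)) (∣nz∖∣ A b#)
            (good-erased (All.lookup in-erase (∈-allFin b)) (suc b) b# b# v)
          -- If l were nonzero at h, then l would be a coloop. So ρ(h) = 0, where the bounds of C₋₁
          -- and C₋₂ coincide.
          kernel : (∀ b → Unit {Level.zero} → ⟦ A (suc b) ⟧ h ≈ 0#) → Below (internal ∣ nz A h ∣) (line f h v)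
          kernel z = [ (λ p → contradiction (≡.trans (∣nz∣-apart A p) (≡.cong suc (∣nz∣-empty (A ∘ suc) λ i → z i tt))) (no-coloop h))
                     , (λ z₀ → let eq = ≡.trans (∣nz∣-zero A z₀) (∣nz∣-empty (A ∘ suc) λ i → z i tt) in
                         ≡.subst (λ k → Below (internal k) (line f h v)) (≡.sym eq) (≡.subst (λ k → Below (central k) (line f h v)) eq (P⇒central in-P h v)))
                     ]′ (zero-or-apart (⟦ l ⟧ h))

  internal-lift : ∀ {n} (A : Arr (suc n)) {u} → ⟦ A zero ⟧ u ≈ 1# → ∀ a → (∀ v → ⟦ A zero ⟧ v ≈ combination a (A ∘ suc) v) →
    ∀ {d f₀} → Internal (contract A u) d f₀ → Σ[ f ∈ Fun ] Internal A d f × (∀ v → f (π (A zero) u v) ≈ f₀ v)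
  internal-lift A {u} e a ea {d} {f₀} in₀ = decide (coloop? A)
    where
    l = A zero
    decide : Dec (HasColoop A) → Σ[ f ∈ Fun ] Internal A d f × (∀ v → f (π l u v) ≈ f₀ v)
    decide (no none) = Correct.internal-lift A e in₀ λ h eq → none (Level.lift (h , eq))
    -- As l is a combination of the others, it cannot be the only form nonzero at h, so l(h) = 0.
    -- The contraction then has ρ(h) = 1 as well, which forces f₀ = 0.
    decide (yes (Level.lift (h , eq))) = (λ _ → 0#) , (hom-0 d , λ h v → below-0 (internal ∣ nz A h ∣) λ _ → refl) , λ v → sym (f₀≈0 v)
      where
      lh≈0 : ⟦ l ⟧ h ≈ 0#
      lh≈0 = [ (λ p → trans (ea h) (combination-zero a (A ∘ suc) λ i → ∉nz⇒≈0 (A ∘ suc) {i = i} λ i∈ →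
               ℕP.1+n≢0 (≡.trans (x∈p⇒suc∣p-x∣≡∣p∣ i∈) (ℕP.suc-injective (≡.trans (≡.sym (∣nz∣-apart A p)) eq)))))
             , (λ z → z) ]′ (zero-or-apart (⟦ l ⟧ h))
      ∣nz∣≡1 : ∣ nz (contract A u) h ∣ ≡ 1
      ∣nz∣≡1 = ≡.trans (≡.cong ∣_∣ (nz-cong-≈ (contract A u) (A ∘ suc) λ i → form-cong (A (suc i)) (π-fixes l u lh≈0)))
        (≡.trans (≡.sym (∣nz∣-zero A lh≈0)) eq)
      f₀≈0 : ∀ v → f₀ v ≈ 0#
      f₀≈0 v = trans (hom-cong (proj₁ in₀) (≈ᴹ-sym (v+0h≈v v h)))
        (Level.lower (≡.subst (λ k → Below (internal k) (line f₀ h v)) ∣nz∣≡1 (proj₂ in₀ h v)) 0#)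

-- Dimensions and exact sequences

module LinearAlgebra {c ℓ₁ ℓ₂ m ℓm : Level} (K : CharZeroField c ℓ₁ ℓ₂)
                     (M : LeftModule (CharZeroField.ring K) m ℓm) where
  open Field K
  open LeftModule M
  open CommutativeMonoidSum +ᴹ-commutativeMonoid using () renaming (sum to sumᴹ; sum-cong-≋ to sumᴹ-cong; sum-remove to sumᴹ-remove)
  open SetoidReasoning ≈ᴹ-setoid

  lc : ∀ {d} → (Fin d → 𝕂) → (Fin d → Carrierᴹ) → Carrierᴹ
  lc = linearCombination K M

  lc-cong : ∀ {d} {a a′ : Fin d → 𝕂} {b b′ : Fin d → Carrierᴹ} → (∀ j → a j ≈ a′ j) → (∀ j → b j ≈ᴹ b′ j) → lc a b ≈ᴹ lc a′ b′
  lc-cong {d} e e′ = sumᴹ-cong {d} (λ j → *ₗ-cong (e j) (e′ j))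

  interchange : ∀ a b x y → (a +ᴹ b) +ᴹ (x +ᴹ y) ≈ᴹ (a +ᴹ x) +ᴹ (b +ᴹ y)
  interchange a b x y = ≈ᴹ-trans (+ᴹ-assoc a b _) (≈ᴹ-trans (+ᴹ-congˡ (≈ᴹ-trans (≈ᴹ-sym (+ᴹ-assoc b x y))
    (≈ᴹ-trans (+ᴹ-congʳ (+ᴹ-comm b x)) (+ᴹ-assoc x b y)))) (≈ᴹ-sym (+ᴹ-assoc a x _)))

  lc-+ : ∀ {d} (a a′ : Fin d → 𝕂) b → lc (λ j → a j + a′ j) b ≈ᴹ lc a b +ᴹ lc a′ b
  lc-+ {zero}  a a′ b = ≈ᴹ-sym (+ᴹ-identityˡ 0ᴹ)
  lc-+ {suc d} a a′ b = ≈ᴹ-trans (+ᴹ-cong (*ₗ-distribʳ (b zero) (a zero) (a′ zero)) (lc-+ (a ∘ suc) (a′ ∘ suc) (b ∘ suc)))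
    (interchange _ _ _ _)

  lc-* : ∀ {d} x (a : Fin d → 𝕂) b → lc (λ j → x * a j) b ≈ᴹ x *ₗ lc a b
  lc-* {zero}  x a b = ≈ᴹ-sym (*ₗ-zeroʳ x)
  lc-* {suc d} x a b = ≈ᴹ-trans (+ᴹ-cong (*ₗ-assoc x (a zero) (b zero)) (lc-* x (a ∘ suc) (b ∘ suc))) (≈ᴹ-sym (*ₗ-distribˡ x _ _))

  lc-0 : ∀ {d} (a : Fin d → 𝕂) {b : Fin d → Carrierᴹ} → (∀ j → a j ≈ 0#) → lc a b ≈ᴹ 0ᴹ
  lc-0 {zero}  a z = ≈ᴹ-refl
  lc-0 {suc d} a z = ≈ᴹ-trans (+ᴹ-cong (≈ᴹ-trans (*ₗ-congʳ (z zero)) (*ₗ-zeroˡ _)) (lc-0 (a ∘ suc) (z ∘ suc))) (+ᴹ-identityˡ 0ᴹ)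

  record Subspace {p} (P : Pred Carrierᴹ p) : Set (c ⊔ m ⊔ ℓm ⊔ p) where
    field
      has-0    : P 0ᴹ
      has-+    : ∀ {x y} → P x → P y → P (x +ᴹ y)
      has-*    : ∀ a {x} → P x → P (a *ₗ x)

    has-lc : ∀ {d} (a : Fin d → 𝕂) {b} → (∀ j → P (b j)) → P (lc a b)
    has-lc {zero}  a pb = has-0
    has-lc {suc d} a pb = has-+ (has-* (a zero) (pb zero)) (has-lc (a ∘ suc) (pb ∘ suc))

  record Linear (f : Carrierᴹ → Carrierᴹ) : Set (c ⊔ m ⊔ ℓm) where
    field
      f-cong : ∀ {x y} → x ≈ᴹ y → f x ≈ᴹ f y
      f-0    : f 0ᴹ ≈ᴹ 0ᴹ
      f-+    : ∀ x y → f (x +ᴹ y) ≈ᴹ f x +ᴹ f y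
      f-*    : ∀ a x → f (a *ₗ x) ≈ᴹ a *ₗ f x

    f-lc : ∀ {d} (a : Fin d → 𝕂) b → f (lc a b) ≈ᴹ lc a (f ∘ b)
    f-lc {zero}  a b = f-0
    f-lc {suc d} a b = ≈ᴹ-trans (f-+ _ _) (+ᴹ-cong (f-* (a zero) (b zero)) (f-lc (a ∘ suc) (b ∘ suc)))

  Independent : ∀ {d} → (Fin d → Carrierᴹ) → Set (c ⊔ ℓ₁ ⊔ ℓm)
  Independent w = ∀ a → lc a w ≈ᴹ 0ᴹ → ∀ j → a j ≈ 0#

  lc-remove : ∀ {d} p (a : Fin (suc d) → 𝕂) b → lc a b ≈ᴹ a p *ₗ b p +ᴹ lc (removeAt a p) (removeAt b p)
  lc-remove {d} p a b = sumᴹ-remove {d} {p} (λ j → a j *ₗ b j)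

  private
    -- One step of Gaussian elimination: multiples of `w p` clear the first coordinate of the other
    -- vectors, which then lie in the span of one generator fewer.
    module Pivot {d k} (v : Fin (suc k) → Carrierᴹ) (w : Fin (suc d) → Carrierᴹ) (ind : Independent w)
                 (x : Fin (suc d) → Fin (suc k) → 𝕂) (e : ∀ j → w j ≈ᴹ lc (x j) v) (p : Fin (suc d)) (p# : x p zero # 0#) where
      ratio : Fin d → 𝕂
      ratio j = x (punchIn p j) zero * p# ⁻¹

      w′ : Fin d → Carrierᴹ
      w′ j = w (punchIn p j) +ᴹ (- ratio j) *ₗ w p

      y : Fin d → Fin (suc k) → 𝕂
      y j i = x (punchIn p j) i + (- ratio j) * x p i

      w′≈ : ∀ j → w′ j ≈ᴹ lc (y j ∘ suc) (v ∘ suc)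
      w′≈ j = begin
        w (punchIn p j) +ᴹ (- ratio j) *ₗ w p         ≈⟨ +ᴹ-cong (e (punchIn p j)) (*ₗ-congˡ (e p)) ⟩
        lc (x (punchIn p j)) v +ᴹ (- ratio j) *ₗ lc (x p) v  ≈⟨ +ᴹ-congˡ (lc-* (- ratio j) (x p) v) ⟨
        lc (x (punchIn p j)) v +ᴹ lc (λ i → (- ratio j) * x p i) v  ≈⟨ lc-+ (x (punchIn p j)) (λ i → (- ratio j) * x p i) v ⟨
        lc (y j) v                                     ≈⟨ +ᴹ-congʳ (≈ᴹ-trans (*ₗ-congʳ y₀≈0) (*ₗ-zeroˡ _)) ⟩
        0ᴹ +ᴹ lc (y j ∘ suc) (v ∘ suc)                 ≈⟨ +ᴹ-identityˡ _ ⟩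
        lc (y j ∘ suc) (v ∘ suc)                       ∎
        where
        y₀≈0 : y j zero ≈ 0#
        y₀≈0 = trans (+-congʳ (x≈[yx⁻¹]x p# _)) (solve 2 (λ r x → r :* x :+ (:- r) :* x := :0) refl (ratio j) (x p zero))

      lc-w′ : ∀ {d} (a : Fin d → 𝕂) (u : Fin d → Carrierᴹ) (r : Fin d → 𝕂) z →
        lc a (λ j → u j +ᴹ (- r j) *ₗ z) ≈ᴹ (- sum (λ j → a j * r j)) *ₗ z +ᴹ lc a u
      lc-w′ {zero}  a u r z = ≈ᴹ-sym (≈ᴹ-trans (+ᴹ-congʳ (≈ᴹ-trans (*ₗ-congʳ (solve 0 (:- :0 := :0) refl)) (*ₗ-zeroˡ z))) (+ᴹ-identityˡ 0ᴹ))
      lc-w′ {suc d} a u r z = begin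
        a zero *ₗ (u zero +ᴹ (- r zero) *ₗ z) +ᴹ lc (a ∘ suc) _
          ≈⟨ +ᴹ-cong (≈ᴹ-trans (*ₗ-distribˡ _ _ _) (+ᴹ-congˡ (≈ᴹ-sym (*ₗ-assoc _ _ _)))) (lc-w′ (a ∘ suc) (u ∘ suc) (r ∘ suc) z) ⟩
        (a zero *ₗ u zero +ᴹ (a zero * (- r zero)) *ₗ z) +ᴹ ((- s) *ₗ z +ᴹ lc (a ∘ suc) (u ∘ suc))
          ≈⟨ ≈ᴹ-trans (+ᴹ-congʳ (+ᴹ-comm _ _)) (interchange _ _ _ _) ⟩
        ((a zero * (- r zero)) *ₗ z +ᴹ (- s) *ₗ z) +ᴹ (a zero *ₗ u zero +ᴹ lc (a ∘ suc) (u ∘ suc))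
          ≈⟨ +ᴹ-congʳ (≈ᴹ-trans (≈ᴹ-sym (*ₗ-distribʳ z _ _)) (*ₗ-congʳ (solve 3 (λ a r s → a :* (:- r) :+ (:- s) := :- (a :* r :+ s)) refl (a zero) (r zero) s))) ⟩
        (- (a zero * r zero + s)) *ₗ z +ᴹ lc a u ∎
        where s = sum (λ j → a (suc j) * r (suc j))

      ind′ : Independent w′
      ind′ a a≈0 j = trans (reflexive (≡.sym (VectorP.insertAt-punchIn a p _ j))) (ind a⁺ (begin
        lc a⁺ w                                          ≈⟨ lc-remove p a⁺ w ⟩
        a⁺ p *ₗ w p +ᴹ lc (removeAt a⁺ p) (removeAt w p)  ≈⟨ +ᴹ-cong (*ₗ-congʳ (reflexive (VectorP.insertAt-lookup a p _)))
                                                              (lc-cong (λ i → reflexive (VectorP.insertAt-punchIn a p _ i)) (λ _ → ≈ᴹ-refl)) ⟩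
        (- sum (λ j → a j * ratio j)) *ₗ w p +ᴹ lc a (removeAt w p) ≈⟨ lc-w′ a (removeAt w p) ratio (w p) ⟨
        lc a w′                                          ≈⟨ a≈0 ⟩
        0ᴹ                                               ∎) (punchIn p j))
        where
        a⁺ : Fin (suc d) → 𝕂
        -- The entry at p gathers the multiples of `w p` hidden in `w′`.
        a⁺ = insertAt a p (- sum (λ j → a j * ratio j))

  independent-≤ : ∀ k {d} (v : Fin k → Carrierᴹ) (w : Fin d → Carrierᴹ) → Independent w →
    (x : Fin d → Fin k → 𝕂) → (∀ j → w j ≈ᴹ lc (x j) v) → d ℕ.≤ k
  independent-≤ k       {zero}  v w ind x e = ℕ.z≤n
  independent-≤ zero    {suc d} v w ind x e = contradiction
    (ind (1# ∷ᶠ λ _ → 0#) (≈ᴹ-trans (+ᴹ-cong (≈ᴹ-trans (*ₗ-congˡ (e zero)) (*ₗ-zeroʳ 1#)) (lc-0 {d} (λ _ → 0#) (λ _ → refl))) (+ᴹ-identityˡ 0ᴹ)) zero)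
    (#⇒≉ 1#0)
  independent-≤ (suc k) {suc d} v w ind x e = by-pivot (FinP.any? (λ j → x j zero #? 0#))
    where
    by-pivot : Dec (∃ λ j → x j zero # 0#) → suc d ℕ.≤ suc k
    by-pivot (yes (p , p#)) = ℕ.s≤s (independent-≤ k (v ∘ suc) w′ ind′ (λ j → y j ∘ suc) w′≈)
      where open Pivot v w ind x e p p#
    by-pivot (no none) = ℕP.m≤n⇒m≤1+n (independent-≤ k (v ∘ suc) w ind (λ j → x j ∘ suc) λ j →
      ≈ᴹ-trans (e j) (≈ᴹ-trans (+ᴹ-congʳ (≈ᴹ-trans (*ₗ-congʳ ([ (λ p → contradiction (j , p) none) , (λ z → z) ]′ (zero-or-apart (x j zero)))) (*ₗ-zeroˡ _)))
        (+ᴹ-identityˡ _)))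

  dimension-≤ : ∀ {p q} {P : Pred Carrierᴹ p} {Q : Pred Carrierᴹ q} {d d′} →
    (∀ {x} → P x → Q x) → HasDimension K M P d → HasDimension K M Q d′ → d ℕ.≤ d′
  dimension-≤ {d′ = d′} P⊆Q hp hq = independent-≤ d′ q.b p.b p.independent
    (λ j → proj₁ (q.spanning (P⊆Q (p.inside-P j)))) (λ j → proj₂ (q.spanning (P⊆Q (p.inside-P j))))
    where
    module p = HasDimension hp
    module q = HasDimension hq

  dimension-unique : ∀ {p q} {P : Pred Carrierᴹ p} {Q : Pred Carrierᴹ q} {d d′} →
    (∀ {x} → P x → Q x) → (∀ {x} → Q x → P x) → HasDimension K M P d → HasDimension K M Q d′ → d ≡ d′
  dimension-unique P⊆Q Q⊆P hp hq = ℕP.≤-antisym (dimension-≤ P⊆Q hp hq) (dimension-≤ Q⊆P hq hp)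

  dimension-resp : ∀ {p q} {P : Pred Carrierᴹ p} {Q : Pred Carrierᴹ q} {d} →
    (∀ {x} → P x → Q x) → (∀ {x} → Q x → P x) → HasDimension K M P d → HasDimension K M Q d
  dimension-resp P⊆Q Q⊆P hp = record
    { b = b ; inside-P = λ j → P⊆Q (inside-P j) ; independent = independent ; spanning = λ q → spanning (Q⊆P q) }
    where open HasDimension hp

  dimension-zero : ∀ {p} {P : Pred Carrierᴹ p} → (∀ {x} → P x → x ≈ᴹ 0ᴹ) → HasDimension K M P 0
  dimension-zero z = record { b = λ () ; inside-P = λ () ; independent = λ _ _ () ; spanning = λ px → (λ ()) , z px }

  append : ∀ {ℓ} {X : Set ℓ} {k n} → (Fin k → X) → (Fin n → X) → Fin (k ℕ.+ n) → X
  append {k = zero}  xs ys i       = ys i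
  append {k = suc k} xs ys zero    = xs zero
  append {k = suc k} xs ys (suc i) = append (xs ∘ suc) ys i

  append-all : ∀ {ℓ q} {X : Set ℓ} (Q : X → Set q) {k n} {xs : Fin k → X} {ys : Fin n → X} →
    (∀ i → Q (xs i)) → (∀ i → Q (ys i)) → ∀ i → Q (append xs ys i)
  append-all Q {zero}  qx qy i       = qy i
  append-all Q {suc k} qx qy zero    = qx zero
  append-all Q {suc k} qx qy (suc i) = append-all Q (qx ∘ suc) qy i

  lc-append : ∀ {k n} (a : Fin (k ℕ.+ n) → 𝕂) (xs : Fin k → Carrierᴹ) (ys : Fin n → Carrierᴹ) →
    lc a (append xs ys) ≈ᴹ lc (a ∘ (_↑ˡ n)) xs +ᴹ lc (a ∘ (k ↑ʳ_)) ys
  lc-append {zero}  a xs ys = ≈ᴹ-sym (+ᴹ-identityˡ _)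
  lc-append {suc k} a xs ys = ≈ᴹ-trans (+ᴹ-congˡ (lc-append (a ∘ suc) (xs ∘ suc) ys)) (≈ᴹ-sym (+ᴹ-assoc _ _ _))

  append-↑ˡ : ∀ {k n} (x : Fin k → 𝕂) (y : Fin n → 𝕂) i → append x y (i ↑ˡ n) ≡ x i
  append-↑ˡ x y zero    = ≡.refl
  append-↑ˡ x y (suc i) = append-↑ˡ (x ∘ suc) y i

  append-↑ʳ : ∀ {k n} (x : Fin k → 𝕂) (y : Fin n → 𝕂) i → append x y (k ↑ʳ i) ≡ y i
  append-↑ʳ {zero}  x y i = ≡.refl
  append-↑ʳ {suc k} x y i = append-↑ʳ (x ∘ suc) y i

  ↑-all : ∀ {q k n} (Q : Fin (k ℕ.+ n) → Set q) → (∀ i → Q (i ↑ˡ n)) → (∀ i → Q (k ↑ʳ i)) → ∀ i → Q i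
  ↑-all {k = zero}  Q l r i       = r i
  ↑-all {k = suc k} Q l r zero    = l zero
  ↑-all {k = suc k} Q l r (suc i) = ↑-all (Q ∘ suc) (l ∘ suc) r i

  x-y≈ᴹ0⇒x≈ᴹy : ∀ {x y z} → x +ᴹ (- 1#) *ₗ y ≈ᴹ z → x ≈ᴹ z +ᴹ y
  x-y≈ᴹ0⇒x≈ᴹy {x} {y} {z} e = begin
    x                                   ≈⟨ +ᴹ-identityʳ x ⟨
    x +ᴹ 0ᴹ                             ≈⟨ +ᴹ-congˡ (≈ᴹ-trans (*ₗ-congʳ (-‿inverseˡ 1#)) (*ₗ-zeroˡ y)) ⟨
    x +ᴹ (- 1# + 1#) *ₗ y               ≈⟨ +ᴹ-congˡ (≈ᴹ-trans (*ₗ-distribʳ y _ _) (+ᴹ-congˡ (*ₗ-identityˡ y))) ⟩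
    x +ᴹ ((- 1#) *ₗ y +ᴹ y)             ≈⟨ +ᴹ-assoc _ _ _ ⟨
    (x +ᴹ (- 1#) *ₗ y) +ᴹ y             ≈⟨ +ᴹ-congʳ e ⟩
    z +ᴹ y                              ∎

  -- Dimensions in the exact sequence 0 → P₁ → P → P₂ → 0 with maps μ and ρ.
  dimension-exact : ∀ {p₁ p p₂} {P₁ : Pred Carrierᴹ p₁} {P : Pred Carrierᴹ p} {P₂ : Pred Carrierᴹ p₂} {d₁ d₂} {μ ρ : Carrierᴹ → Carrierᴹ} →
    Linear μ → Linear ρ → Subspace P₁ → Subspace P →
    (∀ {x} → P₁ x → P (μ x)) → (∀ {x} → P₁ x → μ x ≈ᴹ 0ᴹ → x ≈ᴹ 0ᴹ) → (∀ {x} → P₁ x → ρ (μ x) ≈ᴹ 0ᴹ) →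
    (∀ {x} → P x → P₂ (ρ x)) → (∀ {x} → P x → ρ x ≈ᴹ 0ᴹ → Σ[ y ∈ Carrierᴹ ] P₁ y × x ≈ᴹ μ y) →
    (∀ {y} → P₂ y → Σ[ x ∈ Carrierᴹ ] P x × ρ x ≈ᴹ y) →
    HasDimension K M P₁ d₁ → HasDimension K M P₂ d₂ → HasDimension K M P (d₁ ℕ.+ d₂)
  dimension-exact {P₁ = P₁} {P} {P₂} {d₁} {d₂} {μ} {ρ} lin-μ lin-ρ sub₁ sub μ-P μ-inj ρμ ρ-P kernel lifting h₁ h₂ = record
    { b           = basis
    ; inside-P    = append-all P (λ i → μ-P (B₁.inside-P i)) (λ i → proj₁ (proj₂ (lifting (B₂.inside-P i))))
    ; independent = independent
    ; spanning    = spanning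
    }
    where
    module B₁ = HasDimension h₁
    module B₂ = HasDimension h₂
    module μ = Linear lin-μ
    module ρ = Linear lin-ρ
    module S₁ = Subspace sub₁
    module S = Subspace sub
    lifted : Fin d₂ → Carrierᴹ
    lifted i = proj₁ (lifting (B₂.inside-P i))
    lifted-P : ∀ i → P (lifted i)
    lifted-P i = proj₁ (proj₂ (lifting (B₂.inside-P i)))
    ρ-lifted : ∀ (a : Fin d₂ → 𝕂) → ρ (lc a lifted) ≈ᴹ lc a B₂.b
    ρ-lifted a = ≈ᴹ-trans (ρ.f-lc a lifted) (lc-cong {d₂} (λ _ → refl) (λ i → proj₂ (proj₂ (lifting (B₂.inside-P i)))))
    basis : Fin (d₁ ℕ.+ d₂) → Carrierᴹ
    basis = append (μ ∘ B₁.b) lifted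
    independent : Independent basis
    independent a e = ↑-all (λ i → a i ≈ 0#) zero₁ zero₂
      where
      a₁ = a ∘ (_↑ˡ d₂)
      a₂ = a ∘ (d₁ ↑ʳ_)
      e′ : μ (lc a₁ B₁.b) +ᴹ lc a₂ lifted ≈ᴹ 0ᴹ
      e′ = ≈ᴹ-trans (+ᴹ-congʳ (μ.f-lc a₁ B₁.b)) (≈ᴹ-trans (≈ᴹ-sym (lc-append a (μ ∘ B₁.b) lifted)) e)
      in₁ : P₁ (lc a₁ B₁.b)
      in₁ = S₁.has-lc a₁ B₁.inside-P
      zero₂ : ∀ i → a₂ i ≈ 0#
      zero₂ = B₂.independent a₂ (begin
        lc a₂ B₂.b                                  ≈⟨ ρ-lifted a₂ ⟨
        ρ (lc a₂ lifted)                            ≈⟨ +ᴹ-identityˡ _ ⟨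
        0ᴹ +ᴹ ρ (lc a₂ lifted)                      ≈⟨ +ᴹ-congʳ (ρμ in₁) ⟨
        ρ (μ (lc a₁ B₁.b)) +ᴹ ρ (lc a₂ lifted)      ≈⟨ ρ.f-+ _ _ ⟨
        ρ (μ (lc a₁ B₁.b) +ᴹ lc a₂ lifted)          ≈⟨ ρ.f-cong e′ ⟩
        ρ 0ᴹ                                        ≈⟨ ρ.f-0 ⟩
        0ᴹ                                          ∎)
      zero₁ : ∀ i → a₁ i ≈ 0#
      zero₁ = B₁.independent a₁ (μ-inj in₁ (≈ᴹ-trans (≈ᴹ-sym (+ᴹ-identityʳ _)) (≈ᴹ-trans (+ᴹ-congˡ (≈ᴹ-sym (lc-0 a₂ zero₂))) e′)))
    spanning : ∀ {x} → P x → ∃ λ a → x ≈ᴹ lc a basis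
    spanning {x} px = append a₁ a₂ , (begin
      x                                    ≈⟨ x-y≈ᴹ0⇒x≈ᴹy (proj₂ (proj₂ k)) ⟩
      μ y +ᴹ lc a₂ lifted                  ≈⟨ +ᴹ-congʳ (≈ᴹ-trans (μ.f-cong (proj₂ (B₁.spanning (proj₁ (proj₂ k))))) (μ.f-lc a₁ B₁.b)) ⟩
      lc a₁ (μ ∘ B₁.b) +ᴹ lc a₂ lifted     ≈⟨ +ᴹ-cong (lc-cong (λ i → reflexive (append-↑ˡ a₁ a₂ i)) (λ _ → ≈ᴹ-refl))
                                               (lc-cong (λ i → reflexive (append-↑ʳ a₁ a₂ i)) (λ _ → ≈ᴹ-refl)) ⟨
      lc (append a₁ a₂ ∘ (_↑ˡ d₂)) (μ ∘ B₁.b) +ᴹ lc (append a₁ a₂ ∘ (d₁ ↑ʳ_)) lifted ≈⟨ lc-append (append a₁ a₂) (μ ∘ B₁.b) lifted ⟨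
      lc (append a₁ a₂) basis              ∎)
      where
      a₂ = proj₁ (B₂.spanning (ρ-P px))
      -- Subtracting a lift of ρ x from x leaves an element of the kernel of ρ, hence an image under
      -- μ.
      k : Σ[ y ∈ Carrierᴹ ] P₁ y × x +ᴹ (- 1#) *ₗ lc a₂ lifted ≈ᴹ μ y
      k = kernel (S.has-+ px (S.has-* (- 1#) (S.has-lc a₂ lifted-P))) (begin
        ρ (x +ᴹ (- 1#) *ₗ lc a₂ lifted)        ≈⟨ ≈ᴹ-trans (ρ.f-+ _ _) (+ᴹ-congˡ (ρ.f-* _ _)) ⟩
        ρ x +ᴹ (- 1#) *ₗ ρ (lc a₂ lifted)      ≈⟨ +ᴹ-cong (proj₂ (B₂.spanning (ρ-P px))) (*ₗ-congˡ (ρ-lifted a₂)) ⟩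
        lc a₂ B₂.b +ᴹ (- 1#) *ₗ lc a₂ B₂.b     ≈⟨ +ᴹ-congʳ (*ₗ-identityˡ _) ⟨
        1# *ₗ lc a₂ B₂.b +ᴹ (- 1#) *ₗ lc a₂ B₂.b ≈⟨ *ₗ-distribʳ _ _ _ ⟨
        (1# - 1#) *ₗ lc a₂ B₂.b                ≈⟨ ≈ᴹ-trans (*ₗ-congʳ (-‿inverseʳ 1#)) (*ₗ-zeroˡ _) ⟩
        0ᴹ                                     ∎)
      y = proj₁ k
      a₁ = proj₁ (B₁.spanning (proj₁ (proj₂ k)))

-- Deletion and contraction for the Tutte polynomial

module TutteRecursion where
  open import Data.Integer using (+_; -[1+_])
  open ≡ using (refl; sym; trans; cong; cong₂; module ≡-Reasoning)
  open +-*-Solver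
  open RawRing laurent using (_*_; 0#; 1#) renaming (_+_ to _⊕_; -_ to ⊖_)
  open RawSemiringOps (RawRing.rawSemiring laurent) using (_^_)

  coefficient-++ : ∀ p p′ e → coefficient (p ++ p′) e ≡ coefficient p e ℤ.+ coefficient p′ e
  coefficient-++ []            p′ e = sym (ℤP.+-identityˡ _)
  coefficient-++ ((a , k) ∷ p) p′ e = trans (cong (ℤ._+_ (if does (k ℤ.≟ e) then a else + 0)) (coefficient-++ p p′ e)) (sym (ℤP.+-assoc (if does (k ℤ.≟ e) then a else + 0) _ _))

  -- Multiplication by a Laurent polynomial, on coefficient functions.
  act : Laurent → (ℤ → ℤ) → ℤ → ℤ
  act []            F e = + 0
  act ((a , k) ∷ p) F e = a ℤ.* F (e ℤ.- k) ℤ.+ act p F e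

  act-cong : ∀ p {F G : ℤ → ℤ} → (∀ e → F e ≡ G e) → ∀ e → act p F e ≡ act p G e
  act-cong []            eq e = refl
  act-cong ((a , k) ∷ p) eq e = cong₂ ℤ._+_ (cong (a ℤ.*_) (eq _)) (act-cong p eq e)

  coefficient-monomial : ∀ a k r e → coefficient (List.map (λ (b , j) → a ℤ.* b , k ℤ.+ j) r) e ≡ a ℤ.* coefficient r (e ℤ.- k)
  coefficient-monomial a k []            e = sym (ℤP.*-zeroʳ a)
  coefficient-monomial a k ((b , j) ∷ r) e = trans (cong₂ ℤ._+_ (head (k ℤ.+ j ℤ.≟ e) (j ℤ.≟ e ℤ.- k)) (coefficient-monomial a k r e))
    (sym (ℤP.*-distribˡ-+ a (if does (j ℤ.≟ e ℤ.- k) then b else + 0) (coefficient r (e ℤ.- k))))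
    where
    head : (d : Dec (k ℤ.+ j ≡ e)) (d′ : Dec (j ≡ e ℤ.- k)) →
      (if does d then a ℤ.* b else + 0) ≡ a ℤ.* (if does d′ then b else + 0)
    head (yes _) (yes _) = refl
    head (no _)  (no _)  = sym (ℤP.*-zeroʳ a)
    head (yes p) (no ¬q) = contradiction (trans (solve 2 (λ k j → j := k :+ j :- k) refl k j) (cong (ℤ._- k) p)) ¬q
    head (no ¬p) (yes q) = contradiction (trans (cong (ℤ._+_ k) q) (solve 2 (λ k e → k :+ (e :- k) := e) refl k e)) ¬p

  coefficient-* : ∀ p r e → coefficient (p * r) e ≡ act p (coefficient r) e
  coefficient-* []            r e = refl
  coefficient-* ((a , k) ∷ p) r e = trans (coefficient-++ (List.map _ r) (p * r) e)
    (cong₂ ℤ._+_ (coefficient-monomial a k r e) (coefficient-* p r e))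

  act-++ : ∀ p p′ F e → act (p ++ p′) F e ≡ act p F e ℤ.+ act p′ F e
  act-++ []            p′ F e = sym (ℤP.+-identityˡ _)
  act-++ ((a , k) ∷ p) p′ F e = trans (cong (ℤ._+_ (a ℤ.* F (e ℤ.- k))) (act-++ p p′ F e)) (sym (ℤP.+-assoc (a ℤ.* F (e ℤ.- k)) _ _))

  act-monomial : ∀ a k r F e → act (List.map (λ (b , j) → a ℤ.* b , k ℤ.+ j) r) F e ≡ a ℤ.* act r F (e ℤ.- k)
  act-monomial a k []            F e = sym (ℤP.*-zeroʳ a)
  act-monomial a k ((b , j) ∷ r) F e = trans (cong₂ ℤ._+_
    (trans (ℤP.*-assoc a b _) (cong (λ i → a ℤ.* (b ℤ.* F i)) (solve 3 (λ e k j → e :- (k :+ j) := e :- k :- j) refl e k j)))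
    (act-monomial a k r F e)) (sym (ℤP.*-distribˡ-+ a _ _))

  act-* : ∀ p r F e → act (p * r) F e ≡ act p (act r F) e
  act-* []            r F e = refl
  act-* ((a , k) ∷ p) r F e = trans (act-++ (List.map _ r) (p * r) F e) (cong₂ ℤ._+_ (act-monomial a k r F e) (act-* p r F e))

  -- On coefficient functions, multiplication by q⁻¹ - 1 is the difference operator, and it commutes
  -- with every multiplication.
  act-difference : ∀ p (F : ℤ → ℤ) e → act p (λ i → F (i ℤ.+ + 1) ℤ.- F i) e ≡ act p F (e ℤ.+ + 1) ℤ.- act p F e
  act-difference []            F e = refl
  act-difference ((a , k) ∷ p) F e = trans (cong₂ (λ i x → a ℤ.* (F i ℤ.- F (e ℤ.- k)) ℤ.+ x)
      (solve 2 (λ e k → e :- k :+ con (+ 1) := e :+ con (+ 1) :- k) refl e k) (act-difference p F e))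
    (solve 5 (λ a x y z w → a :* (x :- y) :+ (z :- w) := a :* x :+ z :- (a :* y :+ w)) refl a (F (e ℤ.+ + 1 ℤ.- k)) (F (e ℤ.- k)) (act p F (e ℤ.+ + 1)) (act p F e))

  -- Kept as the unreduced sums that `tutte` produces at x = 0 and y = q⁻¹.
  x-1 y-1 : Laurent
  x-1 = 0# ⊕ ⊖ 1#
  y-1 = q^ (ℤ.- (+ 1)) ⊕ ⊖ 1#

  term : ℕ → ℕ → ℤ → ℤ
  term a b = coefficient (x-1 ^ a * y-1 ^ b)

  term-corank : ∀ a b e → term (suc a) b e ≡ ℤ.- term a b e
  term-corank a b e = begin
    term (suc a) b e                                     ≡⟨ coefficient-* (x-1 ^ suc a) (y-1 ^ b) e ⟩
    act (x-1 * x-1 ^ a) F e                              ≡⟨ act-* x-1 (x-1 ^ a) F e ⟩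
    -[1+ 0 ] ℤ.* act (x-1 ^ a) F (e ℤ.- + 0) ℤ.+ + 0     ≡⟨ cong (λ i → -[1+ 0 ] ℤ.* act (x-1 ^ a) F i ℤ.+ + 0) (ℤP.+-identityʳ e) ⟩
    -[1+ 0 ] ℤ.* act (x-1 ^ a) F e ℤ.+ + 0               ≡⟨ solve 1 (λ x → con -[1+ 0 ] :* x :+ con (+ 0) := :- x) refl (act (x-1 ^ a) F e) ⟩
    ℤ.- act (x-1 ^ a) F e                                ≡⟨ cong ℤ.-_ (coefficient-* (x-1 ^ a) (y-1 ^ b) e) ⟨
    ℤ.- term a b e                                       ∎
    where
    open ≡-Reasoning
    F = coefficient (y-1 ^ b)

  term-nullity : ∀ a b e → term a (suc b) e ≡ term a b (e ℤ.+ + 1) ℤ.- term a b e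
  term-nullity a b e = begin
    term a (suc b) e                               ≡⟨ coefficient-* (x-1 ^ a) (y-1 ^ suc b) e ⟩
    act (x-1 ^ a) (coefficient (y-1 * y-1 ^ b)) e  ≡⟨ act-cong (x-1 ^ a) eq e ⟩
    act (x-1 ^ a) (λ i → F (i ℤ.+ + 1) ℤ.- F i) e  ≡⟨ act-difference (x-1 ^ a) F e ⟩
    act (x-1 ^ a) F (e ℤ.+ + 1) ℤ.- act (x-1 ^ a) F e ≡⟨ cong₂ ℤ._-_ (coefficient-* (x-1 ^ a) (y-1 ^ b) (e ℤ.+ + 1)) (coefficient-* (x-1 ^ a) (y-1 ^ b) e) ⟨
    term a b (e ℤ.+ + 1) ℤ.- term a b e            ∎
    where
    open ≡-Reasoning
    F = coefficient (y-1 ^ b)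
    eq : ∀ i → coefficient (y-1 * y-1 ^ b) i ≡ F (i ℤ.+ + 1) ℤ.- F i
    eq i = trans (coefficient-* y-1 (y-1 ^ b) i) (trans (cong (λ j → + 1 ℤ.* F (i ℤ.+ + 1) ℤ.+ (-[1+ 0 ] ℤ.* F j ℤ.+ + 0)) (ℤP.+-identityʳ i))
      (solve 2 (λ x y → con (+ 1) :* x :+ (con -[1+ 0 ] :* y :+ con (+ 0)) := x :- y) refl (F (i ℤ.+ + 1)) (F i)))

  sumOver : ∀ {n} → List (Subset n) → (Subset n → ℤ) → ℤ
  sumOver []       G = + 0
  sumOver (S ∷ Ss) G = G S ℤ.+ sumOver Ss G

  sumOver-cong : ∀ {n} (Ss : List (Subset n)) {G H : Subset n → ℤ} → (∀ S → G S ≡ H S) → sumOver Ss G ≡ sumOver Ss H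
  sumOver-cong []       eq = refl
  sumOver-cong (S ∷ Ss) eq = cong₂ ℤ._+_ (eq S) (sumOver-cong Ss eq)

  sumOver-+ : ∀ {n} (Ss : List (Subset n)) G H → sumOver Ss G ℤ.+ sumOver Ss H ≡ sumOver Ss (λ S → G S ℤ.+ H S)
  sumOver-+ []       G H = refl
  sumOver-+ (S ∷ Ss) G H = trans (solve 4 (λ a b c d → (a :+ b) :+ (c :+ d) := (a :+ c) :+ (b :+ d)) refl (G S) (sumOver Ss G) (H S) (sumOver Ss H))
    (cong (ℤ._+_ (G S ℤ.+ H S)) (sumOver-+ Ss G H))

  sumOver-0 : ∀ {n} (Ss : List (Subset n)) → sumOver Ss (λ _ → + 0) ≡ + 0
  sumOver-0 []       = refl
  sumOver-0 (_ ∷ Ss) = trans (ℤP.+-identityˡ _) (sumOver-0 Ss)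

  sumOver-++ : ∀ {n} (Ss Ts : List (Subset n)) G → sumOver (Ss ++ Ts) G ≡ sumOver Ss G ℤ.+ sumOver Ts G
  sumOver-++ []       Ts G = sym (ℤP.+-identityˡ _)
  sumOver-++ (S ∷ Ss) Ts G = trans (cong (ℤ._+_ (G S)) (sumOver-++ Ss Ts G)) (sym (ℤP.+-assoc (G S) _ _))

  sumOver-map : ∀ {n} s (Ss : List (Subset n)) G → sumOver (List.map (s ∷_) Ss) G ≡ sumOver Ss (λ S → G (s ∷ S))
  sumOver-map s []       G = refl
  sumOver-map s (S ∷ Ss) G = cong (ℤ._+_ (G (s ∷ S))) (sumOver-map s Ss G)

  sumOver-subsets : ∀ {n} (G : Subset (suc n) → ℤ) →
    sumOver (subsets (suc n)) G ≡ sumOver (subsets n) (λ S → G (inside ∷ S)) ℤ.+ sumOver (subsets n) (λ S → G (outside ∷ S))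
  sumOver-subsets {n} G = trans (sumOver-++ (List.map (inside ∷_) (subsets n)) _ G)
    (cong₂ ℤ._+_ (sumOver-map inside (subsets n) G) (sumOver-map outside (subsets n) G))

  -- The coefficients of qⁿ⁻ʳ T(0, q⁻¹).
  hilbert : ∀ {n} → (Subset n → ℕ) → ℤ → ℤ
  hilbert {n} rank e = sumOver (subsets n) λ S → term (rank ⊤ ∸ rank S) (∣ S ∣ ∸ rank S) (e ℤ.- (+ n ℤ.- + rank ⊤))

  coefficient-tutte : ∀ {n} (rank : Subset n → ℕ) e →
    coefficient (q^ (+ n ℤ.- + rank ⊤) * tutte laurent rank 0# (q^ (ℤ.- (+ 1)))) e ≡ hilbert rank e
  coefficient-tutte {n} rank e = trans (coefficient-* (q^ (+ n ℤ.- + rank ⊤)) (tutte laurent rank 0# (q^ (ℤ.- (+ 1)))) e)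
    (trans (ℤP.+-identityʳ _) (trans (ℤP.*-identityˡ _) (sums (subsets n) (e ℤ.- (+ n ℤ.- + rank ⊤)))))
    where
    t : Subset n → Laurent
    t S = x-1 ^ (rank ⊤ ∸ rank S) * y-1 ^ (∣ S ∣ ∸ rank S)
    sums : ∀ Ss i → coefficient (List.foldr _⊕_ 0# (List.map t Ss)) i ≡ sumOver Ss (λ S → coefficient (t S) i)
    sums []       i = refl
    sums (S ∷ Ss) i = trans (coefficient-++ (t S) _ i) (cong (ℤ._+_ (coefficient (t S) i)) (sums Ss i))

  module _ {n} (rank : Subset (suc n) → ℕ) where
    private
      split : ∀ e → hilbert rank e ≡
        sumOver (subsets n) (λ S → term (rank ⊤ ∸ rank (inside ∷ S)) (suc ∣ S ∣ ∸ rank (inside ∷ S)) (e ℤ.- (+ suc n ℤ.- + rank ⊤))) ℤ.+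
        sumOver (subsets n) (λ S → term (rank ⊤ ∸ rank (outside ∷ S)) (∣ S ∣ ∸ rank (outside ∷ S)) (e ℤ.- (+ suc n ℤ.- + rank ⊤)))
      split e = sumOver-subsets {n} λ S → term (rank ⊤ ∸ rank S) (∣ S ∣ ∸ rank S) (e ℤ.- (+ suc n ℤ.- + rank ⊤))

    -- A loop raises the nullity by one: the factors q⁻¹ - 1 with it and 1 without it add up to q⁻¹,
    -- which the larger exponent n - r absorbs.
    hilbert-loop : (∀ S → rank (inside ∷ S) ≡ rank (outside ∷ S)) → (∀ S → rank (outside ∷ S) ℕ.≤ ∣ S ∣) →
      ∀ e → hilbert rank e ≡ hilbert (λ S → rank (outside ∷ S)) e
    hilbert-loop loop bound e = trans (split e) (trans (sumOver-+ (subsets n) _ _) (sumOver-cong (subsets n) eq))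
      where
      r = rank (outside ∷ ⊤)
      eq : ∀ S → term (rank ⊤ ∸ rank (inside ∷ S)) (suc ∣ S ∣ ∸ rank (inside ∷ S)) (e ℤ.- (+ suc n ℤ.- + rank ⊤)) ℤ.+
                 term (rank ⊤ ∸ rank (outside ∷ S)) (∣ S ∣ ∸ rank (outside ∷ S)) (e ℤ.- (+ suc n ℤ.- + rank ⊤)) ≡
                 term (r ∸ rank (outside ∷ S)) (∣ S ∣ ∸ rank (outside ∷ S)) (e ℤ.- (+ n ℤ.- + r))
      eq S rewrite loop S | loop ⊤ | ℕP.+-∸-assoc 1 (bound S) = trans
        (cong (ℤ._+ term a b i) (term-nullity a b i))
        (trans (solve 2 (λ x y → x :- y :+ y := x) refl (term a b (i ℤ.+ + 1)) (term a b i))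
          (cong (term a b) (solve 3 (λ e n r → e :- (con (+ 1) :+ n :- r) :+ con (+ 1) := e :- (n :- r)) refl e (+ n) (+ r))))
        where
        a = r ∸ rank (outside ∷ S)
        b = ∣ S ∣ ∸ rank (outside ∷ S)
        i = e ℤ.- (+ suc n ℤ.- + r)

    -- Adding a coloop to S lowers the corank by one and keeps the nullity, so with x - 1 = -1 the
    -- terms cancel in pairs.
    hilbert-coloop : (∀ S → rank (inside ∷ S) ≡ suc (rank (outside ∷ S))) → (∀ S → rank (outside ∷ S) ℕ.≤ rank (outside ∷ ⊤)) →
      ∀ e → hilbert rank e ≡ + 0
    hilbert-coloop coloop bound e = trans (split e) (trans (sumOver-+ (subsets n) _ _) (trans (sumOver-cong (subsets n) eq) (sumOver-0 (subsets n))))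
      where
      r = rank (outside ∷ ⊤)
      eq : ∀ S → term (rank ⊤ ∸ rank (inside ∷ S)) (suc ∣ S ∣ ∸ rank (inside ∷ S)) (e ℤ.- (+ suc n ℤ.- + rank ⊤)) ℤ.+
                 term (rank ⊤ ∸ rank (outside ∷ S)) (∣ S ∣ ∸ rank (outside ∷ S)) (e ℤ.- (+ suc n ℤ.- + rank ⊤)) ≡ + 0
      eq S rewrite coloop S | coloop ⊤ | ℕP.+-∸-assoc 1 (bound S) = trans
        (cong (ℤ._+_ (term a b i)) (term-corank a b i)) (ℤP.+-inverseʳ (term a b i))
        where
        a = r ∸ rank (outside ∷ S)
        b = ∣ S ∣ ∸ rank (outside ∷ S)
        i = e ℤ.- (+ suc n ℤ.- + suc r)

    -- Contraction lowers both n and r and so keeps n - r, whereas deletion lowers only n; hence the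
    -- shift by one in the deletion term.
    hilbert-generic : (rank/ : Subset n → ℕ) → (∀ S → rank (inside ∷ S) ≡ suc (rank/ S)) → rank (inside ∷ ⊤) ≡ rank (outside ∷ ⊤) →
      ∀ e → hilbert rank e ≡ hilbert (λ S → rank (outside ∷ S)) (e ℤ.- + 1) ℤ.+ hilbert rank/ e
    hilbert-generic rank/ contraction same e = trans (split e) (trans (cong₂ ℤ._+_ (sumOver-cong (subsets n) eq)
      (sumOver-cong (subsets n) λ S → cong₂ (λ r i → term (r ∸ rank (outside ∷ S)) (∣ S ∣ ∸ rank (outside ∷ S)) i) same
        (trans (cong (λ r → e ℤ.- (+ suc n ℤ.- + r)) same)
          (solve 3 (λ e n r → e :- (con (+ 1) :+ n :- r) := e :- con (+ 1) :- (n :- r)) refl e (+ n) (+ rank (outside ∷ ⊤))))))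
      (ℤP.+-comm (hilbert rank/ e) (hilbert (λ S → rank (outside ∷ S)) (e ℤ.- + 1))))
      where
      eq : ∀ S → term (rank ⊤ ∸ rank (inside ∷ S)) (suc ∣ S ∣ ∸ rank (inside ∷ S)) (e ℤ.- (+ suc n ℤ.- + rank ⊤)) ≡
                 term (rank/ ⊤ ∸ rank/ S) (∣ S ∣ ∸ rank/ S) (e ℤ.- (+ n ℤ.- + rank/ ⊤))
      eq S rewrite contraction S | contraction ⊤ = cong (term (rank/ ⊤ ∸ rank/ S) (∣ S ∣ ∸ rank/ S))
        (solve 3 (λ e n r → e :- (con (+ 1) :+ n :- (con (+ 1) :+ r)) := e :- (n :- r)) refl e (+ n) (+ rank/ ⊤))

-- Rank functions of deletions and contractions

module Ranks {c ℓ₁ ℓ₂ m ℓm : Level} (K : CharZeroField c ℓ₁ ℓ₂)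
             (V : Module (CharZeroField.commutativeRing K) m ℓm) (fin : FiniteDimensional K V) where
  open Field K
  open Polynomials K V
  open Arrangements K V
  open Deletion K V fin
  open LinearAlgebra K (functions K V)

  lc-at : ∀ {d} (a : Fin d → 𝕂) (F : Fin d → Fun) v → lc a F v ≈ sum (λ i → a i * F i v)
  lc-at {zero}  a F v = refl
  lc-at {suc d} a F v = +-congˡ (lc-at (a ∘ suc) (F ∘ suc) v)

  HasDim : ∀ {p} (P : Fun → Set p) → ℕ → Set (c ⊔ ℓ₁ ⊔ m ⊔ p)
  HasDim = HasDimension K (functions K V)

  span : ∀ {n} {A : Arr n} {S f} (a : Fin n → 𝕂) → (∀ {i} → i ∉ S → a i ≈ 0#) → (∀ v → f v ≈ combination a A v) → Span K V A S f
  span {A = A} a z e = a , z , λ v → trans (e v) (sym (lc-at a (λ i → ⟦ A i ⟧) v))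

  span-at : ∀ {n} {A : Arr n} {S f} (s : Span K V A S f) → ∀ v → f v ≈ combination (proj₁ s) A v
  span-at {A = A} (a , _ , e) v = trans (e v) (lc-at a (λ i → ⟦ A i ⟧) v)

  module _ {n} (A : Arr (suc n)) (S : Subset n) where

    span-outside⁻ : ∀ {f} → Span K V A (outside ∷ S) f → Span K V (A ∘ suc) S f
    span-outside⁻ s@(a , z , _) = span {A = A ∘ suc} {S} (a ∘ suc) (λ i∉S → z λ { (there i∈S) → i∉S i∈S })
      λ v → trans (span-at {A = A} {outside ∷ S} s v) (trans (+-congʳ (trans (*-congʳ (z λ ())) (zeroˡ _))) (+-identityˡ _))

    span-outside⁺ : ∀ {f} → Span K V (A ∘ suc) S f → Span K V A (outside ∷ S) f
    span-outside⁺ s@(a , z , _) = span {A = A} {outside ∷ S} (0# ∷ᶠ a) (λ { {zero} _ → refl ; {suc i} i∉ → z (i∉ ∘ there) })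
      λ v → trans (span-at {A = A ∘ suc} {S} s v) (sym (trans (+-congʳ (zeroˡ _)) (+-identityˡ _)))

    span-loop⁻ : (∀ v → ⟦ A zero ⟧ v ≈ 0#) → ∀ {f} → Span K V A (inside ∷ S) f → Span K V (A ∘ suc) S f
    span-loop⁻ vanish s@(a , z , _) = span {A = A ∘ suc} {S} (a ∘ suc) (λ i∉S → z λ { (there i∈S) → i∉S i∈S })
      λ v → trans (span-at {A = A} {inside ∷ S} s v) (trans (+-congʳ (trans (*-congˡ (vanish v)) (zeroʳ _))) (+-identityˡ _))

    span-loop⁺ : ∀ {f} → Span K V (A ∘ suc) S f → Span K V A (inside ∷ S) f
    span-loop⁺ s@(a , z , _) = span {A = A} {inside ∷ S} (0# ∷ᶠ a) (λ { {zero} _ → refl ; {suc i} i∉ → z (i∉ ∘ there) })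
      λ v → trans (span-at {A = A ∘ suc} {S} s v) (sym (trans (+-congʳ (zeroˡ _)) (+-identityˡ _)))

  span-⊤ : ∀ {n} (A : Arr n) S {f} → Span K V A S f → Span K V A ⊤ f
  span-⊤ A S s = span {A = A} {⊤} (proj₁ s) (λ i∉ → contradiction ∈⊤ i∉) (span-at {A = A} {S} s)

  span-respects : ∀ {n} (A B : Arr n) S → (∀ i v → ⟦ A i ⟧ v ≈ ⟦ B i ⟧ v) → ∀ {f} → Span K V A S f → Span K V B S f
  span-respects {n} A B S e s@(a , z , _) = span {A = B} {S} a z
    λ v → trans (span-at {A = A} {S} s v) (sum-cong-≋ {n} λ i → *-congˡ (e i v))

  combination-+ : ∀ {n} a b (A : Arr n) v → combination (λ i → a i + b i) A v ≈ combination a A v + combination b A v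
  combination-+ {n} a b A v = trans (sum-cong-≋ {n} λ i → distribʳ _ (a i) (b i)) (∑-distrib-+ {n} (λ i → a i * ⟦ A i ⟧ v) (λ i → b i * ⟦ A i ⟧ v))

  combination-* : ∀ {n} x b (A : Arr n) v → combination (λ i → x * b i) A v ≈ x * combination b A v
  combination-* {n} x b A v = trans (sum-cong-≋ {n} λ i → *-assoc x (b i) _) (sym (*-distribˡ-sum {n} x (λ i → b i * ⟦ A i ⟧ v)))

  span-spanned : ∀ {n} (A : Arr (suc n)) a → (∀ v → ⟦ A zero ⟧ v ≈ combination a (A ∘ suc) v) →
    ∀ {f} → Span K V A (inside ∷ ⊤) f → Span K V A (outside ∷ ⊤) f
  span-spanned A a ea s@(x , _ , _) = span-outside⁺ A ⊤ (span {A = A ∘ suc} {⊤} (λ i → x zero * a i + x (suc i)) (λ i∉ → contradiction ∈⊤ i∉)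
    λ v → trans (span-at {A = A} {inside ∷ ⊤} s v) (sym (trans (combination-+ _ (x ∘ suc) (A ∘ suc) v)
      (+-congʳ (trans (combination-* (x zero) a (A ∘ suc) v) (*-congˡ (sym (ea v))))))))

  combination-kernel : ∀ {n} (l : Form) u a (B : Arr n) v →
    combination a (λ i → formOnKernel l u (B i)) v ≈ (- combination a B u) * ⟦ l ⟧ v + combination a B v
  combination-kernel {zero}  l u a B v = solve 1 (λ x → :0 := (:- :0) :* x :+ :0) refl (⟦ l ⟧ v)
  combination-kernel {suc n} l u a B v = trans (+-cong (*-congˡ (form-π l u (B zero) v)) (combination-kernel l u (a ∘ suc) (B ∘ suc) v))
    (solve 6 (λ a b l c x y → a :* (b :+ (:- l) :* c) :+ ((:- x) :* l :+ y) := (:- (a :* c :+ x)) :* l :+ (a :* b :+ y)) refl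
      (a zero) (⟦ B zero ⟧ v) (⟦ l ⟧ v) (⟦ B zero ⟧ u) (combination (a ∘ suc) (B ∘ suc) u) (combination (a ∘ suc) (B ∘ suc) v))

  module _ {n} (A : Arr (suc n)) {u : 𝕍} (e : ⟦ A zero ⟧ u ≈ 1#) (S : Subset n) where

    contract-at-u : ∀ {f} → Span K V (contract A u) S f → f u ≈ 0#
    contract-at-u s@(a , _ , _) = trans (span-at {A = contract A u} {S} s u) (combination-zero a (contract A u) λ i →
      trans (form-π (A zero) u (A (suc i)) u) (trans (+-congˡ (*-congʳ (-‿cong e)))
        (solve 1 (λ x → x :+ (:- :1) :* x := :0) refl (⟦ A (suc i) ⟧ u))))

    span-contract⁺ : ∀ {f} → Span K V (contract A u) S f → Span K V A (inside ∷ S) f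
    span-contract⁺ s@(a , z , _) = span {A = A} {inside ∷ S} ((- combination a (A ∘ suc) u) ∷ᶠ a)
      (λ { {zero} 0∉ → contradiction here 0∉ ; {suc i} i∉ → z (i∉ ∘ there) })
      λ v → trans (span-at {A = contract A u} {S} s v) (combination-kernel (A zero) u a (A ∘ suc) v)

    span-contract⁻ : ∀ {f} → Span K V A (inside ∷ S) f →
      Σ[ x ∈ 𝕂 ] Σ[ g ∈ Fun ] Span K V (contract A u) S g × (∀ v → f v ≈ x * ⟦ A zero ⟧ v + g v)
    span-contract⁻ s@(a , z , _) = a zero + combination (a ∘ suc) (A ∘ suc) u , combination (a ∘ suc) (contract A u) ,
      span {A = contract A u} {S} (a ∘ suc) (λ i∉S → z λ { (there i∈S) → i∉S i∈S }) (λ _ → refl) ,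
      λ v → trans (span-at {A = A} {inside ∷ S} s v) (sym (trans (+-congˡ (combination-kernel (A zero) u (a ∘ suc) (A ∘ suc) v))
        (solve 4 (λ a c l y → (a :+ c) :* l :+ ((:- c) :* l :+ y) := a :* l :+ y) refl
          (a zero) (combination (a ∘ suc) (A ∘ suc) u) (⟦ A zero ⟧ v) (combination (a ∘ suc) (A ∘ suc) v))))

    -- Evaluation at u splits off l: it is 1 on l and 0 on the span of the contracted forms.
    dimension-inside : ∀ {d} → HasDim (Span K V (contract A u) S) d → HasDim (Span K V A (inside ∷ S)) (suc d)
    dimension-inside {d} hd = record
      { b           = ⟦ A zero ⟧ ∷ᶠ b
      ; inside-P    = λ { zero → span {A = A} {inside ∷ S} (1# ∷ᶠ λ _ → 0#) (λ { {zero} 0∉ → contradiction here 0∉ ; {suc i} _ → refl })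
                          (λ v → sym (trans (+-cong (*-identityˡ _) (trans (sum-cong-≋ {n} λ i → zeroˡ _) (sum-replicate-zero n))) (+-identityʳ _)))
                        ; (suc j) → span-contract⁺ (inside-P j) }
      ; independent = independent⁺
      ; spanning    = spanning⁺
      }
      where
      open HasDimension hd
      independent⁺ : Independent (⟦ A zero ⟧ ∷ᶠ b)
      independent⁺ a e′ = λ { zero → a₀≈0 ; (suc j) → independent (a ∘ suc) rest j }
        where
        at-u : lc (a ∘ suc) b u ≈ 0#
        at-u = trans (lc-at (a ∘ suc) b u) (trans (sum-cong-≋ {d} λ j → trans (*-congˡ (contract-at-u (inside-P j))) (zeroʳ _)) (sum-replicate-zero d))
        a₀≈0 : a zero ≈ 0#
        a₀≈0 = trans (sym (trans (+-cong (trans (*-congˡ e) (*-identityʳ _)) at-u) (+-identityʳ _))) (e′ u)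
        rest : ∀ v → lc (a ∘ suc) b v ≈ 0#
        rest v = trans (sym (trans (+-congʳ (trans (*-congʳ a₀≈0) (zeroˡ _))) (+-identityˡ _))) (e′ v)
      spanning⁺ : ∀ {f} → Span K V A (inside ∷ S) f → ∃ λ a → ∀ v → f v ≈ lc a (⟦ A zero ⟧ ∷ᶠ b) v
      spanning⁺ s = (proj₁ s′ ∷ᶠ proj₁ s″) , λ v → trans (proj₂ (proj₂ (proj₂ s′)) v) (+-congˡ (proj₂ s″ v))
        where
        s′ = span-contract⁻ s
        s″ = spanning (proj₁ (proj₂ (proj₂ s′)))

  -- A nonzero form in S contributes one and is contracted, while loops and forms outside S are
  -- dropped; the bound by ∣ S ∣ comes with the same recursion.
  span-dimension : ∀ {n} (A : Arr n) (S : Subset n) → Σ[ d ∈ ℕ ] d ℕ.≤ ∣ S ∣ × HasDim (Span K V A S) d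
  span-dimension {zero}  A [] = 0 , ℕ.z≤n , dimension-zero λ s v → proj₂ (proj₂ s) v
  span-dimension {suc n} A (outside ∷ S) = d , d≤ , dimension-resp (span-outside⁺ A S) (span-outside⁻ A S) hd
    where
    r = span-dimension (A ∘ suc) S
    d = proj₁ r
    d≤ = proj₁ (proj₂ r)
    hd = proj₂ (proj₂ r)
  span-dimension {suc n} A (inside ∷ S) = by-kind (zero-or-one (A zero))
    where
    by-kind : (∀ v → ⟦ A zero ⟧ v ≈ 0#) ⊎ (Σ[ u ∈ 𝕍 ] ⟦ A zero ⟧ u ≈ 1#) → Σ[ d ∈ ℕ ] d ℕ.≤ suc ∣ S ∣ × HasDim (Span K V A (inside ∷ S)) d
    by-kind (inj₁ z)       = proj₁ r , ℕP.m≤n⇒m≤1+n (proj₁ (proj₂ r)) , dimension-resp (span-loop⁺ A S) (span-loop⁻ A S z) (proj₂ (proj₂ r))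
      where r = span-dimension (A ∘ suc) S
    by-kind (inj₂ (u , e)) = suc (proj₁ r) , ℕ.s≤s (proj₁ (proj₂ r)) , dimension-inside A e S (proj₂ (proj₂ r))
      where r = span-dimension (contract A u) S

  rankFunction : ∀ {n} (A : Arr n) → RankFunction K V A
  rankFunction A = record { rank = λ S → proj₁ (span-dimension A S) ; isRank = λ S → proj₂ (proj₂ (span-dimension A S)) }

  module _ {n} {A : Arr n} (rk : RankFunction K V A) where
    open RankFunction rk

    rank≤∣S∣ : ∀ S → rank S ℕ.≤ ∣ S ∣
    rank≤∣S∣ S = ℕP.≤-trans (dimension-≤ (λ s → s) (isRank S) (proj₂ (proj₂ (span-dimension A S)))) (proj₁ (proj₂ (span-dimension A S)))

    rank≤rank⊤ : ∀ S → rank S ℕ.≤ rank ⊤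
    rank≤rank⊤ S = dimension-≤ (span-⊤ A S) (isRank S) (isRank ⊤)

  module _ {n} {A : Arr (suc n)} (rk : RankFunction K V A) where
    open RankFunction rk

    deletionRank : RankFunction K V (A ∘ suc)
    deletionRank = record { rank = λ S → rank (outside ∷ S) ; isRank = λ S → dimension-resp (span-outside⁻ A S) (span-outside⁺ A S) (isRank (outside ∷ S)) }

    rank-loop : (∀ v → ⟦ A zero ⟧ v ≈ 0#) → ∀ S → rank (inside ∷ S) ≡ rank (outside ∷ S)
    rank-loop z S = dimension-unique (span-loop⁻ A S z) (span-loop⁺ A S) (isRank (inside ∷ S)) (RankFunction.isRank deletionRank S)

    rank-contract : ∀ {u} → ⟦ A zero ⟧ u ≈ 1# → (rk/ : RankFunction K V (contract A u)) →
      ∀ S → rank (inside ∷ S) ≡ suc (RankFunction.rank rk/ S)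
    rank-contract e rk/ S = dimension-unique (λ s → s) (λ s → s) (isRank (inside ∷ S)) (dimension-inside A e S (RankFunction.isRank rk/ S))

    -- Contracting a coloop along a direction where the other forms vanish does not change them, so
    -- contraction and deletion agree.
    rank-coloop : ∀ {h} → ⟦ A zero ⟧ h ≈ 1# → (∀ i → ⟦ A (suc i) ⟧ h ≈ 0#) → ∀ S → rank (inside ∷ S) ≡ suc (rank (outside ∷ S))
    rank-coloop {h} e z = rank-contract e record
      { rank   = λ S → rank (outside ∷ S)
      ; isRank = λ S → dimension-resp (span-respects (A ∘ suc) (contract A h) S λ i v → sym (same i v))
                   (span-respects (contract A h) (A ∘ suc) S same) (RankFunction.isRank deletionRank S)
      }
      where
      same : ∀ i v → ⟦ contract A h i ⟧ v ≈ ⟦ A (suc i) ⟧ v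
      same i v = trans (form-π (A zero) h (A (suc i)) v) (trans (+-congˡ (trans (*-congˡ (z i)) (zeroʳ _))) (+-identityʳ _))

    rank-generic : ∀ a → (∀ v → ⟦ A zero ⟧ v ≈ combination a (A ∘ suc) v) → rank (inside ∷ ⊤) ≡ rank (outside ∷ ⊤)
    rank-generic a ea = dimension-unique (span-spanned A a ea) (span-⊤ A (outside ∷ ⊤))
      (isRank (inside ∷ ⊤)) (isRank (outside ∷ ⊤))

-- Hilbert series of C₋₂

module HilbertSeries {c ℓ₁ ℓ₂ m ℓm : Level} (K : CharZeroField c ℓ₁ ℓ₂)
                     (V : Module (CharZeroField.commutativeRing K) m ℓm) (fin : FiniteDimensional K V) where
  open import Data.Integer using (+_; -[1+_])
  open Field K
  open Univariate K
  open Polynomials K V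
  open Arrangements K V
  open Deletion K V fin
  open Lifting K V fin
  open LinearAlgebra K (functions K V)
  open Ranks K V fin
  open TutteRecursion
  open Subsets using (x∈p⇒suc∣p-x∣≡∣p∣)

  internal-subspace : ∀ {n} (A : Arr n) i → Subspace (Internal A i)
  internal-subspace A i = record
    { has-0 = hom-0 i , λ h v → below-0 (internal ∣ nz A h ∣) λ _ → refl
    ; has-+ = λ (hf , bf) (hg , bg) → add hf hg , λ h v → below-+ (internal ∣ nz A h ∣) (bf h v) (bg h v)
    ; has-* = λ x (hf , bf) → hom-* x hf , λ h v → below-* (internal ∣ nz A h ∣) x (bf h v)
    }

  InternalPred : ∀ {n} → Arr n → ℕ → Fun → Set (c ⊔ ℓ₁ ⊔ m ⊔ ℓm)
  InternalPred A zero    f = Lift (c ⊔ ℓm) (∀ v → f v ≈ 0#)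
  InternalPred A (suc i) f = Internal A i f

  internalPred-subspace : ∀ {n} (A : Arr n) i → Subspace (InternalPred A i)
  internalPred-subspace A zero = record
    { has-0 = Level.lift λ _ → refl
    ; has-+ = λ { (Level.lift z) (Level.lift z′) → Level.lift λ v → trans (+-cong (z v) (z′ v)) (+-identityˡ 0#) }
    ; has-* = λ { x (Level.lift z) → Level.lift λ v → trans (*-congˡ (z v)) (zeroʳ x) }
    }
  internalPred-subspace A (suc i) = internal-subspace A i

  module _ {n} (A : Arr (suc n)) where
    private l = A zero

    times-l : Fun → Fun
    times-l f v = ⟦ l ⟧ v * f v

    restrict-l : 𝕍 → Fun → Fun
    restrict-l u f v = f (π l u v)

    times-linear : Linear times-l
    times-linear = record
      { f-cong = λ e v → *-congˡ (e v)
      ; f-0    = λ v → zeroʳ _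
      ; f-+    = λ f g v → distribˡ _ _ _
      ; f-*    = λ x f v → solve 3 (λ l x y → l :* (x :* y) := x :* (l :* y)) refl (⟦ l ⟧ v) x (f v)
      }

    restrict-linear : ∀ u → Linear (restrict-l u)
    restrict-linear u = record { f-cong = λ e v → e _ ; f-0 = λ v → refl ; f-+ = λ f g v → refl ; f-* = λ x f v → refl }

    internal-loop⁻ : (∀ v → ⟦ l ⟧ v ≈ 0#) → ∀ {i f} → Internal A i f → Internal (A ∘ suc) i f
    internal-loop⁻ z {f = f} (hf , b) = hf , λ h v → ≡.subst (λ k → Below (internal k) (line f h v)) (∣nz∣-zero A (z h)) (b h v)

    internal-loop⁺ : (∀ v → ⟦ l ⟧ v ≈ 0#) → ∀ {i f} → Internal (A ∘ suc) i f → Internal A i f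
    internal-loop⁺ z {f = f} (hf , b) = hf , λ h v → ≡.subst (λ k → Below (internal k) (line f h v)) (≡.sym (∣nz∣-zero A (z h))) (b h v)

    internal-coloop : ∀ {h} → ⟦ l ⟧ h ≈ 1# → (∀ i → ⟦ A (suc i) ⟧ h ≈ 0#) → ∀ {i f} → Internal A i f → ∀ v → f v ≈ 0#
    internal-coloop {h} e z {f = f} (hf , b) v = trans (hom-cong hf (≈ᴹ-sym (v+0h≈v v h)))
      (Level.lower (≡.subst (λ k → Below (internal k) (line f h v))
        (≡.trans (∣nz∣-apart A (#-resp (sym e) 1#0)) (≡.cong suc (∣nz∣-empty (A ∘ suc) z))) (b h v)) 0#)

    module Exact {u : 𝕍} (e : ⟦ l ⟧ u ≈ 1#) (a : Fin n → 𝕂) (ea : ∀ v → ⟦ l ⟧ v ≈ combination a (A ∘ suc) v) where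

      -- As l is not a coloop, ρ(h) ≥ 2 wherever l(h) ≠ 0. There the bound of C₋₂ drops by exactly
      -- one under deletion, without meeting the special value at ρ = 0.
      rest-nonzero : ∀ {h} → ⟦ l ⟧ h # 0# → Σ[ k ∈ ℕ ] ∣ nz (A ∘ suc) h ∣ ≡ suc k
      rest-nonzero {h} p = positive ∣ nz (A ∘ suc) h ∣ ≡.refl
        where
        positive : ∀ k → ∣ nz (A ∘ suc) h ∣ ≡ k → Σ[ k ∈ ℕ ] ∣ nz (A ∘ suc) h ∣ ≡ suc k
        positive (suc k) eq = k , eq
        positive zero    eq = contradiction (trans (ea h) (combination-zero a (A ∘ suc) λ i → ∉nz⇒≈0 (A ∘ suc) {i = i} λ i∈ →
          ℕP.1+n≢0 (≡.trans (x∈p⇒suc∣p-x∣≡∣p∣ i∈) eq))) (#⇒≉ p)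

      ∣nz∣-generic : ∀ {h} (p : ⟦ l ⟧ h # 0#) → ∣ nz A h ∣ ≡ suc (suc (proj₁ (rest-nonzero p)))
      ∣nz∣-generic p = ≡.trans (∣nz∣-apart A p) (≡.cong suc (proj₂ (rest-nonzero p)))

      times-internal : ∀ i {g} → InternalPred (A ∘ suc) i g → Internal A i (times-l g)
      times-internal zero (Level.lift z) = respects (λ v → sym (trans (*-congˡ (z v)) (zeroʳ _))) (constant 0#) ,
        λ h v → below-0 (internal ∣ nz A h ∣) λ t → trans (*-congˡ (z _)) (zeroʳ _)
      times-internal (suc i) {g} (hg , b) = multiply l hg , λ h v → [ apart h v , kernel h v ]′ (zero-or-apart (⟦ l ⟧ h))
        where
        apart : ∀ h v → ⟦ l ⟧ h # 0# → Below (internal ∣ nz A h ∣) (line (times-l g) h v)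
        apart h v p = ≡.subst (λ k → Below (internal k) (line (times-l g) h v)) (≡.sym (∣nz∣-generic p))
          (below-line-* _ l g h v (≡.subst (λ k → Below (internal k) (line g h v)) (proj₂ (rest-nonzero p)) (b h v)))
        kernel : ∀ h v → ⟦ l ⟧ h ≈ 0# → Below (internal ∣ nz A h ∣) (line (times-l g) h v)
        kernel h v z = ≡.subst (λ k → Below (internal k) (line (times-l g) h v)) (≡.sym (∣nz∣-zero A z))
          (below-resp (internal ∣ nz (A ∘ suc) h ∣) (λ t → *-congʳ (sym (trans (form-line l v t h) (trans (+-congˡ (trans (*-congˡ z) (zeroʳ t))) (+-identityʳ _)))))
            (below-* (internal ∣ nz (A ∘ suc) h ∣) (⟦ l ⟧ v) (b h v)))

      times-injective : ∀ i {g} → InternalPred (A ∘ suc) i g → (∀ v → ⟦ l ⟧ v * g v ≈ 0#) → ∀ v → g v ≈ 0#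
      times-injective zero    (Level.lift z) _ v = z v
      times-injective (suc i) {g} (hg , _) z v = trans (hom-cong hg (≈ᴹ-sym (v+0h≈v v 0ᴹ))) (Level.lower
        -- With bound 0 and direction 0, density says that a homogeneous function vanishing off l =
        -- 0 vanishes everywhere.
        (below-dense hg l e 0 {0ᴹ} (λ w p → Level.lift λ t → trans (hom-cong hg (≈ᴹ-trans (+ᴹ-congˡ (*ₗ-zeroʳ t)) (+ᴹ-identityʳ w)))
          (cancel-zero p (z w))) v) 0#)

      kernel-internal : ∀ i {f} → Internal A i f → (∀ v → f (π l u v) ≈ 0#) → Σ[ g ∈ Fun ] InternalPred (A ∘ suc) i g × (∀ v → f v ≈ ⟦ l ⟧ v * g v)
      kernel-internal i {f} (hf , b) z = proj₁ d , pred i (proj₁ (proj₂ d)) , eq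
        where
        d = divideOut l u hf
        g = proj₁ d
        eq : ∀ v → f v ≈ ⟦ l ⟧ v * g v
        eq v = trans (proj₂ (proj₂ d) v) (trans (+-congʳ (z v)) (+-identityˡ _))
        pred : ∀ i → HomogeneousPred i g → InternalPred (A ∘ suc) i g
        pred zero    z′ = z′
        pred (suc j) hg = hg , λ h v → [ apart h v , kernel h v ]′ (zero-or-apart (⟦ l ⟧ h))
          where
          apart : ∀ h v → ⟦ l ⟧ h # 0# → Below (internal ∣ nz (A ∘ suc) h ∣) (line g h v)
          apart h v p = ≡.subst (λ k → Below (internal k) (line g h v)) (≡.sym (proj₂ (rest-nonzero p)))
            (below-quotient-apart l e hg eq p _ v (≡.subst (λ k → Below (internal k) (line f h v)) (∣nz∣-generic p) (b h v)))
          kernel : ∀ h v → ⟦ l ⟧ h ≈ 0# → Below (internal ∣ nz (A ∘ suc) h ∣) (line g h v)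
          kernel h v z′ = below-quotient-zero l e hg eq z′ (internal ∣ nz (A ∘ suc) h ∣)
            (λ v → ≡.subst (λ k → Below (internal k) (line f h v)) (∣nz∣-zero A z′) (b h v)) v

      dimension-generic : ∀ i {d₁ d₂} → HasDim (InternalPred (A ∘ suc) i) d₁ → HasDim (Internal (contract A u) i) d₂ →
        HasDim (Internal A i) (d₁ ℕ.+ d₂)
      dimension-generic i = dimension-exact times-linear (restrict-linear u)
        (internalPred-subspace (A ∘ suc) i) (internal-subspace A i)
        (times-internal i) (times-injective i) (λ {g} _ v → trans (*-congʳ (l-π l e v)) (zeroˡ _))
        (λ {f} (hf , b) → hom-π l u hf , below-restrict {f} (hom-cong hf) A e internal b)
        (kernel-internal i) (internal-lift A e a ea)

  shift : (ℕ → ℕ) → ℕ → ℕ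
  shift h zero    = 0
  shift h (suc i) = h i

  shift-dimension : ∀ {n} (A : Arr n) {h} → (∀ i → HasDim (Internal A i) (h i)) → ∀ i → HasDim (InternalPred A i) (shift h i)
  shift-dimension A hd zero    = dimension-zero λ { (Level.lift z) → z }
  shift-dimension A hd (suc i) = hd i

  series-sum : ∀ h₁ h₂ e → seriesCoefficient (λ i → shift h₁ i ℕ.+ h₂ i) e ≡ seriesCoefficient h₁ (e ℤ.- + 1) ℤ.+ seriesCoefficient h₂ e
  series-sum h₁ h₂ (+ zero)  = ≡.refl
  series-sum h₁ h₂ (+ suc i) = ≡.refl
  series-sum h₁ h₂ -[1+ _ ]  = ≡.refl

  series-zero : ∀ e → seriesCoefficient (λ _ → 0) e ≡ + 0
  series-zero (+ _)    = ≡.refl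
  series-zero -[1+ _ ] = ≡.refl

  constants : ℕ → ℕ
  constants zero    = 1
  constants (suc i) = 0

  -- Every direction has ρ = 0, so invariance leaves only the constants.
  dimension-empty : (A : Arr 0) → ∀ i → HasDim (Internal A i) (constants i)
  dimension-empty A zero = record
    { b           = λ _ _ → 1#
    ; inside-P    = λ _ → constant 1# , λ h v → below-const 1#
    ; independent = λ { a z zero → trans (sym (trans (+-identityʳ _) (*-identityʳ _))) (z 0ᴹ) }
    ; spanning    = λ {f} (hf , b) → (λ _ → f 0ᴹ) , λ v → trans (constant-f hf A b v) (sym (trans (+-identityʳ _) (*-identityʳ _)))
    }
  dimension-empty A (suc i) = dimension-zero λ (hf , b) v → trans (constant-f hf A b v) (hom-at-0 hf)

  series-empty : (rank : Subset 0 → ℕ) → rank [] ≡ 0 → ∀ e → seriesCoefficient constants e ≡ hilbert rank e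
  series-empty rank eq e rewrite eq = ≡.trans (delta e) (≡.cong (λ i → term 0 0 i ℤ.+ + 0) (≡.sym (ℤP.+-identityʳ e)))
    where
    delta : ∀ e → seriesCoefficient constants e ≡ term 0 0 e ℤ.+ + 0
    delta (+ zero)  = ≡.refl
    delta (+ suc _) = ≡.refl
    delta -[1+ _ ]  = ≡.refl

  -- The induction covers arrangements that are not essential, as contractions have u in their
  -- common kernel. The rank function of the deletion is read off the given one; that of the
  -- contraction is constructed.
  internal-hilbert : ∀ {n} (A : Arr n) (rk : RankFunction K V A) → Σ[ h ∈ (ℕ → ℕ) ]
    (∀ i → HasDim (Internal A i) (h i)) × (∀ e → seriesCoefficient h e ≡ hilbert (RankFunction.rank rk) e)
  internal-hilbert {zero}  A rk = constants , dimension-empty A , series-empty (RankFunction.rank rk) (ℕP.n≤0⇒n≡0 (rank≤∣S∣ rk []))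
  internal-hilbert {suc n} A rk = by-kind (kind A)
    where
    open RankFunction rk
    deleted = internal-hilbert (A ∘ suc) (deletionRank rk)
    h₁ = proj₁ deleted
    by-kind : Kind A → Σ[ h ∈ (ℕ → ℕ) ] (∀ i → HasDim (Internal A i) (h i)) × (∀ e → seriesCoefficient h e ≡ hilbert rank e)
    by-kind (loop z) = h₁ ,
      (λ i → dimension-resp (internal-loop⁺ A z) (internal-loop⁻ A z) (proj₁ (proj₂ deleted) i)) ,
      λ e → ≡.trans (proj₂ (proj₂ deleted) e) (≡.sym (hilbert-loop rank (rank-loop rk z) (rank≤∣S∣ (deletionRank rk)) e))
    by-kind (coloop h e z) = (λ _ → 0) , (λ i → dimension-zero (internal-coloop A e z)) ,
      λ x → ≡.trans (series-zero x) (≡.sym (hilbert-coloop rank (rank-coloop rk e z) (rank≤rank⊤ (deletionRank rk)) x))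
    by-kind (generic u e a ea) = (λ i → shift h₁ i ℕ.+ h₂ i) ,
      (λ i → Exact.dimension-generic A e a ea i (shift-dimension (A ∘ suc) (proj₁ (proj₂ deleted)) i) (proj₁ (proj₂ contracted) i)) ,
      λ x → ≡.trans (series-sum h₁ h₂ x) (≡.trans (≡.cong₂ ℤ._+_ (proj₂ (proj₂ deleted) (x ℤ.- + 1)) (proj₂ (proj₂ contracted) x))
        (≡.sym (hilbert-generic rank (RankFunction.rank rk/) (rank-contract rk e rk/) (rank-generic rk a ea) x)))
      where
      rk/ = rankFunction (contract A u)
      contracted = internal-hilbert (contract A u) rk/
      h₂ = proj₁ contracted

  private module KF = CharZeroField K

  private
    pull-t : ∀ {d} (a : Fin d → 𝕂) t → sum (λ j → a j * (t * t KF.^ toℕ j)) ≈ t * sum (λ j → a j * t KF.^ toℕ j)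
    pull-t {d} a t = trans
      (sum-cong-≋ {d} λ j → solve 3 (λ a t p → a :* (t :* p) := t :* (a :* p)) refl (a j) t (t KF.^ toℕ j))
      (sym (*-distribˡ-sum {d} t (λ j → a j * t KF.^ toℕ j)))

  degree⇒below : ∀ d {p} → DegreeAtMost K (+ d) p → Below (suc d) p
  degree⇒below zero    (a , e) = below-resp 1 (λ t → sym (trans (e t) (trans (+-identityʳ _) (*-identityʳ _)))) (below-const (a zero))
  degree⇒below (suc d) (a , e) = a zero , (λ t → sum (λ j → a (suc j) * t KF.^ toℕ j)) ,
    degree⇒below d ((a ∘ suc) , λ t → refl) , λ t → trans (e t) (+-cong (*-identityʳ _) (pull-t (a ∘ suc) t))

  below⇒degree : ∀ d {p} → Below (suc d) p → DegreeAtMost K (+ d) p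
  below⇒degree zero    {p} b = (λ _ → p 0#) , λ t → trans (below-1 b t) (sym (trans (+-identityʳ _) (*-identityʳ _)))
  below⇒degree (suc d) (x , q , b , e) = (x ∷ᶠ proj₁ r) , λ t → trans (e t)
    (+-cong (sym (*-identityʳ x)) (trans (*-congˡ (proj₂ r t)) (sym (pull-t (proj₁ r) t))))
    where r = below⇒degree d b

  degree⇒internal : ∀ k {p} → DegreeAtMost K (+ suc k ℤ.+ ℤ.- (+ 2)) p → Below (internal (suc k)) p
  -- For ρ = 1 the degree bound is -1, which means the zero function.
  degree⇒internal zero    (Level.lift z) = Level.lift z
  degree⇒internal (suc k) d = degree⇒below k d

  internal⇒degree : ∀ k {p} → Below (internal (suc k)) p → DegreeAtMost K (+ suc k ℤ.+ ℤ.- (+ 2)) p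
  internal⇒degree zero    (Level.lift z) = Level.lift z
  internal⇒degree (suc k) b = below⇒degree k b

  ρ≡∣nz∣ : ∀ {n} (A : Arr n) h → ρ K V A h ≡ ∣ nz A h ∣
  ρ≡∣nz∣ {n} A h = go (λ i → i)
    where
    go : ∀ {k} (σ : Fin k → Fin n) → length (filter (λ i → ⟦ A i ⟧ h #? 0#) (tabulate σ)) ≡ ∣ nz (A ∘ σ) h ∣
    go {zero}  σ = ≡.refl
    go {suc k} σ with ⟦ A (σ zero) ⟧ h #? 0#
    ... | yes _ = ≡.cong suc (go (σ ∘ suc))
    ... | no _  = go (σ ∘ suc)

  module _ {f : Fun} where

    concentrated : ∀ k → Fin (suc k) → Fun
    concentrated zero    _       = f
    concentrated (suc k) zero    = λ _ → 0#
    concentrated (suc k) (suc j) = concentrated k j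

    -- The offset `o` counts the zero entries already passed, so that the induction ends with f in
    -- its own degree.
    concentrated-hom : ∀ k {o} → Homogeneous (k ℕ.+ o) f → ∀ j → Homogeneous (toℕ j ℕ.+ o) (concentrated k j)
    concentrated-hom zero    hf zero    = hf
    concentrated-hom (suc k) hf zero    = hom-0 _
    concentrated-hom (suc k) {o} hf (suc j) = ≡.subst (λ i → Homogeneous i (concentrated k j)) (ℕP.+-suc (toℕ j) o)
      (concentrated-hom k (≡.subst (λ i → Homogeneous i f) (≡.sym (ℕP.+-suc k o)) hf) j)

    private module F = CommutativeRing (functionRing K V)

    concentrated-sum : ∀ k v → f v ≈ RawMonoidOps.sum F.+-rawMonoid (concentrated k) v
    concentrated-sum zero    v = sym (+-identityʳ _)
    concentrated-sum (suc k) v = trans (concentrated-sum k v) (sym (+-identityˡ _))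

    hom⇒polynomial : ∀ {i} → Homogeneous i f → IsPolynomial K V f
    hom⇒polynomial {i} hf = suc i , concentrated i ,
      (λ j → ≡.subst (λ d → Homogeneous d (concentrated i j)) (ℕP.+-identityʳ (toℕ j))
        (concentrated-hom i (≡.subst (λ d → Homogeneous d f) (≡.sym (ℕP.+-identityʳ i)) hf) j)) ,
      concentrated-sum i

  module _ {n} (A : Arr n) (essential : Essential K V A) {i : ℕ} {f : Fun} where

    -- For an essential arrangement ρ(h) = 0 forces h = 0, and for all other directions the two
    -- bounds are the same.
    internal⇒Cᵢ : Internal A i f → Cᵢ K V A (ℤ.- (+ 2)) i f
    internal⇒Cᵢ (hf , b) = (hom⇒polynomial hf , λ h h≉0 v →
      ≡.subst (λ k → DegreeAtMost K (+ k ℤ.+ ℤ.- (+ 2)) (line f h v)) (≡.sym (ρ≡∣nz∣ A h)) (small h h≉0 v ∣ nz A h ∣ ≡.refl)) , hf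
      where
      small : ∀ h → ¬ (h ≈ᴹ 0ᴹ) → ∀ v k → ∣ nz A h ∣ ≡ k → DegreeAtMost K (+ k ℤ.+ ℤ.- (+ 2)) (line f h v)
      small h h≉0 v zero    eq = contradiction (essential h λ j → ∉nz⇒≈0 A {i = j} λ j∈ →
        ℕP.1+n≢0 (≡.trans (x∈p⇒suc∣p-x∣≡∣p∣ j∈) eq)) h≉0
      small h h≉0 v (suc k) eq = internal⇒degree k (≡.subst (λ k → Below (internal k) (line f h v)) eq (b h v))

    Cᵢ⇒internal : Cᵢ K V A (ℤ.- (+ 2)) i f → Internal A i f
    Cᵢ⇒internal ((_ , d) , hf) = hf , λ h v → small h v ∣ nz A h ∣ ≡.refl
      where
      small : ∀ h v k → ∣ nz A h ∣ ≡ k → Below (internal ∣ nz A h ∣) (line f h v)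
      -- Here h = 0, so the line stays at v and its function is constant.
      small h v zero    eq = ≡.subst (λ k → Below (internal k) (line f h v)) (≡.sym eq) (below-resp 1 (λ t → hom-cong hf
        (≈ᴹ-sym (≈ᴹ-trans (+ᴹ-congˡ (≈ᴹ-trans (*ₗ-congˡ h≈0) (*ₗ-zeroʳ t))) (+ᴹ-identityʳ v)))) (below-const (f v)))
        where
        h≈0 : h ≈ᴹ 0ᴹ
        h≈0 = essential h λ j → ∉nz⇒≈0 A {i = j} λ j∈ → ℕP.1+n≢0 (≡.trans (x∈p⇒suc∣p-x∣≡∣p∣ j∈) eq)
      small h v (suc k) eq = ≡.subst (λ k → Below (internal k) (line f h v)) (≡.sym eq)
        (degree⇒internal k (≡.subst (λ k → DegreeAtMost K (+ k ℤ.+ ℤ.- (+ 2)) (line f h v)) (≡.trans (ρ≡∣nz∣ A h) eq) (d h h≉0 v)))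
        where
        h≉0 : ¬ (h ≈ᴹ 0ᴹ)
        h≉0 h≈0 = ℕP.1+n≢0 (≡.trans (≡.sym eq) (∣nz∣-empty A λ j → trans (form-cong (A j) h≈0) (form-0 (A j))))

open import Data.Integer using (+_; -_; _-_)

proposition4p15 :
  ∀ {c ℓ₁ ℓ₂ m ℓm} (K : CharZeroField c ℓ₁ ℓ₂)
    (V : Module (CharZeroField.commutativeRing K) m ℓm) → FiniteDimensional K V →
  ∀ (n : ℕ) (A : Arrangement K V n) → Essential K V A →
  (rk : RankFunction K V A) →
  let open RawRing laurent using (_*_)
      open RawRing laurent using (0#)
      open RankFunction rk using (rank)
      r = rank ⊤
  in
  Σ[ hilb ∈ (ℕ → ℕ) ]
    IsHilbertSeries K V A (- (+ 2)) hilb ×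
    (∀ e → seriesCoefficient hilb e ≡
      coefficient (q^ (+ n - + r) * tutte laurent rank 0# (q^ (- (+ 1)))) e)
proposition4p15 K V fin n A essential rk = proj₁ result ,
  (λ i → dimension-resp (internal⇒Cᵢ A essential) (Cᵢ⇒internal A essential) (proj₁ (proj₂ result) i)) ,
  λ e → ≡.trans (proj₂ (proj₂ result) e) (≡.sym (TutteRecursion.coefficient-tutte (RankFunction.rank rk) e))
  where
  open HilbertSeries K V fin
  open LinearAlgebra K (functions K V)
  result = internal-hilbert A rk
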